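{- Let $T$ be a complete (multi-sorted) totally transcendental theory with quantifier elimination and elimination of imaginaries, $\overline{\mathcal M}\models T$ sufficiently saturated, $B$ a small set of parameters and $\mathcal C$ a $B$-definable set. Suppose $p\in S(B)$ is fundamental $\mathcal C$-internal and weakly $\mathcal C$-orthogonal. Then there exists a $B$-definable bitorsor $(\mathcal G,p(\overline{\mathcal M}),\widehat{\mathcal G})$ such that (a) $\mathcal G$ is the binding group for $p$ relative to $\mathcal C$ over $B$, and (b) $\widehat{\mathcal G}\subseteq\operatorname{dcl}(B\mathcal C)$.
   Context: $p\in S(B)$ is fundamental $\mathcal C$-internal if $p(\overline{\mathcal M})\subseteq\operatorname{dcl}(Ba\mathcal C)$ for some (equivalently any) $a\models p$. It is weakly $\mathcal C$-orthogonal if it isolates a complete type over $B\cup\mathcal C$. $\operatorname{Aut}_B(p/\mathcal C)$ denotes the group of restrictions to $p(\overline{\mathcal M})$ of automorphisms of $\overline{\mathcal M}$ fixing $B\cup\mathcal C$ pointwise. A (definable) binding group for $p$ relative to $\mathcal C$ over $B$ is a $B$-definable group $\mathcal G$ with a (relatively) $B$-definable faithful left action on $p(\overline{\mathcal M})$ such that there is a group isomorphism between $\mathcal G$ and $\operatorname{Aut}_B(p/\mathcal C)$ respecting the action on $p(\overline{\mathcal M})$. (For $p$ fundamental $\mathcal C$-internal and weakly $\mathcal C$-orthogonal it is unique up to $B$-definable isomorphism, so one says "the" binding group.) A bitorsor is a triple $(G,S,H)$ where $G$ is a group with a uniquely transitive left action on the set $S$, $H$ is a group with a uniquely transitive right action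 on $S$, and $(ga)h=g(ah)$ for all $g\in G$, $a\in S$, $h\in H$. It is $B$-definable if the groups, the set and the actions are all $B$-definable. -}

module Defs where

open import Level using (Level; suc; _⊔_)
open import Algebra.Bundles using (Group)
open import Algebra.Structures using (IsGroup)
open import Algebra.Morphism.Structures using (module GroupMorphisms)
open import Data.Empty.Polymorphic using (⊥)
open import Data.List.Base using (List; []; _∷_; _++_)
open import Data.List.Membership.Propositional renaming (_∈_ to _∋_) using ()
open import Data.List.Relation.Unary.All as All using (All; []; _∷_)
import Data.List.Relation.Unary.All.Properties as Allₚ
open Allₚ using () renaming (++⁺ to infixr 5 _++ᵗ_)
open import Data.List.Relation.Unary.Any using (here; there)
open import Data.Nat.Base using (ℕ)
open import Data.Product.Base using (Σ; ∃; Σ-syntax; ∃-syntax; _×_; _,_; proj₁; proj₂)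
open import Data.Product using (∃!)
open import Data.Sum.Base using (_⊎_; inj₁; inj₂)
open import Data.Unit.Polymorphic.Base using (⊤)
open import Function.Base using (_∘_; id)
open import Function.Bundles using (_⇔_; mk⇔; _↔_; _↣_; Inverse; Equivalence)
import Function.Construct.Composition as Comp
import Function.Construct.Identity as Ident
import Function.Construct.Symmetry as Symm
open import Induction.WellFounded using (WellFounded)
open import Relation.Binary.Bundles using (Setoid)
open import Relation.Binary.Core using () renaming (Rel to BinRel)
open import Relation.Binary.Structures using (IsEquivalence; IsStrictTotalOrder)
open import Relation.Binary.PropositionalEquality
  using (_≡_; _≢_; refl; sym; trans; cong; cong₂; subst)
open import Relation.Nullary.Negation using (¬_)
open import Relation.Unary using (Pred; _∈_; _⊆_; _∪_)

private
  variable
    ℓ : Level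

-- A cardinal is an initial ordinal: a well-order that does not inject into
-- any of its proper initial segments.  X has size < κ when it injects into
-- some proper initial segment of κ.

Below : {K A : Set ℓ} (_<_ : BinRel K ℓ) → Pred A ℓ → Set ℓ
Below {K = K} {A} _<_ X =
  ∃[ k ] Σ[ f ∈ (A → K) ]
    (∀ {x} → x ∈ X → f x < k) ×
    (∀ {x y} → x ∈ X → y ∈ X → f x ≡ f y → x ≡ y)

record Cardinal ℓ : Set (suc ℓ) where
  infix 4 _<_
  field
    Carrier            : Set ℓ
    _<_                : BinRel Carrier ℓ
    isStrictTotalOrder : IsStrictTotalOrder _≡_ _<_
    wellFounded        : WellFounded _<_
    initial            : ¬ Below {A = Carrier} _<_ (λ _ → ⊤)

SmallerThan : Cardinal ℓ → {A : Set ℓ} → Pred A ℓ → Set ℓ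
SmallerThan κ = Below (Cardinal._<_ κ)

record Language ℓ : Set (suc ℓ) where
  field
    Sort : Set ℓ
    Fun  : List Sort → Sort → Set ℓ
    Rel  : List Sort → Set ℓ

module _ (L : Language ℓ) where
  open Language L

  Context : Set ℓ
  Context = List Sort

  data Term (Γ : Context) : Sort → Set ℓ where
    var : ∀ {s} → s ∋ Γ → Term Γ s
    app : ∀ {Δ s} → Fun Δ s → All (Term Γ) Δ → Term Γ s

  infixr 5 _⇒_
  infix  6 _≐_

  data Formula (Γ : Context) : Set ℓ where
    _≐_ : ∀ {s} → Term Γ s → Term Γ s → Formula Γ
    rel : ∀ {Δ} → Rel Δ → All (Term Γ) Δ → Formula Γ
    ⊥̇   : Formula Γ
    _⇒_ : Formula Γ → Formula Γ → Formula Γ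
    ∀̇   : ∀ s → Formula (s ∷ Γ) → Formula Γ

  Sentence : Set ℓ
  Sentence = Formula []

  neg : ∀ {Γ} → Formula Γ → Formula Γ
  neg φ = φ ⇒ ⊥̇

  data QuantifierFree {Γ : Context} : Pred (Formula Γ) ℓ where
    _≐_ : ∀ {s} (t u : Term Γ s) → QuantifierFree (t ≐ u)
    rel : ∀ {Δ} (R : Rel Δ) (ts : All (Term Γ) Δ) → QuantifierFree (rel R ts)
    ⊥̇   : QuantifierFree ⊥̇
    _⇒_ : ∀ {φ ψ} → QuantifierFree φ → QuantifierFree ψ → QuantifierFree (φ ⇒ ψ)

  record Structure : Set (suc ℓ) where
    field
      Dom       : Sort → Set ℓ
      inhabited : ∀ s → Dom s
      fun       : ∀ {Δ s} → Fun Δ s → All Dom Δ → Dom s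
      relation  : ∀ {Δ} → Rel Δ → Pred (All Dom Δ) ℓ

module _ {L : Language ℓ} (M : Structure L) where
  open Language L
  open Structure M

  Tuple : Context L → Set ℓ
  Tuple = All Dom

  Element : Set ℓ
  Element = Σ Sort Dom

  mutual
    eval : ∀ {Γ s} → Tuple Γ → Term L Γ s → Dom s
    eval x (var i)    = All.lookup x i
    eval x (app f ts) = fun f (evals x ts)

    evals : ∀ {Γ Δ} → Tuple Γ → All (Term L Γ) Δ → Tuple Δ
    evals x []       = []
    evals x (t ∷ ts) = eval x t ∷ evals x ts

  Sat : ∀ {Γ} → Formula L Γ → Pred (Tuple Γ) ℓ
  Sat (t ≐ u)    x = eval x t ≡ eval x u
  Sat (rel R ts) x = relation R (evals x ts)
  Sat ⊥̇          x = ⊥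
  Sat (φ ⇒ ψ)    x = Sat φ x → Sat ψ x
  Sat (∀̇ s φ)    x = ∀ d → Sat φ (d ∷ x)

  Coords : ∀ {Γ} → Tuple Γ → Pred Element ℓ
  Coords {Γ} x (s , d) = Σ[ i ∈ s ∋ Γ ] All.lookup x i ≡ d

  -- For a set X of tuples, the parameter set "X" in B ∪ X is the set of
  -- coordinates of its members.
  CoordsOf : ∀ {Γ} → Pred (Tuple Γ) ℓ → Pred Element ℓ
  CoordsOf X e = ∃[ x ] x ∈ X × e ∈ Coords x

  record LFormula (A : Pred Element ℓ) (Γ : Context L) : Set ℓ where
    constructor _[_∣_]
    field
      {Params}   : Context L
      body       : Formula L (Params ++ Γ)
      params     : Tuple Params
      params⊆A   : Coords params ⊆ A

  Satᴸ : ∀ {A Γ} → LFormula A Γ → Pred (Tuple Γ) ℓ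
  Satᴸ (φ [ a ∣ _ ]) x = Sat φ (a ++ᵗ x)

  ¬ᴸ_ : ∀ {A Γ} → LFormula A Γ → LFormula A Γ
  ¬ᴸ (φ [ a ∣ a⊆A ]) = neg L φ [ a ∣ a⊆A ]

  Definable : Pred Element ℓ → ∀ {Γ} → Pred (Tuple Γ) ℓ → Set ℓ
  Definable A {Γ} X = Σ[ φ ∈ LFormula A Γ ] ∀ x → Satᴸ φ x ⇔ x ∈ X

  dcl : Pred Element ℓ → Pred Element ℓ
  dcl A (s , d) =
    Σ[ φ ∈ LFormula A (s ∷ []) ]
      Satᴸ φ (d ∷ []) × (∀ d′ → Satᴸ φ (d′ ∷ []) → d′ ≡ d)

  Realisations : ∀ {A Γ} → Pred (LFormula A Γ) ℓ → Pred (Tuple Γ) ℓ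
  Realisations p x = ∀ {φ} → φ ∈ p → Satᴸ φ x

  FinitelySatisfiable : ∀ {A Γ} → Pred (LFormula A Γ) ℓ → Set ℓ
  FinitelySatisfiable p = ∀ φs → All p φs → ∃[ x ] All (λ φ → Satᴸ φ x) φs

  -- The complete types over A in the variables Γ: maximal finitely
  -- satisfiable sets of formulas with parameters in A.
  record CompleteType (A : Pred Element ℓ) (Γ : Context L) : Set (suc ℓ) where
    field
      formulas    : Pred (LFormula A Γ) ℓ
      satisfiable : FinitelySatisfiable formulas
      complete    : ∀ φ → φ ∈ formulas ⊎ (¬ᴸ φ) ∈ formulas

  -- p ⊢ ψ: finitely many formulas of p imply ψ.
  Entails : ∀ {A A′ Γ} → Pred (LFormula A Γ) ℓ → Pred (LFormula A′ Γ) ℓ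
  Entails p ψ = ∃[ φs ] All p φs × (∀ x → All (λ φ → Satᴸ φ x) φs → Satᴸ ψ x)

  RealisesTypesOver : Pred Element ℓ → Set (suc ℓ)
  RealisesTypesOver A =
    ∀ {Γ} (q : Pred (LFormula A Γ) ℓ) → FinitelySatisfiable q → ∃ (Realisations q)

  ℵ₀-Saturated : Set (suc ℓ)
  ℵ₀-Saturated = ∀ {Δ} (a : Tuple Δ) → RealisesTypesOver (Coords a)

  -- M is saturated in its own cardinality κ > |T|, where |T| is the number of
  -- L-formulas.  The size is only bounded by κ: a structure with all sorts
  -- finite realises every type over every parameter set.
  record SaturatedIn (κ : Cardinal ℓ) : Set (suc ℓ) where
    field
      language<κ : SmallerThan κ {A = Σ (Context L) (Formula L)} (λ _ → ⊤)
      size≤κ     : Element ↣ Cardinal.Carrier κ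
      saturated  : ∀ A → SmallerThan κ A → RealisesTypesOver A

module _ {L : Language ℓ} where

  infix 4 _⊨ᵀ_
  _⊨ᵀ_ : Structure L → Pred (Sentence L) ℓ → Set ℓ
  M ⊨ᵀ T = ∀ {σ} → σ ∈ T → Sat M σ []

  module _ (T : Pred (Sentence L) ℓ) where

    Complete : Set (suc ℓ)
    Complete =
      (∃[ N ] N ⊨ᵀ T) ×
      (∀ σ → (∀ N → N ⊨ᵀ T → Sat N σ []) ⊎ (∀ N → N ⊨ᵀ T → ¬ Sat N σ []))

    QuantifierElimination : Set (suc ℓ)
    QuantifierElimination =
      ∀ {Γ} (φ : Formula L Γ) →
        Σ[ ψ ∈ Formula L Γ ] QuantifierFree L ψ ×
          (∀ N → N ⊨ᵀ T → ∀ x → Sat N φ x ⇔ Sat N ψ x)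

    -- Every ∅-definable equivalence relation is the kernel of a ∅-definable
    -- function into a finite product of sorts.
    EliminationOfImaginaries : Set (suc ℓ)
    EliminationOfImaginaries =
      ∀ {Γ} (E : Formula L (Γ ++ Γ)) →
        (∀ N → N ⊨ᵀ T → IsEquivalence (λ (x y : Tuple N Γ) → Sat N E (x ++ᵗ y))) →
        ∃[ Δ ] Σ[ F ∈ Formula L (Γ ++ Δ) ]
          (∀ N → N ⊨ᵀ T →
            (∀ (x : Tuple N Γ) → ∃! _≡_ (λ (d : Tuple N Δ) → Sat N F (x ++ᵗ d))) ×
            (∀ (x y : Tuple N Γ) →
               Sat N E (x ++ᵗ y) ⇔
               (Σ[ d ∈ Tuple N Δ ] Sat N F (x ++ᵗ d) × Sat N F (y ++ᵗ d))))

-- Tree notation for ordinals: sup f denotes the least ordinal > every f i.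
data Ordinal ℓ : Set (suc ℓ) where
  sup : {I : Set ℓ} → (I → Ordinal ℓ) → Ordinal ℓ

-- RM φ ≥ α.  It requires φ to be consistent, and for every β < α infinitely
-- many pairwise inconsistent formulas of rank ≥ β implying φ.
MorleyRank≥ : {L : Language ℓ} (N : Structure L) {Γ : Context L} →
              Ordinal ℓ → Pred (LFormula N (λ _ → ⊤) Γ) ℓ
MorleyRank≥ N {Γ} (sup {I} f) φ =
  ∃ (Satᴸ N φ) ×
  (∀ i → Σ[ ψ ∈ (ℕ → LFormula N _ Γ) ]
    (∀ n x → Satᴸ N (ψ n) x → Satᴸ N φ x) ×
    (∀ m n → m ≢ n → ∀ x → ¬ (Satᴸ N (ψ m) x × Satᴸ N (ψ n) x)) ×
    (∀ n → MorleyRank≥ N (f i) (ψ n)))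

-- Every formula over a model has ordinal Morley rank (or rank −∞); ranks are
-- computed in ℵ₀-saturated models.
TotallyTranscendental : {L : Language ℓ} → Pred (Sentence L) ℓ → Set (suc ℓ)
TotallyTranscendental {ℓ} T =
  ∀ N → N ⊨ᵀ T → ℵ₀-Saturated N →
  ∀ {Γ} (φ : LFormula N (λ _ → ⊤) Γ) →
  Σ[ α ∈ Ordinal ℓ ] ¬ MorleyRank≥ N α φ

module _ {L : Language ℓ} (M : Structure L) where
  open Language L
  open Structure M

  record Automorphism : Set ℓ where
    field
      bijection : ∀ s → Dom s ↔ Dom s

    to : ∀ {s} → Dom s → Dom s
    to {s} = Inverse.to (bijection s)

    from : ∀ {s} → Dom s → Dom s
    from {s} = Inverse.from (bijection s)

    field
      preserves-fun : ∀ {Δ s} (f : Fun Δ s) xs → to (fun f xs) ≡ fun f (All.map to xs)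
      preserves-rel : ∀ {Δ} (R : Rel Δ) xs → relation R xs ⇔ relation R (All.map to xs)

    to∘from : ∀ {s} (d : Dom s) → to (from d) ≡ d
    to∘from {s} d = Inverse.inverseˡ (bijection s) refl

    from∘to : ∀ {s} (d : Dom s) → from (to d) ≡ d
    from∘to {s} d = Inverse.inverseʳ (bijection s) refl

  open Automorphism

  infixr 8 _$ᵗ_
  _$ᵗ_ : ∀ {Γ} → Automorphism → Tuple M Γ → Tuple M Γ
  σ $ᵗ x = All.map (to σ) x

  idᴬ : Automorphism
  idᴬ = record
    { bijection     = λ s → Ident.↔-id (Dom s)
    ; preserves-fun = λ f xs → cong (fun f) (sym (Allₚ.map-id xs))
    ; preserves-rel = λ R xs →
        mk⇔ (subst (relation R) (sym (Allₚ.map-id xs)))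
            (subst (relation R) (Allₚ.map-id xs))
    }

  infixr 9 _∘ᴬ_
  _∘ᴬ_ : Automorphism → Automorphism → Automorphism
  σ ∘ᴬ τ = record
    { bijection     = λ s → bijection σ s Comp.↔-∘ bijection τ s
    ; preserves-fun = λ f xs →
        trans (cong (to σ) (preserves-fun τ f xs))
       (trans (preserves-fun σ f (τ $ᵗ xs))
              (cong (fun f) (Allₚ.map-∘ xs)))
    ; preserves-rel = λ R xs →
        let module τR = Equivalence (preserves-rel τ R xs)
            module σR = Equivalence (preserves-rel σ R (τ $ᵗ xs))
        in mk⇔ (λ r → subst (relation R) (Allₚ.map-∘ xs) (σR.to (τR.to r)))
               (λ r → τR.from (σR.from (subst (relation R) (sym (Allₚ.map-∘ xs)) r)))
    }

  private
    map-inverse : ∀ {Γ} {f g : ∀ {s} → Dom s → Dom s} →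
                  (∀ {s} (d : Dom s) → f (g d) ≡ d) →
                  (x : Tuple M Γ) → All.map f (All.map g x) ≡ x
    map-inverse fg []      = refl
    map-inverse fg (d ∷ x) = cong₂ _∷_ (fg d) (map-inverse fg x)

  infix 10 _⁻¹ᴬ
  _⁻¹ᴬ : Automorphism → Automorphism
  σ ⁻¹ᴬ = record
    { bijection     = λ s → Symm.↔-sym (bijection σ s)
    ; preserves-fun = λ f xs →
        trans (cong (from σ ∘ fun f) (sym (map-inverse (to∘from σ) xs)))
       (trans (cong (from σ) (sym (preserves-fun σ f (All.map (from σ) xs))))
              (from∘to σ _))
    ; preserves-rel = λ R xs →
        let module σR = Equivalence (preserves-rel σ R (All.map (from σ) xs))
        in mk⇔ (λ r → σR.from (subst (relation R) (sym (map-inverse (to∘from σ) xs)) r))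
               (λ r → subst (relation R) (map-inverse (to∘from σ) xs) (σR.to r))
    }

  ∘ᴬ-$ᵗ : ∀ {Γ} σ τ (x : Tuple M Γ) → (σ ∘ᴬ τ) $ᵗ x ≡ σ $ᵗ τ $ᵗ x
  ∘ᴬ-$ᵗ σ τ x = sym (Allₚ.map-∘ x)

  ⁻¹ᴬ-$ᵗ-$ᵗ : ∀ {Γ} σ (x : Tuple M Γ) → (σ ⁻¹ᴬ) $ᵗ σ $ᵗ x ≡ x
  ⁻¹ᴬ-$ᵗ-$ᵗ σ = map-inverse (from∘to σ)

  $ᵗ-⁻¹ᴬ-$ᵗ : ∀ {Γ} σ (x : Tuple M Γ) → σ $ᵗ (σ ⁻¹ᴬ) $ᵗ x ≡ x
  $ᵗ-⁻¹ᴬ-$ᵗ σ = map-inverse (to∘from σ)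

  idᴬ-$ᵗ : ∀ {Γ} (x : Tuple M Γ) → idᴬ $ᵗ x ≡ x
  idᴬ-$ᵗ = Allₚ.map-id

  lookup-map : ∀ {Γ s} (σ : Automorphism) (x : Tuple M Γ) (i : s ∋ Γ) →
               All.lookup (σ $ᵗ x) i ≡ to σ (All.lookup x i)
  lookup-map σ (d ∷ x) (here refl) = refl
  lookup-map σ (d ∷ x) (there i)   = lookup-map σ x i

  $ᵗ-++ᵗ : ∀ {Γ Δ} (σ : Automorphism) (x : Tuple M Γ) (y : Tuple M Δ) →
           σ $ᵗ (x ++ᵗ y) ≡ (σ $ᵗ x) ++ᵗ (σ $ᵗ y)
  $ᵗ-++ᵗ σ []      y = refl
  $ᵗ-++ᵗ σ (d ∷ x) y = cong (to σ d ∷_) ($ᵗ-++ᵗ σ x y)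

  mutual
    eval-$ᵗ : ∀ {Γ s} (σ : Automorphism) (x : Tuple M Γ) (t : Term L Γ s) →
              to σ (eval M x t) ≡ eval M (σ $ᵗ x) t
    eval-$ᵗ σ x (var i)    = sym (lookup-map σ x i)
    eval-$ᵗ σ x (app f ts) =
      trans (preserves-fun σ f _) (cong (fun f) (evals-$ᵗ σ x ts))

    evals-$ᵗ : ∀ {Γ Δ} (σ : Automorphism) (x : Tuple M Γ) (ts : All (Term L Γ) Δ) →
               σ $ᵗ evals M x ts ≡ evals M (σ $ᵗ x) ts
    evals-$ᵗ σ x []       = refl
    evals-$ᵗ σ x (t ∷ ts) = cong₂ _∷_ (eval-$ᵗ σ x t) (evals-$ᵗ σ x ts)

  Sat-$ᵗ : ∀ {Γ} (σ : Automorphism) (φ : Formula L Γ) (x : Tuple M Γ) →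
           Sat M φ x ⇔ Sat M φ (σ $ᵗ x)
  Sat-$ᵗ σ (t ≐ u) x = mk⇔
    (λ e → trans (sym (eval-$ᵗ σ x t)) (trans (cong (to σ) e) (eval-$ᵗ σ x u)))
    (λ e → trans (sym (from∘to σ _))
          (trans (cong (from σ) (trans (eval-$ᵗ σ x t) (trans e (sym (eval-$ᵗ σ x u)))))
                 (from∘to σ _)))
  Sat-$ᵗ σ (rel R ts) x = mk⇔
    (λ r → subst (relation R) (evals-$ᵗ σ x ts) (Equivalence.to (preserves-rel σ R _) r))
    (λ r → Equivalence.from (preserves-rel σ R _) (subst (relation R) (sym (evals-$ᵗ σ x ts)) r))
  Sat-$ᵗ σ ⊥̇ x = mk⇔ id id
  Sat-$ᵗ σ (φ ⇒ ψ) x = mk⇔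
    (λ h s → Equivalence.to (Sat-$ᵗ σ ψ x) (h (Equivalence.from (Sat-$ᵗ σ φ x) s)))
    (λ h s → Equivalence.from (Sat-$ᵗ σ ψ x) (h (Equivalence.to (Sat-$ᵗ σ φ x) s)))
  Sat-$ᵗ σ (∀̇ s φ) x = mk⇔
    (λ h d → subst (λ e → Sat M φ (e ∷ σ $ᵗ x)) (to∘from σ d)
               (Equivalence.to (Sat-$ᵗ σ φ (from σ d ∷ x)) (h (from σ d))))
    (λ h d → Equivalence.from (Sat-$ᵗ σ φ (d ∷ x)) (h (to σ d)))

  Fixes : Pred (Element M) ℓ → Pred Automorphism ℓ
  Fixes A σ = ∀ {s} {d : Dom s} → (s , d) ∈ A → to σ d ≡ d

  Fixes-⁻¹ : ∀ {A} σ → Fixes A σ → Fixes A (σ ⁻¹ᴬ)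
  Fixes-⁻¹ σ fix a = trans (cong (from σ) (sym (fix a))) (from∘to σ _)

  fixes-tuple : ∀ {A Γ} σ → Fixes A σ → (x : Tuple M Γ) → Coords M x ⊆ A → σ $ᵗ x ≡ x
  fixes-tuple σ fix []      x⊆A = refl
  fixes-tuple σ fix (d ∷ x) x⊆A =
    cong₂ _∷_ (fix (x⊆A (here refl , refl)))
              (fixes-tuple σ fix x (λ (i , e) → x⊆A (there i , e)))

  $ᵗ-realises : ∀ {B Γ} (p : Pred (LFormula M B Γ) ℓ) σ → Fixes B σ →
                ∀ {a} → a ∈ Realisations M p → σ $ᵗ a ∈ Realisations M p
  $ᵗ-realises p σ fix {a} a⊨p {φ [ b ∣ b⊆B ]} φ∈p =
    subst (Sat M φ)
      (trans ($ᵗ-++ᵗ σ b a) (cong (λ c → c ++ᵗ (σ $ᵗ a)) (fixes-tuple σ fix b b⊆B)))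
      (Equivalence.to (Sat-$ᵗ σ φ _) (a⊨p φ∈p))

  -- Aut_B(p/𝒞).  A restriction to p(M) is represented by an automorphism
  -- inducing it, and two automorphisms are identified when they agree on p(M).
  module _ {B : Pred (Element M) ℓ} {Γ Θ : Context L}
           (p : CompleteType M B Γ) (𝒞 : Pred (Tuple M Θ) ℓ) where
    open CompleteType p

    private
      FixesB : ∀ {σ} → Fixes (B ∪ CoordsOf M 𝒞) σ → Fixes B σ
      FixesB fix b = fix (inj₁ b)

    AutGroup : Group ℓ ℓ
    AutGroup = record
      { Carrier = Σ Automorphism (Fixes (B ∪ CoordsOf M 𝒞))
      ; _≈_     = λ (σ , _) (τ , _) → ∀ {a} → a ∈ Realisations M formulas → σ $ᵗ a ≡ τ $ᵗ a
      ; _∙_     = λ (σ , σ-fix) (τ , τ-fix) →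
                    σ ∘ᴬ τ , λ c → trans (cong (to σ) (τ-fix c)) (σ-fix c)
      ; ε       = idᴬ , λ _ → refl
      ; _⁻¹     = λ (σ , σ-fix) → σ ⁻¹ᴬ , Fixes-⁻¹ σ σ-fix
      ; isGroup = record
        { isMonoid = record
          { isSemigroup = record
            { isMagma = record
              { isEquivalence = record
                { refl  = λ _ → refl
                ; sym   = λ e a → sym (e a)
                ; trans = λ e e′ a → trans (e a) (e′ a)
                }
              ; ∙-cong = λ {(σ , _)} {(σ′ , _)} {(τ , τ-fix)} {(τ′ , _)} σ≈σ′ τ≈τ′ {a} a⊨p →
                  trans (∘ᴬ-$ᵗ σ τ a)
                 (trans (σ≈σ′ ($ᵗ-realises formulas τ (FixesB {τ} τ-fix) a⊨p))
                 (trans (cong (σ′ $ᵗ_) (τ≈τ′ a⊨p)) (sym (∘ᴬ-$ᵗ σ′ τ′ a))))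
              }
            ; assoc = λ _ _ _ _ → refl
            }
          ; identity = (λ _ _ → refl) , (λ _ _ → refl)
          }
        ; inverse =
            (λ (σ , _) {a} _ →
              trans (∘ᴬ-$ᵗ (σ ⁻¹ᴬ) σ a) (trans (⁻¹ᴬ-$ᵗ-$ᵗ σ a) (sym (idᴬ-$ᵗ a)))) ,
            (λ (σ , _) {a} _ →
              trans (∘ᴬ-$ᵗ σ (σ ⁻¹ᴬ) a) (trans ($ᵗ-⁻¹ᴬ-$ᵗ σ a) (sym (idᴬ-$ᵗ a))))
        ; ⁻¹-cong = λ {(σ , _)} {(τ , τ-fix)} σ≈τ {a} a⊨p →
            let b     = (τ ⁻¹ᴬ) $ᵗ a
                b⊨p   = $ᵗ-realises formulas (τ ⁻¹ᴬ) (FixesB {τ ⁻¹ᴬ} (Fixes-⁻¹ τ τ-fix)) a⊨p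
                σb≡a  = trans (σ≈τ b⊨p) ($ᵗ-⁻¹ᴬ-$ᵗ τ a)
            in trans (cong ((σ ⁻¹ᴬ) $ᵗ_) (sym σb≡a)) (⁻¹ᴬ-$ᵗ-$ᵗ σ b)
        }
      }

record LeftAction {g s} (G : Group g g) (S : Setoid s s) : Set (g ⊔ s) where
  private
    module G = Group G
    module S = Setoid S
  infixr 7 _·_
  field
    _·_      : G.Carrier → S.Carrier → S.Carrier
    ·-cong   : ∀ {g h a b} → g G.≈ h → a S.≈ b → (g · a) S.≈ (h · b)
    identity : ∀ a → (G.ε · a) S.≈ a
    assoc    : ∀ g h a → ((g G.∙ h) · a) S.≈ (g · h · a)

  UniquelyTransitive : Set (g ⊔ s)
  UniquelyTransitive = ∀ a b → ∃! G._≈_ (λ g → (g · a) S.≈ b)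

  Faithful : Set (g ⊔ s)
  Faithful = ∀ g h → (∀ a → (g · a) S.≈ (h · a)) → g G.≈ h

record RightAction {h s} (S : Setoid s s) (H : Group h h) : Set (h ⊔ s) where
  private
    module H = Group H
    module S = Setoid S
  infixl 7 _·_
  field
    _·_      : S.Carrier → H.Carrier → S.Carrier
    ·-cong   : ∀ {a b g h} → a S.≈ b → g H.≈ h → (a · g) S.≈ (b · h)
    identity : ∀ a → (a · H.ε) S.≈ a
    assoc    : ∀ a g h → (a · (g H.∙ h)) S.≈ (a · g · h)

  UniquelyTransitive : Set (h ⊔ s)
  UniquelyTransitive = ∀ a b → ∃! H._≈_ (λ h → (a · h) S.≈ b)

record IsBitorsor {ℓ} {G H : Group ℓ ℓ} {S : Setoid ℓ ℓ}
                  (left : LeftAction G S) (right : RightAction S H) : Set ℓ where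
  private
    module L = LeftAction left
    module R = RightAction right
  field
    left-uniquelyTransitive  : L.UniquelyTransitive
    right-uniquelyTransitive : R.UniquelyTransitive
    compatible : ∀ g a h → Setoid._≈_ S (R._·_ (L._·_ g a) h) (L._·_ g (R._·_ a h))

module _ {L : Language ℓ} (M : Structure L) where

  setoidOf : ∀ {Γ} → Pred (Tuple M Γ) ℓ → Setoid ℓ ℓ
  setoidOf X = record
    { Carrier       = ∃ X
    ; _≈_           = λ x y → proj₁ x ≡ proj₁ y
    ; isEquivalence = record { refl = refl ; sym = sym ; trans = trans }
    }

  -- The graph of f is the intersection of a B-definable set with X × Y × Z.
  RelativelyDefinable : Pred (Element M) ℓ → ∀ {Γ Δ Θ}
    {X : Pred (Tuple M Γ) ℓ} {Y : Pred (Tuple M Δ) ℓ} {Z : Pred (Tuple M Θ) ℓ} →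
    (∃ X → ∃ Y → ∃ Z) → Set ℓ
  RelativelyDefinable B {Γ} {Δ} {Θ} {Z = Z} f =
    Σ[ θ ∈ LFormula M B (Γ ++ (Δ ++ Θ)) ]
      ∀ x y (z : ∃ Z) →
        Satᴸ M θ (proj₁ x ++ᵗ proj₁ y ++ᵗ proj₁ z) ⇔
        (proj₁ (f x y) ≡ proj₁ z)

  record DefinableGroup (B : Pred (Element M) ℓ) : Set (suc ℓ) where
    field
      {Vars}    : Context L
      set       : Pred (Tuple M Vars) ℓ
      definable : Definable M B set
      _∙_       : ∃ set → ∃ set → ∃ set
      ε         : ∃ set
      _⁻¹       : ∃ set → ∃ set
      isGroup   : IsGroup (Setoid._≈_ (setoidOf set)) _∙_ ε _⁻¹
      ∙-definable : RelativelyDefinable B {X = set} {Y = set} {Z = set} _∙_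

    group : Group ℓ ℓ
    group = record { isGroup = isGroup }

  record DefinableBitorsor (B : Pred (Element M) ℓ) {Γ : Context L}
                           (S : Pred (Tuple M Γ) ℓ) : Set (suc ℓ) where
    field
      G H         : DefinableGroup B
      S-definable : Definable M B S
      left        : LeftAction (DefinableGroup.group G) (setoidOf S)
      right       : RightAction (setoidOf S) (DefinableGroup.group H)
      isBitorsor  : IsBitorsor left right
      left-definable  : RelativelyDefinable B {X = DefinableGroup.set G} {Y = S} {Z = S}
                          (LeftAction._·_ left)
      right-definable : RelativelyDefinable B {X = S} {Y = DefinableGroup.set H} {Z = S}
                          (RightAction._·_ right)

  module _ {B : Pred (Element M) ℓ} {Γ Θ : Context L}
           (p : CompleteType M B Γ) (𝒞 : Pred (Tuple M Θ) ℓ) where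
    open CompleteType p

    FundamentalInternal : Set ℓ
    FundamentalInternal =
      ∃[ a ] a ∈ Realisations M formulas ×
        (∀ b → b ∈ Realisations M formulas →
           Coords M b ⊆ dcl M (B ∪ (Coords M a ∪ CoordsOf M 𝒞)))

    WeaklyOrthogonal : Set (suc ℓ)
    WeaklyOrthogonal =
      Σ[ q ∈ CompleteType M (B ∪ CoordsOf M 𝒞) Γ ]
        (∀ {ψ} → ψ ∈ CompleteType.formulas q → Entails M formulas ψ)

    record IsBindingGroup (G : DefinableGroup B)
        (action : LeftAction (DefinableGroup.group G) (setoidOf (Realisations M formulas))) :
        Set ℓ where
      private
        module G = DefinableGroup G
        P = Realisations M formulas
      open LeftAction action
      open GroupMorphisms (Group.rawGroup G.group) (Group.rawGroup (AutGroup M p 𝒞))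
      field
        faithful         : Faithful
        action-definable : RelativelyDefinable B {X = G.set} {Y = P} {Z = P} _·_
        ⟦_⟧              : ∃ G.set → Group.Carrier (AutGroup M p 𝒞)
        isIsomorphism    : IsGroupIsomorphism ⟦_⟧
        respects-action  : ∀ g a → proj₁ (g · a) ≡ _$ᵗ_ M (proj₁ ⟦ g ⟧) (proj₁ a)

{-# OPTIONS --safe #-}
-- Put D = B ∪ 𝒞 and P = p(M).  Total transcendence makes 𝒞 stably embedded
-- (Shelah's 2-rank is finite), so in a back-and-forth of length κ over D it is
-- enough to realise, at each step, a type over a small part of 𝒞; hence any two
-- realisations of p are conjugate under Aut(M/D).  By internality and
-- compactness, finitely many B-definable partial functions f(c, x), with c from
-- 𝒞, link any two realisations of p.  So an automorphism over D is determined
-- on P by the image of one point, and since isolated types over D are dense, p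
-- is isolated and P is B-definable.
--
-- Thus P is a torsor under Aut_B(p/𝒞).  Its heap operation x a⁻¹ b, the image of
-- b under the automorphism taking a to x, is B-definable: z = x a⁻¹ b iff
-- b = f(c, a) and z = f(c, x) for some f and c.  The translations x ↦ b a⁻¹ x and
-- x ↦ x a⁻¹ b, coded by eliminating imaginaries, form 𝒢 and 𝒢̂.  The second one
-- is determined by any c with b = f(c, a), so its code lies in dcl(B𝒞).

module Submission where

open import Defs
open import Level using (Level; Lift; lower) renaming (lift to ↑)
open import Axiom.ExcludedMiddle using (ExcludedMiddle)
open import Algebra.Bundles using (Group)
import Algebra.Properties.Group as GroupProperties
open import Algebra.Structures using (IsGroup)
open import Data.Empty using (⊥-elim)
open import Data.List.Base using (List; []; _∷_; _++_; concat; length; drop; head)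
open import Data.List.Membership.Propositional using () renaming (_∈_ to _∈ˡ_)
open import Data.List.Membership.Propositional using () renaming (_∈_ to _∋_)
open import Data.List.Properties using (∷-injective)
open import Data.List.Relation.Unary.All as All using (All; []; _∷_)
import Data.List.Relation.Unary.All.Properties as Allₚ
open Allₚ using () renaming (++⁺ to infixr 5 _++ᵗ_)
open import Data.List.Relation.Unary.Any using (Any; here; there)
open import Data.Maybe.Base using (just)
open import Data.Maybe.Properties using (just-injective)
import Data.Nat.Base as ℕ
open ℕ using (ℕ; zero; suc)
import Data.Nat.Properties as ℕₚ
open import Data.Product using (∃!)
open import Data.Product.Base
  using (Σ; ∃; Σ-syntax; ∃-syntax; _×_; _,_; proj₁; proj₂; swap)
open import Data.Product.Relation.Binary.Lex.Strict using (×-Lex; ×-wellFounded)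
open import Data.Sum.Base using (_⊎_; inj₁; inj₂; [_,_])
open import Data.Unit.Polymorphic.Base using (⊤)
open import Function.Base using (_∘_; id; _on_)
open import Function.Bundles using (_⇔_; mk⇔; Equivalence; mk↔ₛ′; Injection)
open import Induction.WellFounded as WF using (Acc; acc; WellFounded)
import Relation.Binary.Construct.On as On
open import Relation.Binary.Core using () renaming (Rel to BinRel)
open import Relation.Binary.Definitions using (tri<; tri≈; tri>)
open import Relation.Binary.PropositionalEquality
  using (_≡_; _≢_; refl; sym; trans; cong; cong₂; subst; subst₂)
open import Relation.Binary.Structures using (IsEquivalence; IsStrictTotalOrder)
open import Relation.Nullary using (yes; no; ¬_)
open import Relation.Unary using (Pred; _∈_; _⊆_; _∪_)

-- Saturation realises types only over sets of size below κ, while D contains all of 𝒞. This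
-- obstacle shapes the proof that realisations of p are conjugate: at each step the type of the new
-- element over D has to be controlled by a small set. That set consists of parameters defining the
-- traces, on powers of 𝒞, of the formulas over the part of the map built so far. Traces are handled
-- by a 2-rank because each of its finite values is expressed by a first-order formula, which fails
-- for Morley rank in general. Morley rank serves only to forbid families of formulas in which every
-- member splits in two again. That the map stays small at each stage is cardinal arithmetic: the
-- stages are finite lists indexed by a segment of κ, and an injection of m × m into m for infinite
-- m bounds their union. The finite cover by partial functions has to hold on a formula of p and not
-- just on realisations of p, because the isolated type found inside that formula is not known to be
-- p at first. The base point used to multiply translations may fail to be B-definable, so the graph
-- of the product is described by the action on all of P.

private
  variable
    ℓ ℓ₁ : Level

-- Renamings of variables and their effect on tuples.

module _ {S : Set ℓ} where
  private
    variable
      Γ Δ Θ Ξ : List S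

  -- A renaming is itself a tuple, so that tuple operations such as `_++ᵗ_` build renamings, and
  -- `pull` serves both to reindex tuples and to compose renamings.
  Ren : List S → List S → Set ℓ
  Ren Γ Δ = All (_∋ Δ) Γ

  pull : {P : Pred S ℓ₁} → Ren Γ Δ → All P Δ → All P Γ
  pull ρ x = All.map (All.lookup x) ρ

  infixr 9 _⨾_
  _⨾_ : Ren Γ Δ → Ren Δ Θ → Ren Γ Θ
  ρ ⨾ ρ′ = pull ρ ρ′

  wk : ∀ {s} → Ren Γ Δ → Ren Γ (s ∷ Δ)
  wk = All.map there

  idʳ : Ren Γ Γ
  idʳ {Γ = []}    = []
  idʳ {Γ = s ∷ Γ} = here refl ∷ wk idʳ

  liftʳ : ∀ {s} → Ren Γ Δ → Ren (s ∷ Γ) (s ∷ Δ)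
  liftʳ ρ = here refl ∷ wk ρ

  inlʳ : Ren Γ (Γ ++ Δ)
  inlʳ {Γ = []}    = []
  inlʳ {Γ = s ∷ Γ} = here refl ∷ wk inlʳ

  inrʳ : Ren Δ (Γ ++ Δ)
  inrʳ {Γ = []}    = idʳ
  inrʳ {Γ = s ∷ Γ} = wk inrʳ

  block : ∀ {Γ} {Γs : List (List S)} → Γ ∋ Γs → Ren Γ (concat Γs)
  block (here refl)           = inlʳ
  block {Γs = Δ ∷ _} (there v) = block v ⨾ inrʳ {Γ = Δ}

  blocks : ∀ {Γs Δs : List (List S)} → All (_∋ Γs) Δs → Ren (concat Δs) (concat Γs)
  blocks vs = Allₚ.concat⁺ (All.map block vs)

  module _ {P : Pred S ℓ₁} where

    lookup-pull : (ρ : Ren Γ Δ) (x : All P Δ) → ∀ {s} (i : s ∋ Γ) →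
                  All.lookup (pull ρ x) i ≡ All.lookup x (All.lookup ρ i)
    lookup-pull (j ∷ ρ) x (here refl) = refl
    lookup-pull (j ∷ ρ) x (there i)   = lookup-pull ρ x i

    pull-wk : ∀ {s} (ρ : Ren Γ Δ) {d : P s} (x : All P Δ) → pull (wk ρ) (d ∷ x) ≡ pull ρ x
    pull-wk []      x = refl
    pull-wk (j ∷ ρ) x = cong (_ ∷_) (pull-wk ρ x)

    pull-id : (x : All P Γ) → pull idʳ x ≡ x
    pull-id []      = refl
    pull-id (d ∷ x) = cong (d ∷_) (trans (pull-wk idʳ x) (pull-id x))

    pull-⨾ : (ρ : Ren Γ Δ) (ρ′ : Ren Δ Θ) (x : All P Θ) →
             pull (ρ ⨾ ρ′) x ≡ pull ρ (pull ρ′ x)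
    pull-⨾ []      ρ′ x = refl
    pull-⨾ (i ∷ ρ) ρ′ x = cong₂ _∷_ (sym (lookup-pull ρ′ x i)) (pull-⨾ ρ ρ′ x)

    pull-++ : (ρ : Ren Γ Θ) (ρ′ : Ren Δ Θ) (x : All P Θ) →
              pull (ρ ++ᵗ ρ′) x ≡ pull ρ x ++ᵗ pull ρ′ x
    pull-++ []      ρ′ x = refl
    pull-++ (i ∷ ρ) ρ′ x = cong (_ ∷_) (pull-++ ρ ρ′ x)

    pull-inl : (x : All P Γ) (y : All P Δ) → pull inlʳ (x ++ᵗ y) ≡ x
    pull-inl []      y = refl
    pull-inl (d ∷ x) y = cong (d ∷_) (trans (pull-wk inlʳ (x ++ᵗ y)) (pull-inl x y))

    pull-inr : (x : All P Γ) (y : All P Δ) → pull (inrʳ {Γ = Γ}) (x ++ᵗ y) ≡ y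
    pull-inr []      y = pull-id y
    pull-inr (_∷_ {xs = Γ} d x) y = trans (pull-wk (inrʳ {Γ = Γ}) (x ++ᵗ y)) (pull-inr x y)

    pull-⊕ : (ρ : Ren Γ Θ) (ρ′ : Ren Δ Θ) (w : All P Θ) {x : All P Γ} {y : All P Δ} →
             pull ρ w ≡ x → pull ρ′ w ≡ y → pull (ρ ++ᵗ ρ′) w ≡ x ++ᵗ y
    pull-⊕ ρ ρ′ w p q = trans (pull-++ ρ ρ′ w) (cong₂ _++ᵗ_ p q)

    pull-⨾inl : (ρ : Ren Γ Δ) (x : All P Δ) (y : All P Θ) →
                pull (ρ ⨾ inlʳ) (x ++ᵗ y) ≡ pull ρ x
    pull-⨾inl ρ x y = trans (pull-⨾ ρ inlʳ (x ++ᵗ y)) (cong (pull ρ) (pull-inl x y))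

    pull-⨾inr : (ρ : Ren Γ Δ) (x : All P Θ) (y : All P Δ) →
                pull (ρ ⨾ inrʳ {Γ = Θ}) (x ++ᵗ y) ≡ pull ρ y
    pull-⨾inr {Θ = Θ} ρ x y =
      trans (pull-⨾ ρ (inrʳ {Γ = Θ}) (x ++ᵗ y)) (cong (pull ρ) (pull-inr x y))

    pull-block : ∀ {Γ Γs} (v : Γ ∋ Γs) (e : All (All P) Γs) →
                 pull (block v) (Allₚ.concat⁺ e) ≡ All.lookup e v
    pull-block (here refl) (x ∷ e) = pull-inl x (Allₚ.concat⁺ e)
    pull-block (there v) (x ∷ e) =
      trans (pull-⨾inr (block v) x (Allₚ.concat⁺ e)) (pull-block v e)

    pull-blocks : ∀ {Γs Δs} (vs : All (_∋ Γs) Δs) (e : All (All P) Γs) →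
                  pull (blocks vs) (Allₚ.concat⁺ e) ≡ Allₚ.concat⁺ (All.map (All.lookup e) vs)
    pull-blocks []       e = refl
    pull-blocks (v ∷ vs) e =
      pull-⊕ (block v) (blocks vs) (Allₚ.concat⁺ e) (pull-block v e) (pull-blocks vs e)

-- Renaming in formulas and quantifiers over tuples.

module _ {L : Language ℓ} where
  private
    variable
      Γ Δ : Context L

  mutual
    renameᵀ : ∀ {s} → Ren Γ Δ → Term L Γ s → Term L Δ s
    renameᵀ ρ (var i)    = var (All.lookup ρ i)
    renameᵀ ρ (app f ts) = app f (renameᵀˢ ρ ts)

    renameᵀˢ : ∀ {Θ} → Ren Γ Δ → All (Term L Γ) Θ → All (Term L Δ) Θ
    renameᵀˢ ρ []       = []
    renameᵀˢ ρ (t ∷ ts) = renameᵀ ρ t ∷ renameᵀˢ ρ ts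

  rename : Ren Γ Δ → Formula L Γ → Formula L Δ
  rename ρ (t ≐ u)    = renameᵀ ρ t ≐ renameᵀ ρ u
  rename ρ (rel R ts) = rel R (renameᵀˢ ρ ts)
  rename ρ ⊥̇          = ⊥̇
  rename ρ (φ ⇒ ψ)    = rename ρ φ ⇒ rename ρ ψ
  rename ρ (∀̇ s φ)    = ∀̇ s (rename (liftʳ ρ) φ)

  ∀̇* : ∀ Δ → Formula L (Δ ++ Γ) → Formula L Γ
  ∀̇* []      φ = φ
  ∀̇* (s ∷ Δ) φ = ∀̇* Δ (∀̇ s φ)

  module _ (N : Structure L) where

    mutual
      eval-rename : ∀ {s} (ρ : Ren Γ Δ) (t : Term L Γ s) x →
                    eval N x (renameᵀ ρ t) ≡ eval N (pull ρ x) t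
      eval-rename ρ (var i)    x = sym (lookup-pull ρ x i)
      eval-rename ρ (app f ts) x = cong (Structure.fun N f) (evals-rename ρ ts x)

      evals-rename : ∀ {Θ} (ρ : Ren Γ Δ) (ts : All (Term L Γ) Θ) x →
                     evals N x (renameᵀˢ ρ ts) ≡ evals N (pull ρ x) ts
      evals-rename ρ []       x = refl
      evals-rename ρ (t ∷ ts) x = cong₂ _∷_ (eval-rename ρ t x) (evals-rename ρ ts x)

    Sat-rename : (ρ : Ren Γ Δ) (φ : Formula L Γ) (x : Tuple N Δ) {y : Tuple N Γ} →
                 pull ρ x ≡ y → Sat N (rename ρ φ) x ⇔ Sat N φ y
    Sat-rename ρ (t ≐ u) x refl = mk⇔
      (λ e → trans (sym (eval-rename ρ t x)) (trans e (eval-rename ρ u x)))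
      (λ e → trans (eval-rename ρ t x) (trans e (sym (eval-rename ρ u x))))
    Sat-rename ρ (rel R ts) x refl = mk⇔
      (subst (Structure.relation N R) (evals-rename ρ ts x))
      (subst (Structure.relation N R) (sym (evals-rename ρ ts x)))
    Sat-rename ρ ⊥̇ x refl = mk⇔ id id
    Sat-rename ρ (φ ⇒ ψ) x refl =
      let module φ = Equivalence (Sat-rename ρ φ x refl)
          module ψ = Equivalence (Sat-rename ρ ψ x refl)
      in mk⇔ (λ h → ψ.to ∘ h ∘ φ.from) (λ h → ψ.from ∘ h ∘ φ.to)
    Sat-rename ρ (∀̇ s φ) x refl = mk⇔
      (λ h d → Equivalence.to (ih d) (h d))
      (λ h d → Equivalence.from (ih d) (h d))
      where ih = λ d → Sat-rename (liftʳ ρ) φ (d ∷ x) (cong (d ∷_) (pull-wk ρ x))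

    Sat-∀* : ∀ Δ (φ : Formula L (Δ ++ Γ)) x →
             Sat N (∀̇* Δ φ) x ⇔ (∀ y → Sat N φ (y ++ᵗ x))
    Sat-∀* []      φ x = mk⇔ (λ { h [] → h }) (λ h → h [])
    Sat-∀* (s ∷ Δ) φ x =
      let module ih = Equivalence (Sat-∀* Δ (∀̇ s φ) x)
      in mk⇔ (λ { h (d ∷ y) → ih.to h y d }) (λ h → ih.from (λ y d → h (d ∷ y)))

pattern v₀ = here refl
pattern v₁ = there v₀
pattern v₂ = there v₁
pattern v₃ = there v₂
pattern v₄ = there v₃
pattern v₅ = there v₄

-- Classical logic and a calculus of definable predicates.

module Classical (em : ∀ {a} → ExcludedMiddle a) where

  dne : ∀ {a} {P : Set a} → ¬ ¬ P → P
  dne {P = P} ¬¬p with em {P = P}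
  ... | yes p = p
  ... | no ¬p = ⊥-elim (¬¬p ¬p)

  ¬∀⇒∃¬ : ∀ {a b} {A : Set a} {P : A → Set b} → ¬ (∀ x → P x) → ∃[ x ] ¬ P x
  ¬∀⇒∃¬ ¬∀ = dne (λ ¬∃ → ¬∀ (λ x → dne (λ ¬p → ¬∃ (x , ¬p))))

module Definability (em : ∀ {a} → ExcludedMiddle a) {ℓ} {L : Language ℓ} (M : Structure L) where
  open Classical em

  private
    variable
      Γ Δ Ω : Context L
      Γs Δs : List (Context L)
      A A′  : Pred (Element M) ℓ

  Env : List (Context L) → Set ℓ
  Env = All (Tuple M)

  catᵗ : Env Γs → Tuple M (concat Γs)
  catᵗ = Allₚ.concat⁺

  -- Definability of predicates of several tuples; the tuples are concatenated
  -- only inside this definition, so that quantifiers over a whole tuple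
  -- compute on environments.
  DefE : Pred (Element M) ℓ → ∀ Γs → Pred (Env Γs) ℓ → Set ℓ
  DefE A Γs X = Σ[ φ ∈ LFormula M A (concat Γs) ] ∀ e → Satᴸ M φ (catᵗ e) ⇔ X e

  opaque
    respᴰ : {X Y : Pred (Env Γs) ℓ} → (∀ e → X e ⇔ Y e) → DefE A Γs X → DefE A Γs Y
    respᴰ X⇔Y (φ , h) = φ , λ e →
      let module h = Equivalence (h e)
          module r = Equivalence (X⇔Y e)
      in mk⇔ (r.to ∘ h.to) (h.from ∘ r.from)

    monoᴰ : {X : Pred (Env Γs) ℓ} → A ⊆ A′ → DefE A Γs X → DefE A′ Γs X
    monoᴰ A⊆A′ (φ [ a ∣ a⊆A ] , h) = φ [ a ∣ (λ c → A⊆A′ (a⊆A c)) ] , h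

    Coords-++ : (a : Tuple M Γ) (b : Tuple M Δ) →
                Coords M a ⊆ A → Coords M b ⊆ A → Coords M (a ++ᵗ b) ⊆ A
    Coords-++ []      b a⊆ b⊆ c = b⊆ c
    Coords-++ (d ∷ a) b a⊆ b⊆ (here refl , e) = a⊆ (here refl , e)
    Coords-++ (d ∷ a) b a⊆ b⊆ (there i , e) = Coords-++ a b (λ (j , f) → a⊆ (there j , f)) b⊆ (i , e)

    -- The common shape of all reindexings: from the new parameters a followed by the free
    -- variables, `ρ` recovers the old parameters b and `ρ′` the arguments `f e`.
    build : ∀ {Π Π′} {X : Pred (Env Γs) ℓ} (φ : Formula L (Π ++ Ω)) {b : Tuple M Π}
              (a : Tuple M Π′) → Coords M a ⊆ A →
              (ρ : Ren Π (Π′ ++ concat Γs)) (ρ′ : Ren Ω (Π′ ++ concat Γs)) {f : Env Γs → Tuple M Ω} →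
              (∀ (e : Env Γs) → pull ρ (a ++ᵗ catᵗ e) ≡ b) →
              (∀ (e : Env Γs) → pull ρ′ (a ++ᵗ catᵗ e) ≡ f e) →
              (∀ (e : Env Γs) → Sat M φ (b ++ᵗ f e) ⇔ X e) → DefE A Γs X
    build {Γs = Γs} φ a a⊆A ρ ρ′ eq eq′ h = rename (ρ ++ᵗ ρ′) φ [ a ∣ a⊆A ] , λ (e : Env Γs) →
      let r = Sat-rename M (ρ ++ᵗ ρ′) φ (a ++ᵗ catᵗ e)
                (pull-⊕ ρ ρ′ (a ++ᵗ catᵗ e) (eq e) (eq′ e))
      in mk⇔ (Equivalence.to (h e) ∘ Equivalence.to r) (Equivalence.from r ∘ Equivalence.from (h e))

    infixr 3 _⇒ᴰ_

    _⇒ᴰ_ : {X Y : Pred (Env Γs) ℓ} → DefE A Γs X → DefE A Γs Y → DefE A Γs (λ e → X e → Y e)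
    _⇒ᴰ_ {Γs = Γs} (_[_∣_] {Π₁} φ a a⊆A , h) (_[_∣_] {Π₂} ψ b b⊆A , k) =
      (rename ρ₁ φ ⇒ rename ρ₂ ψ) [ a ++ᵗ b ∣ Coords-++ a b a⊆A b⊆A ] , λ e →
        let module r = Equivalence (Sat-rename M ρ₁ φ ((a ++ᵗ b) ++ᵗ catᵗ e) (eq₁ e))
            module s = Equivalence (Sat-rename M ρ₂ ψ ((a ++ᵗ b) ++ᵗ catᵗ e) (eq₂ e))
            module h = Equivalence (h e)
            module k = Equivalence (k e)
        in mk⇔ (λ f x → k.to (s.to (f (r.from (h.from x)))))
               (λ f x → s.from (k.from (f (h.to (r.to x)))))
      where
      R : Context L
      R = concat Γs

      l₁ : Ren Π₁ ((Π₁ ++ Π₂) ++ R)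
      l₁ = inlʳ {Γ = Π₁} ⨾ inlʳ

      l₂ : Ren Π₂ ((Π₁ ++ Π₂) ++ R)
      l₂ = inrʳ {Γ = Π₁} ⨾ inlʳ

      r : Ren R ((Π₁ ++ Π₂) ++ R)
      r = inrʳ {Γ = Π₁ ++ Π₂}

      ρ₁ : Ren (Π₁ ++ R) ((Π₁ ++ Π₂) ++ R)
      ρ₁ = l₁ ++ᵗ r

      ρ₂ : Ren (Π₂ ++ R) ((Π₁ ++ Π₂) ++ R)
      ρ₂ = l₂ ++ᵗ r

      eq₁ : (e : Env Γs) → pull ρ₁ ((a ++ᵗ b) ++ᵗ catᵗ e) ≡ a ++ᵗ catᵗ e
      eq₁ e = pull-⊕ l₁ r ((a ++ᵗ b) ++ᵗ catᵗ e) (trans (pull-⨾inl (inlʳ {Γ = Π₁}) (a ++ᵗ b) (catᵗ e)) (pull-inl a b))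
                            (pull-inr (a ++ᵗ b) (catᵗ e))

      eq₂ : (e : Env Γs) → pull ρ₂ ((a ++ᵗ b) ++ᵗ catᵗ e) ≡ b ++ᵗ catᵗ e
      eq₂ e = pull-⊕ l₂ r ((a ++ᵗ b) ++ᵗ catᵗ e) (trans (pull-⨾inl (inrʳ {Γ = Π₁}) (a ++ᵗ b) (catᵗ e)) (pull-inr a b))
                            (pull-inr (a ++ᵗ b) (catᵗ e))

    ∀ᴰ : ∀ Δ {X : Pred (Env (Δ ∷ Γs)) ℓ} → DefE A (Δ ∷ Γs) X → DefE A Γs (λ e → ∀ y → X (y ∷ e))
    ∀ᴰ {Γs = Γs} Δ (_[_∣_] {Π} φ a a⊆A , h) =
      ∀̇* Δ (rename ρ φ) [ a ∣ a⊆A ] , λ e →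
        let module q = Equivalence (Sat-∀* M Δ (rename ρ φ) (a ++ᵗ catᵗ e))
        in mk⇔ (λ s y → Equivalence.to (h (y ∷ e))
                          (Equivalence.to (Sat-rename M ρ φ (y ++ᵗ (a ++ᵗ catᵗ e)) (eq y (catᵗ e))) (q.to s y)))
               (λ s → q.from (λ y → Equivalence.from (Sat-rename M ρ φ (y ++ᵗ (a ++ᵗ catᵗ e)) (eq y (catᵗ e)))
                                      (Equivalence.from (h (y ∷ e)) (s y))))
      where
      R : Context L
      R = concat Γs

      ρ₁ : Ren Π (Δ ++ (Π ++ R))
      ρ₁ = inlʳ {Γ = Π} ⨾ inrʳ {Γ = Δ}

      ρ₂ : Ren R (Δ ++ (Π ++ R))
      ρ₂ = inrʳ {Γ = Π} ⨾ inrʳ {Γ = Δ}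

      ρ : Ren (Π ++ (Δ ++ R)) (Δ ++ (Π ++ R))
      ρ = ρ₁ ++ᵗ (inlʳ {Γ = Δ} ++ᵗ ρ₂)

      eq : (y : Tuple M Δ) (r : Tuple M R) → pull ρ (y ++ᵗ (a ++ᵗ r)) ≡ a ++ᵗ (y ++ᵗ r)
      eq y r =
        pull-⊕ ρ₁ (inlʳ {Γ = Δ} ++ᵗ ρ₂) (y ++ᵗ (a ++ᵗ r))
          (trans (pull-⨾inr (inlʳ {Γ = Π}) y (a ++ᵗ r)) (pull-inl a r))
          (pull-⊕ (inlʳ {Γ = Δ}) ρ₂ (y ++ᵗ (a ++ᵗ r)) (pull-inl y (a ++ᵗ r))
            (trans (pull-⨾inr (inrʳ {Γ = Π}) y (a ++ᵗ r)) (pull-inr a r)))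

    at : {X : Pred (Env Δs) ℓ} → DefE A Δs X → (vs : All (_∋ Γs) Δs) →
         DefE A Γs (λ e → X (All.map (All.lookup e) vs))
    at (_[_∣_] {Π} φ a a⊆A , h) vs =
      build φ a a⊆A (inlʳ {Γ = Π}) (blocks vs ⨾ inrʳ {Γ = Π})
        (λ e → pull-inl a (catᵗ e))
        (λ e → trans (pull-⨾inr (blocks vs) a (catᵗ e)) (pull-blocks vs e))
        (λ e → h (All.map (All.lookup e) vs))

    fill : {X : Pred (Env (Γ ∷ Γs)) ℓ} (u : Tuple M Γ) → Coords M u ⊆ A →
           DefE A (Γ ∷ Γs) X → DefE A Γs (λ e → X (u ∷ e))
    fill {Γ = Γ} {Γs = Γs} u u⊆A (_[_∣_] {Π} φ a a⊆A , h) =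
      build φ (a ++ᵗ u) (Coords-++ a u a⊆A u⊆A) ρ₁ (ρ₂ ++ᵗ inrʳ {Γ = Π ++ Γ})
        (λ e → trans (pull-⨾inl (inlʳ {Γ = Π}) (a ++ᵗ u) (catᵗ e)) (pull-inl a u))
        (λ e → pull-⊕ ρ₂ (inrʳ {Γ = Π ++ Γ}) ((a ++ᵗ u) ++ᵗ catᵗ e)
          (trans (pull-⨾inl (inrʳ {Γ = Π}) (a ++ᵗ u) (catᵗ e)) (pull-inr a u))
          (pull-inr (a ++ᵗ u) (catᵗ e)))
        (λ e → h (u ∷ e))
      where
      ρ₁ : Ren Π ((Π ++ Γ) ++ concat Γs)
      ρ₁ = inlʳ {Γ = Π} ⨾ inlʳ

      ρ₂ : Ren Γ ((Π ++ Γ) ++ concat Γs)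
      ρ₂ = inrʳ {Γ = Π} ⨾ inlʳ

    coord≡ᴰ : ∀ {s} (v : Γ ∋ Γs) (i : s ∋ Γ) (w : Δ ∋ Γs) (j : s ∋ Δ) →
             DefE A Γs (λ e → All.lookup (All.lookup e v) i ≡ All.lookup (All.lookup e w) j)
    coord≡ᴰ v i w j =
      (var (All.lookup (block v) i) ≐ var (All.lookup (block w) j)) [ [] ∣ (λ ()) ] ,
      λ e → mk⇔ (λ q → trans (sym (eq v i e)) (trans q (eq w j e)))
                (λ q → trans (eq v i e) (trans q (sym (eq w j e))))
      where
      eq : ∀ {s Γ} (v : Γ ∋ Γs) (i : s ∋ Γ) (e : Env Γs) →
           All.lookup (catᵗ e) (All.lookup (block v) i) ≡ All.lookup (All.lookup e v) i
      eq v i e = trans (sym (lookup-pull (block v) (catᵗ e) i))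
                       (cong (λ x → All.lookup x i) (pull-block v e))

    formulaᴰ : (φ : Formula L (concat Γs)) → DefE A Γs (λ e → Sat M φ (catᵗ e))
    formulaᴰ φ = φ [ [] ∣ (λ ()) ] , λ e → mk⇔ id id

    infixr 6 ¬ᴰ_
    infixr 5 _×ᴰ_
    infixr 4 _⊎ᴰ_

    ¬ᴰ_ : {X : Pred (Env Γs) ℓ} → DefE A Γs X → DefE A Γs (λ e → ¬ X e)
    ¬ᴰ (φ [ a ∣ a⊆A ] , h) = neg L φ [ a ∣ a⊆A ] , λ e →
      let module h = Equivalence (h e)
      in mk⇔ (λ s x → lower (s (h.from x))) (λ ¬x s → ↑ (¬x (h.to s)))

    _×ᴰ_ : {X Y : Pred (Env Γs) ℓ} → DefE A Γs X → DefE A Γs Y → DefE A Γs (λ e → X e × Y e)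
    X ×ᴰ Y = respᴰ (λ e → mk⇔ (λ h → dne (λ ¬x×y → h (λ x y → ¬x×y (x , y))))
                              (λ (x , y) h → h x y))
                   (¬ᴰ (X ⇒ᴰ ¬ᴰ Y))

    _⊎ᴰ_ : {X Y : Pred (Env Γs) ℓ} → DefE A Γs X → DefE A Γs Y → DefE A Γs (λ e → X e ⊎ Y e)
    _⊎ᴰ_ {Γs = Γs} {X = X′} {Y = Y′} X Y = respᴰ (λ e → mk⇔ (to e) [ (λ x ¬x → ⊥-elim (¬x x)) , (λ y _ → y) ])
                              (¬ᴰ X ⇒ᴰ Y)
      where
      to : (e : Env Γs) → (¬ X′ e → Y′ e) → X′ e ⊎ Y′ e
      to e h with em {P = X′ e}
      ... | yes x = inj₁ x
      ... | no ¬x = inj₂ (h ¬x)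

    ∃ᴰ : ∀ Δ {X : Pred (Env (Δ ∷ Γs)) ℓ} → DefE A (Δ ∷ Γs) X → DefE A Γs (λ e → ∃[ y ] X (y ∷ e))
    ∃ᴰ Δ X = respᴰ (λ e → mk⇔ (λ h → dne (λ ¬∃ → h (λ y x → ¬∃ (y , x))))
                              (λ (y , x) h → h y x))
                   (¬ᴰ ∀ᴰ Δ (¬ᴰ X))

    ⊤ᴰ : ∀ {X : Pred (Env Γs) ℓ} → (∀ e → X e) → DefE A Γs X
    ⊤ᴰ x = respᴰ (λ e → mk⇔ (λ _ → x e) (λ _ → id)) (formulaᴰ (⊥̇ ⇒ ⊥̇))

    tuple≡ᴰ : ∀ {A} (v w : Γ ∋ Γs) → DefE A Γs (λ e → All.lookup e v ≡ All.lookup e w)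
    tuple≡ᴰ {Γ = Γ} {Γs = Γs} {A = A} v w = respᴰ (λ e → mk⇔ (ext (All.lookup e v) (All.lookup e w))
                                          λ eq i → cong (λ x → All.lookup x i) eq)
                                  (pointwise Γ id)
      where
      ext : ∀ {Δ} (x y : Tuple M Δ) → (∀ {s} (i : s ∋ Δ) → All.lookup x i ≡ All.lookup y i) → x ≡ y
      ext []      []      h = refl
      ext (d ∷ x) (e ∷ y) h = cong₂ _∷_ (h (here refl)) (ext x y (h ∘ there))

      pointwise : ∀ Δ (ι : ∀ {s} → s ∋ Δ → s ∋ Γ) →
                  DefE A Γs (λ e → ∀ {s} (i : s ∋ Δ) →
                    All.lookup (All.lookup e v) (ι i) ≡ All.lookup (All.lookup e w) (ι i))
      pointwise []      ι = ⊤ᴰ (λ e ())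
      pointwise (s ∷ Δ) ι =
        respᴰ (λ e → mk⇔ (λ { (p , q) (here refl) → p ; (p , q) (there i) → q i })
                         (λ h → h (here refl) , (λ {_} i → h (there i))))
              (coord≡ᴰ v (ι (here refl)) w (ι (here refl)) ×ᴰ pointwise Δ (ι ∘ there))

    -- The way back from environments: `vs` tells where each tuple sits inside one long tuple, the
    -- form in which relative definability and canonical parameters are stated.
    flatten : {X : Pred (Env Γs) ℓ} → DefE A Γs X → (vs : All (λ Γ → Ren Γ Ω) Γs) →
              Definable M A (λ x → X (All.map (λ v → pull v x) vs))
    flatten {Γs = Γs} {Ω = Ω} {X = X} (_[_∣_] {Π} φ a a⊆A , h) vs =
      rename ρ φ [ a ∣ a⊆A ] , λ x →
        let module r = Equivalence (Sat-rename M ρ φ (a ++ᵗ x) (eq x))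
            module h = Equivalence (h (All.map (λ v → pull v x) vs))
        in mk⇔ (h.to ∘ r.to) (r.from ∘ h.from)
      where
      ρ₂ : Ren (concat Γs) (Π ++ Ω)
      ρ₂ = Allₚ.concat⁺ vs ⨾ inrʳ {Γ = Π}

      ρ : Ren (Π ++ concat Γs) (Π ++ Ω)
      ρ = inlʳ {Γ = Π} ++ᵗ ρ₂

      pull-concat : ∀ {Γs} (vs : All (λ Γ → Ren Γ Ω) Γs) (x : Tuple M Ω) →
                    pull (Allₚ.concat⁺ vs) x ≡ Allₚ.concat⁺ (All.map (λ v → pull v x) vs)
      pull-concat []       x = refl
      pull-concat (v ∷ vs) x = pull-⊕ v (Allₚ.concat⁺ vs) x refl (pull-concat vs x)

      eq : ∀ x → pull ρ (a ++ᵗ x) ≡ a ++ᵗ Allₚ.concat⁺ (All.map (λ v → pull v x) vs)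
      eq x = pull-⊕ (inlʳ {Γ = Π}) ρ₂ (a ++ᵗ x) (pull-inl a x)
               (trans (pull-⨾inr (Allₚ.concat⁺ vs) a x) (pull-concat vs x))

    toDefinable : {X : Pred (Tuple M Γ) ℓ} → DefE A (Γ ∷ []) (λ e → X (All.lookup e (here refl))) →
                  Definable M A X
    toDefinable {X = X} d =
      let φ , h = flatten d (idʳ ∷ [])
      in φ , λ x → subst (λ y → Satᴸ M φ x ⇔ X y) (pull-id x) (h x)

    pullbackᴰ : {X : Pred (Tuple M Γ) ℓ} → Definable M A X →
                (ρ : Ren Γ (concat Γs)) {f : Env Γs → Tuple M Γ} →
                (∀ e → pull ρ (catᵗ e) ≡ f e) → DefE A Γs (λ e → X (f e))
    pullbackᴰ (_[_∣_] {Π} φ a a⊆A , h) ρ {f} eq =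
      build φ a a⊆A (inlʳ {Γ = Π}) (ρ ⨾ inrʳ {Γ = Π})
        (λ e → pull-inl a (catᵗ e))
        (λ e → trans (pull-⨾inr ρ a (catᵗ e)) (eq e))
        (λ e → h (f e))

  Satᴸ-def : (φ : LFormula M A Γ) → Definable M A (Satᴸ M φ)
  Satᴸ-def φ = φ , λ _ → mk⇔ id id

  Sat-def : (φ : Formula L Γ) → Definable M A (Sat M φ)
  Sat-def φ = Satᴸ-def (φ [ [] ∣ (λ ()) ])

  fromDefinable : {X : Pred (Tuple M Γ) ℓ} → Definable M A X → (v : Γ ∋ Γs) →
                  DefE A Γs (λ e → X (All.lookup e v))
  fromDefinable X v = pullbackᴰ X (block v) (pull-block v)

  fromDefinable-++ : {X : Pred (Tuple M (Γ ++ Δ)) ℓ} → Definable M A X →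
                     (v : Γ ∋ Γs) (w : Δ ∋ Γs) →
                     DefE A Γs (λ e → X (All.lookup e v ++ᵗ All.lookup e w))
  fromDefinable-++ X v w =
    pullbackᴰ X (block v ++ᵗ block w)
      (λ e → pull-⊕ (block v) (block w) (catᵗ e) (pull-block v e) (pull-block w e))

  fromDefinable-pull : {X : Pred (Tuple M Γ) ℓ} → Definable M A X → (ρ : Ren Γ Δ) (v : Δ ∋ Γs) →
                       DefE A Γs (λ e → X (pull ρ (All.lookup e v)))
  fromDefinable-pull X ρ v =
    pullbackᴰ X (ρ ⨾ block v)
      (λ e → trans (pull-⨾ ρ (block v) (catᵗ e)) (cong (pull ρ) (pull-block v e)))

  opaque
    weakenᴰ : {X : Pred (Env (Δ ∷ Γs)) ℓ} → DefE A (Δ ∷ Γs) X →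
              DefE A (Δ ∷ Ω ∷ Γs) (λ e → X (All.head e ∷ All.tail (All.tail e)))
    weakenᴰ {X = X} d =
      respᴰ (λ { (x ∷ y ∷ e) →
               mk⇔ (subst (λ e → X (x ∷ e)) (eq x y e)) (subst (λ e → X (x ∷ e)) (sym (eq x y e))) })
            (at d (here refl ∷ wk (wk idʳ)))
      where
      eq : ∀ {Δ Ω Γs} (x : Tuple M Δ) (y : Tuple M Ω) (e : Env Γs) →
           pull (wk (wk idʳ)) (x ∷ y ∷ e) ≡ e
      eq x y e = trans (pull-wk (wk idʳ) (y ∷ e)) (trans (pull-wk idʳ e) (pull-id e))

    Coords-++ˡ : (a : Tuple M Γ) (b : Tuple M Δ) → Coords M a ⊆ Coords M (a ++ᵗ b)
    Coords-++ˡ (d ∷ a) b (here refl , e) = here refl , e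
    Coords-++ˡ (d ∷ a) b (there i , e) = let j , f = Coords-++ˡ a b (i , e) in there j , f

    Coords-++ʳ : (a : Tuple M Γ) (b : Tuple M Δ) → Coords M b ⊆ Coords M (a ++ᵗ b)
    Coords-++ʳ []      b c = c
    Coords-++ʳ (d ∷ a) b c = let j , f = Coords-++ʳ a b c in there j , f

-- Morley rank forbids endless splitting; density of isolated types.

module Rank (em : ∀ {a} → ExcludedMiddle a) {ℓ} {L : Language ℓ} (M : Structure L)
  (ranked : ∀ {Γ} (φ : LFormula M (λ _ → ⊤) Γ) → Σ[ α ∈ Ordinal ℓ ] ¬ MorleyRank≥ M α φ)
  where
  open Classical em
  open Definability em M

  Splits : ∀ {Γ a} → Pred (LFormula M (λ _ → ⊤) Γ) a → Pred (LFormula M (λ _ → ⊤) Γ) _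
  Splits 𝒫 φ =
    Σ[ φ₁ ∈ LFormula M _ _ ] Σ[ φ₂ ∈ LFormula M _ _ ]
      𝒫 φ₁ × 𝒫 φ₂ × Satᴸ M φ₁ ⊆ Satᴸ M φ × Satᴸ M φ₂ ⊆ Satᴸ M φ ×
      (∀ x → Satᴸ M φ₁ x → ¬ Satᴸ M φ₂ x)

  module _ {Γ : Context L} {a} (𝒫 : Pred (LFormula M (λ _ → ⊤) Γ) a)
    (consistent : ∀ φ → 𝒫 φ → ∃ (Satᴸ M φ)) (split : ∀ φ → 𝒫 φ → Splits 𝒫 φ)
    where

    -- Passing always to the second half gives a descending stem. The first halves cut off along it
    -- are infinitely many pairwise disjoint members of `𝒫` inside φ, and by induction each of them
    -- has every smaller rank.
    splitting⇒rank≥ : ∀ α {φ} → 𝒫 φ → MorleyRank≥ M α φ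
    splitting⇒rank≥ (sup f) {φ} 𝒫φ =
      consistent φ 𝒫φ , λ i →
        leaf ,
        (λ n x → stem⊆ 0 n ℕ.z≤n ∘ leaf⊆ n) ,
        disjoint ,
        (λ n → splitting⇒rank≥ (f i) (proj₁ (proj₂ (proj₂ (split _ (proj₂ (stem n)))))))
      where
      stem : ℕ → ∃ 𝒫
      stem zero    = φ , 𝒫φ
      stem (suc n) = let _ , φ₂ , _ , 𝒫φ₂ , _ = split _ (proj₂ (stem n)) in φ₂ , 𝒫φ₂

      leaf : ℕ → LFormula M _ Γ
      leaf n = proj₁ (split _ (proj₂ (stem n)))

      leaf⊆ : ∀ n {x} → Satᴸ M (leaf n) x → Satᴸ M (proj₁ (stem n)) x
      leaf⊆ n = let _ , _ , _ , _ , ⊆₁ , _ = split _ (proj₂ (stem n)) in ⊆₁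

      stem⊆ : ∀ m n → m ℕ.≤ n → ∀ {x} → Satᴸ M (proj₁ (stem n)) x → Satᴸ M (proj₁ (stem m)) x
      stem⊆ m n m≤n with ℕₚ.m≤n⇒m<n∨m≡n m≤n
      ... | inj₂ refl = id
      stem⊆ m (suc n) _ | inj₁ (ℕ.s≤s m≤n) =
        let _ , _ , _ , _ , _ , ⊆₂ , _ = split _ (proj₂ (stem n)) in stem⊆ m n m≤n ∘ ⊆₂

      disjoint< : ∀ m n → m ℕ.< n → ∀ x → ¬ (Satᴸ M (leaf m) x × Satᴸ M (leaf n) x)
      disjoint< m n m<n x (s , t) =
        let _ , _ , _ , _ , _ , _ , disj = split _ (proj₂ (stem m))
        in disj x s (stem⊆ (suc m) n m<n (leaf⊆ n t))

      disjoint : ∀ m n → m ≢ n → ∀ x → ¬ (Satᴸ M (leaf m) x × Satᴸ M (leaf n) x)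
      disjoint m n m≢n x (s , t) with ℕₚ.<-cmp m n
      ... | tri< m<n _ _ = disjoint< m n m<n x (s , t)
      ... | tri≈ _ m≡n _ = m≢n m≡n
      ... | tri> _ _ n<m = disjoint< n m n<m x (t , s)

    ¬splitting : ∀ {φ} → ¬ 𝒫 φ
    ¬splitting {φ} 𝒫φ = let α , ¬α≤ = ranked φ in ¬α≤ (splitting⇒rank≥ α 𝒫φ)

  _⟨_⟩ : ∀ {A A′ Γ} → LFormula M A Γ → A ⊆ A′ → LFormula M A′ Γ
  (φ [ a ∣ a⊆A ]) ⟨ A⊆A′ ⟩ = φ [ a ∣ (λ c → A⊆A′ (a⊆A c)) ]

  module _ {D : Pred (Element M) ℓ} {Γ : Context L} where

    -- Vacuous for an inconsistent χ, so a realisation is always supplied separately.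
    Isolating : Pred (LFormula M D Γ) ℓ
    Isolating χ = ∀ (θ : LFormula M D Γ) x y → Satᴸ M χ x → Satᴸ M χ y → Satᴸ M θ x → Satᴸ M θ y

    ¬isolating⇒split : (χ : LFormula M D Γ) → ¬ Isolating χ →
      Σ[ θ ∈ LFormula M D Γ ]
        (∃[ y ] Satᴸ M χ y × Satᴸ M θ y) × (∃[ z ] Satᴸ M χ z × ¬ Satᴸ M θ z)
    ¬isolating⇒split χ ¬iso = dne λ none →
      ¬iso (λ θ y z χy χz θy → dne (λ ¬θz → none (θ , (y , χy , θy) , (z , χz , ¬θz))))

    -- Otherwise every consistent D-formula below ψ has two realisations that some D-formula θ tells
    -- apart. Cutting by θ and its negation leaves two consistent D-formulas, and so on without end.
    isolating-dense : (ψ : LFormula M D Γ) → ∃ (Satᴸ M ψ) →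
      Σ[ χ ∈ LFormula M D Γ ] Isolating χ × ∃ (Satᴸ M χ) × Satᴸ M χ ⊆ Satᴸ M ψ
    isolating-dense ψ ∃ψ = dne (λ none →
      ¬splitting 𝒫 (λ _ → proj₁ ∘ proj₂) (split none) {ψ ⟨ _ ⟩} ((Satᴸ-def ψ) , ∃ψ , id))
      where
      𝒫 : Pred (LFormula M (λ _ → ⊤) Γ) ℓ
      -- Morley rank speaks of formulas with parameters anywhere in M; the members are such formulas
      -- whose solution sets happen to be definable over D.
      𝒫 φ = Definable M D (Satᴸ M φ) × ∃ (Satᴸ M φ) × Satᴸ M φ ⊆ Satᴸ M ψ

      part : ∀ {φ} (X : Pred (Tuple M Γ) ℓ) → Definable M D X → ∃ X → X ⊆ Satᴸ M φ →
             Satᴸ M φ ⊆ Satᴸ M ψ → Σ[ φ′ ∈ LFormula M _ Γ ] 𝒫 φ′ × Satᴸ M φ′ ⊆ X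
      part X (φ′ , φ′⇔X) (x , Xx) X⊆φ φ⊆ψ =
        φ′ ⟨ _ ⟩ ,
        ((φ′ , λ _ → mk⇔ id id) , (x , Equivalence.from (φ′⇔X x) Xx) ,
         λ {y} s → φ⊆ψ (X⊆φ (Equivalence.to (φ′⇔X y) s))) ,
        λ {y} → Equivalence.to (φ′⇔X y)

      split : ¬ (Σ[ χ ∈ LFormula M D Γ ] Isolating χ × ∃ (Satᴸ M χ) × Satᴸ M χ ⊆ Satᴸ M ψ) →
              ∀ φ → 𝒫 φ → Splits 𝒫 φ
      split none φ ((χ , χ⇔φ) , (x , φx) , φ⊆ψ)
        with θ , (y , χy , θy) , (z , χz , ¬θz) ← ¬isolating⇒split χ
               (λ iso → none (χ , iso , (x , Equivalence.from (χ⇔φ x) φx) ,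
                              λ {w} s → φ⊆ψ (Equivalence.to (χ⇔φ w) s)))
        with φ₁ , 𝒫φ₁ , ⊆₁ ← part {φ} (λ x → Satᴸ M χ x × Satᴸ M θ x)
               (toDefinable (fromDefinable (Satᴸ-def χ) v₀ ×ᴰ
                             fromDefinable (Satᴸ-def θ) v₀))
               (y , χy , θy) (λ {w} s → Equivalence.to (χ⇔φ w) (proj₁ s)) φ⊆ψ
           | φ₂ , 𝒫φ₂ , ⊆₂ ← part {φ} (λ x → Satᴸ M χ x × ¬ Satᴸ M θ x)
               (toDefinable (fromDefinable (Satᴸ-def χ) v₀ ×ᴰ
                             ¬ᴰ fromDefinable (Satᴸ-def θ) v₀))
               (z , χz , ¬θz) (λ {w} s → Equivalence.to (χ⇔φ w) (proj₁ s)) φ⊆ψ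
        = φ₁ , φ₂ , 𝒫φ₁ , 𝒫φ₂ ,
          (λ {w} s → Equivalence.to (χ⇔φ w) (proj₁ (⊆₁ s))) ,
          (λ {w} s → Equivalence.to (χ⇔φ w) (proj₁ (⊆₂ s))) ,
          λ w s t → proj₂ (⊆₂ t) (proj₂ (⊆₁ s))

-- The 2-rank and stable embeddedness of definable sets.

module Stable (em : ∀ {a} → ExcludedMiddle a) {ℓ} {L : Language ℓ} (M : Structure L)
  (ranked : ∀ {Γ} (φ : LFormula M (λ _ → ⊤) Γ) → Σ[ α ∈ Ordinal ℓ ] ¬ MorleyRank≥ M α φ)
  (sat₀ : ℵ₀-Saturated M)
  where
  open Classical em
  open Definability em M
  open Rank em M ranked

  module _ {Δ Ξ : Context L} (K : Pred (Tuple M Ξ) ℓ) (Φ : Tuple M Δ → Tuple M Ξ → Set ℓ) where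

    -- Shelah's 2-rank of the family (Φ _ c), c ∈ K.
    Rk : ℕ → Pred (Tuple M Δ) ℓ → Set ℓ
    Rk zero    X = ∃ X
    Rk (suc n) X = ∃[ c ] K c × Rk n (λ d → X d × Φ d c) × Rk n (λ d → X d × ¬ Φ d c)

    Rk-mono : ∀ n {X Y} → X ⊆ Y → Rk n X → Rk n Y
    Rk-mono zero    X⊆Y (x , Xx) = x , X⊆Y Xx
    Rk-mono (suc n) X⊆Y (c , Kc , r , r′) =
      c , Kc , Rk-mono n (λ (x , s) → X⊆Y x , s) r , Rk-mono n (λ (x , s) → X⊆Y x , s) r′

    Rk-pred : ∀ n {X} → Rk (suc n) X → Rk n X
    Rk-pred n (_ , _ , r , _) = Rk-mono n proj₁ r

    Rk-≤ : ∀ {m n} → m ℕ.≤ n → ∀ {X} → Rk n X → Rk m X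
    Rk-≤ {m} {n} m≤n with ℕₚ.m≤n⇒m<n∨m≡n m≤n
    ... | inj₂ refl = id
    Rk-≤ {m} {suc n} _ | inj₁ (ℕ.s≤s m≤n) = Rk-≤ m≤n ∘ Rk-pred n

    module _ {A : Pred (Element M) ℓ}
      (Kᴰ : ∀ {Γs} (v : Ξ ∋ Γs) → DefE A Γs (λ e → K (All.lookup e v)))
      (Φᴰ : ∀ {Γs} (v : Δ ∋ Γs) (w : Ξ ∋ Γs) → DefE A Γs (λ e → Φ (All.lookup e v) (All.lookup e w)))
      where

      -- For fixed n the splitting tree has finitely many nodes, each ranging over the definable set
      -- K, so its existence is a first-order condition on the remaining variables. Both the
      -- compactness argument for `realise` and the definition of traces rest on this.
      Rkᴰ : ∀ n {Γs X} → DefE A (Δ ∷ Γs) X → DefE A Γs (λ e → Rk n (λ d → X (d ∷ e)))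
      Rkᴰ zero    Xᴰ = ∃ᴰ Δ Xᴰ
      Rkᴰ (suc n) Xᴰ = ∃ᴰ Ξ (Kᴰ v₀ ×ᴰ Rkᴰ n (weakenᴰ Xᴰ ×ᴰ Φᴰ v₀ v₁) ×ᴰ Rkᴰ n (weakenᴰ Xᴰ ×ᴰ ¬ᴰ Φᴰ v₀ v₁))

  module _ {Δ Ξ : Context L} {K : Pred (Tuple M Ξ) ℓ} {B : Pred (Element M) ℓ}
    (K-def : Definable M B K) (φ : Formula L (Δ ++ Ξ)) where

    private
      Φ : Tuple M Δ → Tuple M Ξ → Set ℓ
      Φ d c = Sat M φ (d ++ᵗ c)

      Φᴰ : ∀ {A Γs} (v : Δ ∋ Γs) (w : Ξ ∋ Γs) →
           DefE A Γs (λ e → Φ (All.lookup e v) (All.lookup e w))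
      Φᴰ = fromDefinable-++ {X = Sat M φ} (Sat-def φ)

      k₀ = LFormula.params (proj₁ K-def)

      𝒫 : Pred (LFormula M (λ _ → ⊤) Δ) ℓ
      𝒫 χ = ∀ n → Rk K Φ n (Satᴸ M χ)

      -- Here c is a first cut leaving rank at least n on both sides; under `𝒫 χ` none of these sets
      -- is empty.
      G : LFormula M (λ _ → ⊤) Δ → ℕ → Pred (Tuple M Ξ) ℓ
      G χ n c = K c × Rk K Φ n (λ d → Satᴸ M χ d × Φ d c) × Rk K Φ n (λ d → Satᴸ M χ d × ¬ Φ d c)

      Gᴰ : ∀ χ n → Definable M (Coords M (k₀ ++ᵗ LFormula.params χ)) (G χ n)
      Gᴰ χ n = toDefinable (Kᴰ v₀ ×ᴰ Rkᴰ K Φ Kᴰ Φᴰ n (χᴰ ×ᴰ Φᴰ v₀ v₁) ×ᴰ Rkᴰ K Φ Kᴰ Φᴰ n (χᴰ ×ᴰ ¬ᴰ Φᴰ v₀ v₁))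
        where
        a = LFormula.params χ

        Kᴰ : ∀ {Γs} (v : Ξ ∋ Γs) → DefE (Coords M (k₀ ++ᵗ a)) Γs (λ e → K (All.lookup e v))
        Kᴰ = fromDefinable (LFormula.body (proj₁ K-def) [ k₀ ∣ Coords-++ˡ k₀ a ] , proj₂ K-def)

        χᴰ : DefE (Coords M (k₀ ++ᵗ a)) (Δ ∷ Ξ ∷ []) (λ e → Satᴸ M χ (All.lookup e v₀))
        χᴰ = fromDefinable (LFormula.body χ [ a ∣ Coords-++ʳ k₀ a ] , λ _ → mk⇔ id id) v₀

      -- The sets `G χ n` decrease with n and are all definable over one finite tuple, so
      -- ℵ₀-saturation yields a single cut good for every n. Its two halves are then again in `𝒫`.
      realise : ∀ χ → 𝒫 χ → ∃[ c ] (∀ n → G χ n c)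
      realise χ 𝒫χ = c , λ n →
        let θ , θ⇔G = Gᴰ χ n
        in Equivalence.to (θ⇔G c) (c⊨q {θ} (n , λ c′ → Equivalence.from (θ⇔G c′)))
        where
        q : Pred (LFormula M (Coords M (k₀ ++ᵗ LFormula.params χ)) Ξ) ℓ
        q θ = ∃[ n ] (∀ c → G χ n c → Satᴸ M θ c)

        G-≤ : ∀ {m n c} → m ℕ.≤ n → G χ n c → G χ m c
        G-≤ m≤n (Kc , r , r′) = Kc , Rk-≤ K Φ m≤n r , Rk-≤ K Φ m≤n r′

        bound : ∀ θs → All q θs → ∃[ n ] (∀ c → G χ n c → All (λ θ → Satᴸ M θ c) θs)
        bound []       []             = 0 , λ _ _ → []
        bound (θ ∷ θs) ((m , h) ∷ hs) =
          let n , hs′ = bound θs hs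
          in m ℕ.⊔ n , λ c g → h c (G-≤ (ℕₚ.m≤m⊔n m n) g) ∷ hs′ c (G-≤ (ℕₚ.m≤n⊔m m n) g)

        fs : FinitelySatisfiable M q
        fs θs qs = let n , h = bound θs qs
                       c , g = 𝒫χ (suc n)
                   in c , h c g

        c = proj₁ (sat₀ (k₀ ++ᵗ LFormula.params χ) q fs)

        c⊨q : c ∈ Realisations M q
        c⊨q {θ} = proj₂ (sat₀ (k₀ ++ᵗ LFormula.params χ) q fs) {θ}

      split : ∀ χ → 𝒫 χ → Splits 𝒫 χ
      split χ 𝒫χ with c , Gc ← realise χ 𝒫χ
        with φ₁ , φ₁⇔ ← toDefinable {A = λ _ → ⊤} {X = λ d → Satᴸ M χ d × Φ d c}
               (fill c _ (fromDefinable (Satᴸ-def χ) v₁ ×ᴰ Φᴰ v₁ v₀))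
           | φ₂ , φ₂⇔ ← toDefinable {A = λ _ → ⊤} {X = λ d → Satᴸ M χ d × ¬ Φ d c}
               (fill c _ (fromDefinable (Satᴸ-def χ) v₁ ×ᴰ ¬ᴰ Φᴰ v₁ v₀))
        = φ₁ , φ₂ ,
          (λ n → Rk-mono K Φ n (λ {d} → Equivalence.from (φ₁⇔ d)) (proj₁ (proj₂ (Gc n)))) ,
          (λ n → Rk-mono K Φ n (λ {d} → Equivalence.from (φ₂⇔ d)) (proj₂ (proj₂ (Gc n)))) ,
          (λ {d} s → proj₁ (Equivalence.to (φ₁⇔ d) s)) ,
          (λ {d} s → proj₁ (Equivalence.to (φ₂⇔ d) s)) ,
          λ d s t → proj₂ (Equivalence.to (φ₂⇔ d) t) (proj₂ (Equivalence.to (φ₁⇔ d) s))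

      -- If all finite ranks were reached, `𝒫` would be a nonempty family in which every member
      -- splits, which Morley rank forbids.
      rank-bound : ∀ χ → ∃[ n ] ¬ Rk K Φ n (Satᴸ M χ)
      rank-bound χ = ¬∀⇒∃¬ (¬splitting 𝒫 (λ _ r → r 0) split {χ})

    module _ {D : Pred (Element M) ℓ} (B⊆D : B ⊆ D) (K⊆D : ∀ c → K c → Coords M c ⊆ D) where

      opaque
        -- Take a D-formula χ true of d whose 2-rank is least, say n. For c in K, whichever of the
        -- parts Φ _ c and ¬ Φ _ c of χ contains d is again given by a D-formula, as c lies in D,
        -- and so keeps rank n by minimality. Both parts cannot keep it, or χ would have rank n + 1.
        -- Hence Φ d c holds exactly when the part Φ _ c has rank n, and that is a D-formula in c.
        stablyEmbedded : ∀ d → Σ[ θ ∈ LFormula M D Ξ ] (∀ c → K c → Satᴸ M θ c ⇔ Sat M φ (d ++ᵗ c))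
        stablyEmbedded d =
          let χ = (⊥̇ ⇒ ⊥̇) [ [] ∣ (λ ()) ]
              n , ¬r = rank-bound (χ ⟨ _ ⟩)
          in descend n χ id ¬r
          where
          Kᴰ : ∀ {Γs} (v : Ξ ∋ Γs) → DefE D Γs (λ e → K (All.lookup e v))
          Kᴰ v = monoᴰ B⊆D (fromDefinable K-def v)

          descend : ∀ n (χ : LFormula M D Δ) → Satᴸ M χ d → ¬ Rk K Φ n (Satᴸ M χ) →
                    Σ[ θ ∈ LFormula M D Ξ ] (∀ c → K c → Satᴸ M θ c ⇔ Sat M φ (d ++ᵗ c))
          descend zero    χ χd ¬r = ⊥-elim (¬r (d , χd))
          descend (suc n) χ χd ¬r
            with em {P = Σ[ χ′ ∈ LFormula M D Δ ] Satᴸ M χ′ d × ¬ Rk K Φ n (Satᴸ M χ′)}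
          ... | yes (χ′ , χ′d , ¬r′) = descend n χ′ χ′d ¬r′
          ... | no minimal =
            let θ , θ⇔ = toDefinable {X = λ c → Rk K Φ n (λ d → Satᴸ M χ d × Φ d c)}
                           (Rkᴰ K Φ Kᴰ Φᴰ n (χᴰ v₀ ×ᴰ Φᴰ v₀ v₁))
            in θ , λ c Kc →
                 mk⇔ (λ s → dne (λ ¬Φdc →
                        ¬r (c , Kc , Equivalence.to (θ⇔ c) s ,
                            big (λ d → ¬ Φ d c) (fill c (K⊆D c Kc) (¬ᴰ Φᴰ v₁ v₀)) ¬Φdc)))
                     (λ Φdc → Equivalence.from (θ⇔ c)
                        (big (λ d → Φ d c) (fill c (K⊆D c Kc) (Φᴰ v₁ v₀)) Φdc))
            where
            χᴰ : ∀ {Γs} (v : Δ ∋ Γs) → DefE D Γs (λ e → Satᴸ M χ (All.lookup e v))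
            χᴰ = fromDefinable (Satᴸ-def χ)

            big : ∀ (X : Pred (Tuple M Δ) ℓ) → DefE D (Δ ∷ []) (λ e → X (All.lookup e v₀)) → X d →
                  Rk K Φ n (λ d → Satᴸ M χ d × X d)
            big X Xᴰ Xd = dne (λ ¬r′ →
              let χ′ , χ′⇔ = toDefinable {X = λ d → Satᴸ M χ d × X d} (χᴰ v₀ ×ᴰ Xᴰ)
              in minimal (χ′ , Equivalence.from (χ′⇔ d) (χd , Xd) ,
                          λ r → ¬r′ (Rk-mono K Φ n (λ {y} → Equivalence.to (χ′⇔ y)) r)))

-- Well-orders: every infinite segment m injects m × m into itself.

pairℕ : ℕ → ℕ → ℕ
pairℕ a b = (a ℕ.+ b) ℕ.* (a ℕ.+ b) ℕ.+ a

-- With s = a + b the values lie between s² and s² + s, which is less than (s + 1)². Different sums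
-- therefore occupy disjoint intervals; squares replace Cantor's triangular numbers since only
-- injectivity is wanted.
pairℕ-mono : ∀ a b c d → a ℕ.+ b ℕ.< c ℕ.+ d → pairℕ a b ℕ.< pairℕ c d
pairℕ-mono a b c d s<t = begin-strict
  s ℕ.* s ℕ.+ a            ≤⟨ ℕₚ.+-monoʳ-≤ (s ℕ.* s) (ℕₚ.m≤m+n a b) ⟩
  s ℕ.* s ℕ.+ s            ≡⟨ ℕₚ.+-comm (s ℕ.* s) s ⟩
  suc s ℕ.* s              <⟨ ℕₚ.*-monoʳ-< (suc s) (ℕₚ.n<1+n s) ⟩
  suc s ℕ.* suc s          ≤⟨ ℕₚ.*-mono-≤ s<t s<t ⟩
  (c ℕ.+ d) ℕ.* (c ℕ.+ d)  ≤⟨ ℕₚ.m≤m+n _ c ⟩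
  pairℕ c d                ∎
  where
  open ℕₚ.≤-Reasoning
  s = a ℕ.+ b

pairℕ-injective : ∀ a b c d → pairℕ a b ≡ pairℕ c d → a ≡ c × b ≡ d
pairℕ-injective a b c d eq with ℕₚ.<-cmp (a ℕ.+ b) (c ℕ.+ d)
... | tri< s<t _ _ = ⊥-elim (ℕₚ.<⇒≢ (pairℕ-mono a b c d s<t) eq)
... | tri> _ _ t<s = ⊥-elim (ℕₚ.<⇒≢ (pairℕ-mono c d a b t<s) (sym eq))
... | tri≈ _ s≡t _ = a≡c , ℕₚ.+-cancelˡ-≡ a b d (trans s≡t (cong (ℕ._+ d) (sym a≡c)))
  where
  a≡c = ℕₚ.+-cancelˡ-≡ ((a ℕ.+ b) ℕ.* (a ℕ.+ b)) a c
          (trans eq (cong (ℕ._+ c) (cong₂ ℕ._*_ (sym s≡t) (sym s≡t))))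

module WellOrder (em : ∀ {a} → ExcludedMiddle a) {ℓ} {K : Set ℓ} {_<_ : BinRel K ℓ}
  (sto : IsStrictTotalOrder _≡_ _<_) (wf : WellFounded _<_) where
  open Classical em
  open IsStrictTotalOrder sto using (compare) renaming (trans to <-trans; irrefl to <-irrefl)

  _≤_ : BinRel K ℓ
  x ≤ y = ¬ (y < x)

  ≤-<-trans : ∀ {x y z} → x ≤ y → y < z → x < z
  ≤-<-trans {x} {y} x≤y y<z with compare x y
  ... | tri< x<y _ _  = <-trans x<y y<z
  ... | tri≈ _ refl _ = y<z
  ... | tri> _ _ y<x  = ⊥-elim (x≤y y<x)

  <-≤-trans : ∀ {x y z} → x < y → y ≤ z → x < z
  <-≤-trans {y = y} {z} x<y y≤z with compare y z
  ... | tri< y<z _ _  = <-trans x<y y<z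
  ... | tri≈ _ refl _ = x<y
  ... | tri> _ _ z<y  = ⊥-elim (y≤z z<y)

  ≤∧≢⇒< : ∀ {x y} → x ≤ y → x ≢ y → x < y
  ≤∧≢⇒< {x} {y} x≤y x≢y with compare x y
  ... | tri< x<y _ _ = x<y
  ... | tri≈ _ x≡y _ = ⊥-elim (x≢y x≡y)
  ... | tri> _ _ y<x = ⊥-elim (x≤y y<x)

  ≤-antisym : ∀ {x y} → x ≤ y → y ≤ x → x ≡ y
  ≤-antisym {x} {y} x≤y y≤x = dne (λ x≢y → y≤x (≤∧≢⇒< x≤y x≢y))

  <⇒≤ : ∀ {x y} → x < y → x ≤ y
  <⇒≤ x<y y<x = <-irrefl refl (<-trans x<y y<x)

  ≤-refl : ∀ {x} → x ≤ x
  ≤-refl = <-irrefl refl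

  ≤-trans : ∀ {x y z} → x ≤ y → y ≤ z → x ≤ z
  ≤-trans x≤y y≤z z<x = x≤y (≤-<-trans y≤z z<x)

  max : K → K → K
  max x y with compare x y
  ... | tri< _ _ _ = y
  ... | tri≈ _ _ _ = y
  ... | tri> _ _ _ = x

  ≤maxˡ : ∀ x y → x ≤ max x y
  ≤maxˡ x y with compare x y
  ... | tri< x<y _ _  = <⇒≤ x<y
  ... | tri≈ _ refl _ = ≤-refl
  ... | tri> _ _ _    = ≤-refl

  ≤maxʳ : ∀ x y → y ≤ max x y
  ≤maxʳ x y with compare x y
  ... | tri< _ _ _   = ≤-refl
  ... | tri≈ _ _ _   = ≤-refl
  ... | tri> _ _ y<x = <⇒≤ y<x

  max< : ∀ {x y z} → x < z → y < z → max x y < z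
  max< {x} {y} x<z y<z with compare x y
  ... | tri< _ _ _ = y<z
  ... | tri≈ _ _ _ = y<z
  ... | tri> _ _ _ = x<z

  max-closed : ∀ {p} (P : Pred K p) {x y} → P x → P y → P (max x y)
  max-closed P {x} {y} Px Py with compare x y
  ... | tri< _ _ _ = Py
  ... | tri≈ _ _ _ = Py
  ... | tri> _ _ _ = Px

  Least : ∀ {p} → Pred K p → Pred K _
  Least P k = P k × (∀ {j} → P j → k ≤ j)

  least : ∀ {p} {P : Pred K p} → ∃ P → ∃ (Least P)
  least {P = P} (k , Pk) = go k (wf k) Pk
    where
    go : ∀ k → Acc _<_ k → P k → ∃ (Least P)
    go k (acc rs) Pk with em {P = ∃[ j ] j < k × P j}
    ... | yes (j , j<k , Pj) = go j (rs j<k) Pj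
    ... | no none            = k , Pk , λ Pj j<k → none (_ , j<k , Pj)

  -- Choosing by leastness depends only on the extension of the predicate. This is what allows
  -- well-founded recursions to be unfolded without function extensionality.
  least-cong : ∀ {p q} {P : Pred K p} {Q : Pred K q} {j k} → P ⊆ Q → Q ⊆ P →
               Least P j → Least Q k → j ≡ k
  least-cong P⊆Q Q⊆P (Pj , j≤) (Qk , k≤) = ≤-antisym (j≤ (Q⊆P Qk)) (k≤ (P⊆Q Pj))

  Infinite : Pred K ℓ
  Infinite m = Σ[ f ∈ (ℕ → K) ] (∀ n → f n < m) × (∀ i j → f i ≡ f j → i ≡ j)

  Infinite-≤ : ∀ {m n} → Infinite m → m ≤ n → Infinite n
  Infinite-≤ (f , f< , f-inj) m≤n = f , (λ i → <-≤-trans (f< i) m≤n) , f-inj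

  InjectsBelow : BinRel K ℓ
  InjectsBelow m n = Σ[ f ∈ (K → K) ]
    (∀ {x} → x < m → f x < n) × (∀ {x y} → x < m → y < m → f x ≡ f y → x ≡ y)

  Pairing : Pred K ℓ
  Pairing m = Σ[ f ∈ (K → K → K) ]
    (∀ {x y} → x < m → y < m → f x y < m) ×
    (∀ {x y x′ y′} → x < m → y < m → x′ < m → y′ < m → f x y ≡ f x′ y′ → x ≡ x′ × y ≡ y′)

  module _ {m : K} (m-inf : Infinite m) (m-least : ∀ {x} → x < m → ¬ Infinite x) where
    private
      next : K → K
      next x with em {P = ∃[ y ] x < y}
      ... | yes above = proj₁ (least above)
      ... | no _      = x

      next-least : ∀ {x y} → x < y → Least (x <_) (next x)
      next-least {x} {y} x<y with em {P = ∃[ y ] x < y}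
      ... | yes above = proj₂ (least above)
      ... | no none   = ⊥-elim (none (y , x<y))

      r : ℕ → K
      r zero    = proj₁ (least {P = λ _ → ⊤ {ℓ}} (m , _))
      r (suc n) = next (r n)

      module _ {x : K} (missed : ∀ n → r n ≢ x) where
        r< : ∀ n → r n < x
        r< zero    = ≤∧≢⇒< (proj₂ (proj₂ (least {P = λ _ → ⊤ {ℓ}} (m , _))) _) (missed 0)
        r< (suc n) = ≤∧≢⇒< (proj₂ (next-least (r< n)) (r< n)) (missed (suc n))

        r-mono : ∀ {i j} → i ℕ.< j → r i < r j
        r-mono {i} {suc j} (ℕ.s≤s i≤j) with ℕₚ.m≤n⇒m<n∨m≡n i≤j
        ... | inj₁ i<j  = <-trans (r-mono i<j) (proj₁ (next-least (r< j)))
        ... | inj₂ refl = proj₁ (next-least (r< j))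

        r-injective : ∀ i j → r i ≡ r j → i ≡ j
        r-injective i j eq with ℕₚ.<-cmp i j
        ... | tri< i<j _ _ = ⊥-elim (<-irrefl eq (r-mono i<j))
        ... | tri≈ _ i≡j _ = i≡j
        ... | tri> _ _ j<i = ⊥-elim (<-irrefl (sym eq) (r-mono j<i))

      -- If x were missed, the successive elements `r n` would all stay below x and make x infinite,
      -- against the leastness of m. So `r` enumerates the segment below m.
      hit : ∀ {x} → x < m → ∃[ n ] r n ≡ x
      hit {x} x<m = dne (λ none →
        let missed = λ n eq → none (n , eq)
        in m-least x<m (r , r< missed , r-injective missed))

      rank : K → ℕ
      rank x with em {P = ∃[ n ] r n ≡ x}
      ... | yes (n , _) = n
      ... | no _        = 0

      r-rank : ∀ {x} → x < m → r (rank x) ≡ x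
      r-rank {x} x<m with em {P = ∃[ n ] r n ≡ x}
      ... | yes (n , eq) = eq
      ... | no none      = ⊥-elim (none (hit x<m))

      rank-injective : ∀ {x y} → x < m → y < m → rank x ≡ rank y → x ≡ y
      rank-injective x<m y<m eq = trans (sym (r-rank x<m)) (trans (cong r eq) (r-rank y<m))

    pairing-ω : Pairing m
    pairing-ω = let f , f< , f-inj = m-inf in
      (λ x y → f (pairℕ (rank x) (rank y))) ,
      (λ _ _ → f< _) ,
      (λ x<m y<m x′<m y′<m eq →
        let p , q = pairℕ-injective _ _ _ _ (f-inj _ _ eq)
        in rank-injective x<m x′<m p , rank-injective y<m y′<m q)

  -- Hilbert's hotel: the segment below M absorbs M itself.
  absorb : ∀ {M} → Infinite M → Σ[ f ∈ (K → K) ]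
    (∀ {x} → x ≤ M → f x < M) × (∀ {x y} → x ≤ M → y ≤ M → f x ≡ f y → x ≡ y)
  absorb {M} (g , g< , g-inj) = f , f< , f-inj
    where
    data Guest : K → K → Set ℓ where
      top   : Guest M (g 0)
      moved : ∀ n → Guest (g n) (g (suc n))
      kept  : ∀ {x} → x ≢ M → (∀ n → g n ≢ x) → Guest x x

    guest : ∀ x → ∃ (Guest x)
    guest x with em {P = x ≡ M} | em {P = ∃[ n ] g n ≡ x}
    ... | yes refl | _              = _ , top
    ... | no _     | yes (n , refl) = _ , moved n
    ... | no x≢M   | no none        = _ , kept x≢M (λ n eq → none (n , eq))

    f : K → K
    f = proj₁ ∘ guest

    guest< : ∀ {x y} → Guest x y → x ≤ M → y < M
    guest< top          _   = g< 0
    guest< (moved n)    _   = g< (suc n)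
    guest< (kept x≢M _) x≤M = ≤∧≢⇒< x≤M x≢M

    f< : ∀ {x} → x ≤ M → f x < M
    f< {x} = guest< (proj₂ (guest x))

    guest-inj : ∀ {x y x′ y′} → Guest x y → Guest x′ y′ → y ≡ y′ → x ≡ x′
    guest-inj top        top         eq = refl
    guest-inj top        (moved n)   eq with () ← g-inj _ _ eq
    guest-inj top        (kept _ ne) eq = ⊥-elim (ne 0 eq)
    guest-inj (moved n)  top         eq with () ← g-inj _ _ eq
    guest-inj (moved n)  (moved k)   eq = cong g (ℕₚ.suc-injective (g-inj _ _ eq))
    guest-inj (moved n)  (kept _ ne) eq = ⊥-elim (ne (suc n) eq)
    guest-inj (kept _ ne) top        eq = ⊥-elim (ne 0 (sym eq))
    guest-inj (kept _ ne) (moved n)  eq = ⊥-elim (ne (suc n) (sym eq))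
    guest-inj (kept _ _) (kept _ _)  eq = eq

    f-inj : ∀ {x y} → x ≤ M → y ≤ M → f x ≡ f y → x ≡ y
    f-inj {x} {y} _ _ = guest-inj (proj₂ (guest x)) (proj₂ (guest y))

  -- Gödel's well-ordering of pairs.
  _≺_ : BinRel (K × K) ℓ
  _≺_ = ×-Lex _≡_ _<_ (×-Lex _≡_ _<_ _<_) on λ (x , y) → max x y , x , y

  ≺-wf : WellFounded _≺_
  ≺-wf = On.wellFounded _ (×-wellFounded wf (×-wellFounded wf wf))

  ≺-total : ∀ p q → p ≢ q → p ≺ q ⊎ q ≺ p
  ≺-total (x , y) (x′ , y′) p≢q with compare (max x y) (max x′ y′)
  ... | tri< lt _ _ = inj₁ (inj₁ lt)
  ... | tri> _ _ gt = inj₂ (inj₁ gt)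
  ... | tri≈ _ e _ with compare x x′
  ... | tri< lt _ _ = inj₁ (inj₂ (e , inj₁ lt))
  ... | tri> _ _ gt = inj₂ (inj₂ (sym e , inj₁ gt))
  ... | tri≈ _ refl _ with compare y y′
  ... | tri< lt _ _ = inj₁ (inj₂ (e , inj₂ (refl , lt)))
  ... | tri> _ _ gt = inj₂ (inj₂ (sym e , inj₂ (refl , gt)))
  ... | tri≈ _ refl _ = ⊥-elim (p≢q refl)

  ≺⇒max≤ : ∀ {p q} → p ≺ q → max (proj₁ p) (proj₂ p) ≤ max (proj₁ q) (proj₂ q)
  ≺⇒max≤ (inj₁ lt)       = <⇒≤ lt
  ≺⇒max≤ (inj₂ (eq , _)) = λ lt → <-irrefl (sym eq) lt

  -- If m is an infinite cardinal > ω, sending each pair to the least ordinal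
  -- not yet used embeds the Gödel order on pairs below m into m, because the
  -- predecessors of a pair are too few to exhaust m.
  module _ {m w : K} (IH : ∀ {j} → j < m → Infinite j → Pairing j)
    (w<m : w < m) (w-inf : Infinite w) (cardinal : ∀ {j} → j < m → ¬ InjectsBelow m j) where
    private
      fresh : Pred K ℓ → K
      fresh X with em {P = ∃[ k ] ¬ X k}
      ... | yes ∃k = proj₁ (least ∃k)
      ... | no _   = m

      fresh-least : ∀ {X k} → ¬ X k → Least (λ k → ¬ X k) (fresh X)
      fresh-least {X} {k} ¬Xk with em {P = ∃[ k ] ¬ X k}
      ... | yes ∃k  = proj₂ (least ∃k)
      ... | no none = ⊥-elim (none (k , ¬Xk))

      fresh-cong : ∀ {X Y} → X ⊆ Y → Y ⊆ X → fresh X ≡ fresh Y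
      fresh-cong {X} {Y} X⊆Y Y⊆X with em {P = ∃[ k ] ¬ X k} | em {P = ∃[ k ] ¬ Y k}
      ... | yes ∃k         | yes ∃k′        =
        least-cong (_∘ Y⊆X) (_∘ X⊆Y) (proj₂ (least ∃k)) (proj₂ (least ∃k′))
      ... | yes (k , ¬Xk)  | no none        = ⊥-elim (none (k , ¬Xk ∘ Y⊆X))
      ... | no none        | yes (k , ¬Yk)  = ⊥-elim (none (k , ¬Yk ∘ X⊆Y))
      ... | no _           | no _           = refl

      Used : ∀ p → (∀ {q} → q ≺ p → K) → Pred K ℓ
      Used p f k = Σ[ q ∈ K × K ] Σ[ q≺p ∈ q ≺ p ] f q≺p ≡ k

      module F = WF.FixPoint ≺-wf (λ _ → K) (λ p f → fresh (Used p f))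
        (λ p eq → fresh-cong (λ (q , q≺p , e) → q , q≺p , trans (sym (eq q≺p)) e)
                             (λ (q , q≺p , e) → q , q≺p , trans (eq q≺p) e))

      code : K × K → K
      code = WF.All.wfRec ≺-wf ℓ (λ _ → K) (λ p f → fresh (Used p f))

      Before : K × K → Pred K ℓ
      Before p = Used p (λ {q} _ → code q)

      module _ {x y : K} (x<m : x < m) (y<m : y < m) where
        M : K
        -- The term w makes M infinite, so that both `absorb` and the induction hypothesis apply to
        -- it.
        M = max (max x y) w

        M<m : M < m
        M<m = max< (max< x<m y<m) w<m

        M-inf : Infinite M
        M-inf = Infinite-≤ w-inf (≤maxʳ (max x y) w)

        h : K → K
        h = proj₁ (absorb M-inf)

        pr : K → K → K
        pr = proj₁ (IH M<m M-inf)

        -- If the codes of the predecessors of (x , y) filled the segment below m, sending each code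
        -- back to its pair and then through the pairing below M would inject m into M. The
        -- coordinates of a predecessor are only known to be at most M, hence the shift by `h`.
        crush : K → K
        crush k with em {P = Before (x , y) k}
        ... | yes ((x′ , y′) , _) = pr (h x′) (h y′)
        ... | no _                = m

        below : ∀ {k} ((q , _) : Before (x , y) k) → proj₁ q ≤ M × proj₂ q ≤ M
        below ((x′ , y′) , q≺p , _) =
          let max≤M = ≤-trans (≺⇒max≤ q≺p) (≤maxˡ (max x y) w)
          in ≤-trans (≤maxˡ x′ y′) max≤M , ≤-trans (≤maxʳ x′ y′) max≤M

        below-h : ∀ {k} ((q , _) : Before (x , y) k) → h (proj₁ q) < M × h (proj₂ q) < M
        below-h b = let x≤ , y≤ = below b
                        h<      = proj₁ (proj₂ (absorb M-inf))
                    in h< x≤ , h< y≤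

        crush< : (∀ {k} → k < m → Before (x , y) k) → ∀ {k} → k < m → crush k < M
        crush< before {k} k<m with em {P = Before (x , y) k}
        ... | no ¬b = ⊥-elim (¬b (before k<m))
        ... | yes b = let x< , y< = below-h b in proj₁ (proj₂ (IH M<m M-inf)) x< y<

        crush-inj : (∀ {k} → k < m → Before (x , y) k) →
                    ∀ {k k′} → k < m → k′ < m → crush k ≡ crush k′ → k ≡ k′
        crush-inj before {k} {k′} k<m k′<m eq with em {P = Before (x , y) k} | em {P = Before (x , y) k′}
        ... | no ¬b | _     = ⊥-elim (¬b (before k<m))
        ... | yes _ | no ¬b = ⊥-elim (¬b (before k′<m))
        ... | yes b@(q , _ , code≡k) | yes b′@(q′ , _ , code≡k′) =
          let h-inj   = proj₂ (proj₂ (absorb M-inf))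
              x< , y<   = below-h b
              x′< , y′< = below-h b′
              x≤ , y≤   = below b
              x′≤ , y′≤ = below b′
              p , p′    = proj₂ (proj₂ (IH M<m M-inf)) x< y< x′< y′< eq
          in trans (sym code≡k)
            (trans (cong code (cong₂ _,_ (h-inj x≤ x′≤ p) (h-inj y≤ y′≤ p′))) code≡k′)

        not-exhausted : ∃[ k ] k < m × ¬ Before (x , y) k
        not-exhausted = dne λ none →
          let before = λ {k} (k<m : k < m) → dne {P = Before (x , y) k} (λ ¬b → none (k , k<m , ¬b))
          in cardinal M<m (crush , crush< before , crush-inj before)

      code-least : ∀ {x y} → x < m → y < m →
                   code (x , y) < m × ¬ Before (x , y) (code (x , y))
      code-least {x} {y} x<m y<m =
        let k , k<m , ¬b = not-exhausted x<m y<m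
            ¬bk , k≤     = subst (Least (λ k → ¬ Before (x , y) k)) (sym F.unfold-wfRec) (fresh-least ¬b)
        in ≤-<-trans (k≤ ¬b) k<m , ¬bk

    pairing-> : Pairing m
    pairing-> = (λ x y → code (x , y)) , (λ x<m y<m → proj₁ (code-least x<m y<m)) ,
      λ {x} {y} {x′} {y′} x<m y<m x′<m y′<m eq →
        let p≡q = dne {P = (x , y) ≡ (x′ , y′)} λ p≢q →
              [ (λ p≺q → proj₂ (code-least x′<m y′<m) (_ , p≺q , eq)) ,
                (λ q≺p → proj₂ (code-least x<m y<m) (_ , q≺p , sym eq)) ]
              (≺-total (x , y) (x′ , y′) p≢q)
        in cong proj₁ p≡q , cong proj₂ p≡q

  -- Three cases. If m injects into a smaller j, the pairing of j is transported, and j is infinite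
  -- because m is. If m is an initial ordinal above an infinite w, the Gödel ordering is used.
  -- Otherwise m is the least infinite element, and pairs of naturals suffice.
  pairing : ∀ m → Infinite m → Pairing m
  pairing m = go m (wf m)
    where
    go : ∀ m → Acc _<_ m → Infinite m → Pairing m
    go m (acc rs) m-inf
      with em {P = ∃[ j ] j < m × InjectsBelow m j}
         | em {P = ∃[ w ] w < m × Infinite w}
    ... | yes (j , j<m , f , f< , f-inj) | _ =
      let g , g< , g-inj    = m-inf
          pr , pr< , pr-inj = go j (rs j<m) (f ∘ g , (λ n → f< (g< n)) ,
                                             λ i k → g-inj i k ∘ f-inj (g< i) (g< k))
      in (λ x y → pr (f x) (f y)) ,
         (λ x<m y<m → <-trans (pr< (f< x<m) (f< y<m)) j<m) ,
         (λ x<m y<m x′<m y′<m eq →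
           let p , q = pr-inj (f< x<m) (f< y<m) (f< x′<m) (f< y′<m) eq
           in f-inj x<m x′<m p , f-inj y<m y′<m q)
    ... | no card | yes (w , w<m , w-inf) =
      pairing-> (λ j<m → go _ (rs j<m)) w<m w-inf (λ j<m inj → card (_ , j<m , inj))
    ... | no _    | no none = pairing-ω m-inf (λ x<m x-inf → none (_ , x<m , x-inf))

-- Closure properties of the sets of size below κ.

nth : ∀ {a} {A : Set a} → List A → ℕ → A → Set a
nth xs n x = head (drop n xs) ≡ just x

∈⇒nth : ∀ {a} {A : Set a} {x : A} {xs} → x ∈ˡ xs → ∃[ n ] nth xs n x
∈⇒nth (here refl) = 0 , refl
∈⇒nth (there i)   = let n , h = ∈⇒nth i in suc n , h

module Smallness (em : ∀ {a} → ExcludedMiddle a) {ℓ} (κ : Cardinal ℓ) where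
  open Cardinal κ
  open WellOrder em isStrictTotalOrder wellFounded

  private
    Small : {A : Set ℓ} → Pred A ℓ → Set ℓ
    Small = SmallerThan κ

  module _ (ω : ∃ Infinite) where
    private
      variable
        A A′ : Set ℓ
        X    : Pred A ℓ
        Y    : Pred A′ ℓ

      -- One segment m that receives X, Y and the naturals at once and is closed under a pairing, so
      -- that the codes built from all three stay below m.
      record Joint {A A′ : Set ℓ} (X : Pred A ℓ) (Y : Pred A′ ℓ) : Set ℓ where
        field
          m       : Carrier
          f       : A → Carrier
          g       : A′ → Carrier
          n       : ℕ → Carrier
          f<      : ∀ {x} → X x → f x < m
          g<      : ∀ {y} → Y y → g y < m
          n<      : ∀ i → n i < m
          f-inj   : ∀ {x x′} → X x → X x′ → f x ≡ f x′ → x ≡ x′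
          g-inj   : ∀ {y y′} → Y y → Y y′ → g y ≡ g y′ → y ≡ y′
          n-inj   : ∀ i j → n i ≡ n j → i ≡ j
          pair    : Pairing m

        pr : Carrier → Carrier → Carrier
        pr = proj₁ pair

        pr< : ∀ {x y} → x < m → y < m → pr x y < m
        pr< = proj₁ (proj₂ pair)

        pr-inj : ∀ {x y x′ y′} → x < m → y < m → x′ < m → y′ < m →
                 pr x y ≡ pr x′ y′ → x ≡ x′ × y ≡ y′
        pr-inj = proj₂ (proj₂ pair)

      joint : Small X → Small Y → Joint X Y
      joint (k , f , f< , f-inj) (l , g , g< , g-inj) =
        let o , o-inf         = ω
            m                 = max (max k l) o
            m-inf             = Infinite-≤ o-inf (≤maxʳ (max k l) o)
            n , n< , n-inj    = m-inf
        in record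
          { m = m ; f = f ; g = g ; n = n
          ; f<      = λ x → <-≤-trans (f< x) (≤-trans (≤maxˡ k l) (≤maxˡ (max k l) o))
          ; g<      = λ y → <-≤-trans (g< y) (≤-trans (≤maxʳ k l) (≤maxˡ (max k l) o))
          ; n<      = n<
          ; f-inj   = f-inj
          ; g-inj   = g-inj
          ; n-inj   = n-inj
          ; pair    = pairing m m-inf
          }

    small-injection : (g : A → A′) → (∀ {x} → X x → Y (g x)) →
                      (∀ {x y} → X x → X y → g x ≡ g y → x ≡ y) → Small Y → Small X
    small-injection g X⇒Y g-inj (k , f , f< , f-inj) =
      k , f ∘ g , (f< ∘ X⇒Y) , λ x y e → g-inj x y (f-inj (X⇒Y x) (X⇒Y y) e)

    small-⊆ : {Y : Pred A ℓ} → X ⊆ Y → Small Y → Small X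
    small-⊆ X⊆Y = small-injection id X⊆Y (λ _ _ e → e)

    small-ℕ : Small {A = Lift ℓ ℕ} (λ _ → ⊤)
    small-ℕ = let o , f , f< , f-inj = ω in
      o , f ∘ lower , (λ _ → f< _) , λ { {↑ i} {↑ j} _ _ e → cong ↑ (f-inj i j e) }

    small-singleton : (x : A) → Small (x ≡_)
    small-singleton x = let o , f , f< , _ = ω in
      o , (λ _ → f 0) , (λ _ → f< 0) , λ { refl refl _ → refl }

    small-× : {X : Pred A ℓ} {Y : Pred A′ ℓ} → Small X → Small Y →
              Small {A = A × A′} (λ (x , y) → X x × Y y)
    small-× {X = X} {Y = Y} sX sY =
      m , (λ (x , y) → pr (f x) (g y)) , (λ (x , y) → pr< (f< x) (g< y)) ,
      λ (x , y) (x′ , y′) e →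
        let p , q = pr-inj (f< x) (g< y) (f< x′) (g< y′) e
        in cong₂ _,_ (f-inj x x′ p) (g-inj y y′ q)
      where open Joint (joint {X = X} {Y = Y} sX sY)

    -- A union of countable sets over a small index set; R i enumerates the
    -- i-th one by a partial function.
    small-⋃ : (R : A → ℕ → A′ → Set ℓ) → (∀ {i n x y} → R i n x → R i n y → x ≡ y) →
              Small X → Small (λ x → ∃[ i ] X i × ∃[ n ] R i n x)
    small-⋃ {A = A} {A′ = A′} {X = X} R functional sX = m , h , h< , h-inj
      where
      open Joint (joint {X = X} {Y = X} sX sX)

      h : A′ → Carrier
      h x with em {P = ∃[ i ] X i × ∃[ n ] R i n x}
      ... | yes (i , _ , k , _) = pr (f i) (n k)
      ... | no _                = m

      h< : ∀ {x} → ∃[ i ] X i × ∃[ n ] R i n x → h x < m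
      h< {x} x∈ with em {P = ∃[ i ] X i × ∃[ n ] R i n x}
      ... | yes (i , Xi , k , _) = pr< (f< Xi) (n< k)
      ... | no x∉                = ⊥-elim (x∉ x∈)

      h-inj : ∀ {x y} → ∃[ i ] X i × ∃[ n ] R i n x → ∃[ i ] X i × ∃[ n ] R i n y →
              h x ≡ h y → x ≡ y
      h-inj {x} {y} x∈ y∈ e
        with em {P = ∃[ i ] X i × ∃[ n ] R i n x} | em {P = ∃[ i ] X i × ∃[ n ] R i n y}
      ... | no x∉ | _     = ⊥-elim (x∉ x∈)
      ... | yes _ | no y∉ = ⊥-elim (y∉ y∈)
      ... | yes (i , Xi , k , r) | yes (j , Xj , l , s)
        with p , q ← pr-inj (f< Xi) (n< k) (f< Xj) (n< l) e
        with refl ← f-inj Xi Xj p | refl ← n-inj k l q = functional r s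

    small-∪ : {X Y : Pred A ℓ} → Small X → Small Y → Small (X ∪ Y)
    small-∪ {A = A} {X = X} {Y = Y} sX sY = m , h , h< , h-inj
      where
      open Joint (joint {X = X} {Y = Y} sX sY)

      h : A → Carrier
      h x with em {P = X x}
      ... | yes _ = pr (n 0) (f x)
      ... | no _  = pr (n 1) (g x)

      h< : ∀ {x} → (X ∪ Y) x → h x < m
      h< {x} x∈ with em {P = X x} | x∈
      ... | yes Xx | _       = pr< (n< 0) (f< Xx)
      ... | no ¬Xx | inj₁ Xx = ⊥-elim (¬Xx Xx)
      ... | no _   | inj₂ Yx = pr< (n< 1) (g< Yx)

      h-inj : ∀ {x y} → (X ∪ Y) x → (X ∪ Y) y → h x ≡ h y → x ≡ y
      h-inj {x} {y} x∈ y∈ e with em {P = X x} | em {P = X y} | x∈ | y∈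
      ... | yes Xx | yes Xy | _       | _       =
        f-inj Xx Xy (proj₂ (pr-inj (n< 0) (f< Xx) (n< 0) (f< Xy) e))
      ... | no ¬Xx | _      | inj₁ Xx | _       = ⊥-elim (¬Xx Xx)
      ... | _      | no ¬Xy | _       | inj₁ Xy = ⊥-elim (¬Xy Xy)
      ... | no _   | no _   | inj₂ Yx | inj₂ Yy =
        g-inj Yx Yy (proj₂ (pr-inj (n< 1) (g< Yx) (n< 1) (g< Yy) e))
      ... | yes Xx | no _   | _       | inj₂ Yy
        with () ← n-inj 0 1 (proj₁ (pr-inj (n< 0) (f< Xx) (n< 1) (g< Yy) e))
      ... | no _   | yes Xy | inj₂ Yx | _
        with () ← n-inj 1 0 (proj₁ (pr-inj (n< 1) (g< Yx) (n< 0) (f< Xy) e))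

    -- The length is stored beside the code: the terminal value `n 0` may also arise as a paired
    -- value, so `code` alone separates only lists of equal length.
    small-List : Small X → Small {A = List A} (All X)
    small-List {A = A} {X = X} sX =
      m , (λ xs → pr (n (length xs)) (code xs)) , (λ Xs → pr< (n< _) (code< Xs)) ,
      λ Xs Ys e → let p , q = pr-inj (n< _) (code< Xs) (n< _) (code< Ys) e
                  in code-inj Xs Ys (n-inj _ _ p) q
      where
      open Joint (joint {X = X} {Y = X} sX sX)

      code : List A → Carrier
      code []       = n 0
      code (x ∷ xs) = pr (f x) (code xs)

      code< : ∀ {xs} → All X xs → code xs < m
      code< []        = n< 0
      code< (Xx ∷ Xs) = pr< (f< Xx) (code< Xs)

      code-inj : ∀ {xs ys} → All X xs → All X ys → length xs ≡ length ys → code xs ≡ code ys → xs ≡ ys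
      code-inj []        []        _ _ = refl
      code-inj (Xx ∷ Xs) (Xy ∷ Ys) l e =
        let p , q = pr-inj (f< Xx) (code< Xs) (f< Xy) (code< Ys) e
        in cong₂ _∷_ (f-inj Xx Xy p) (code-inj Xs Ys (ℕₚ.suc-injective l) q)

-- Partial elementary maps as relations.

module Elementarity (em : ∀ {a} → ExcludedMiddle a) {ℓ} {L : Language ℓ} (M : Structure L) where
  open Classical em
  open Definability em M
  open Language L
  open Structure M

  Pairs : Set _
  Pairs = Pred (Element M × Element M) ℓ

  private
    variable
      Γ Δ Ω : Context L
      Γs : List (Context L)
      R R′ : Pairs

  infixr 5 _∷_
  -- Partial maps are kept as relations, so that extending one is a union. Being a function is not
  -- imposed: for an elementary relation it follows from the preservation of equations. Pairs across
  -- different sorts never take part.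
  data Related (R : Pairs) : ∀ {Γ} → Tuple M Γ → Tuple M Γ → Set ℓ where
    []  : Related R [] []
    _∷_ : ∀ {Γ s d e} {x y : Tuple M Γ} →
          R ((s , d) , (s , e)) → Related R x y → Related R (d ∷ x) (e ∷ y)

  related-⊆ : R ⊆ R′ → {x y : Tuple M Γ} → Related R x y → Related R′ x y
  related-⊆ R⊆R′ []       = []
  related-⊆ R⊆R′ (r ∷ rs) = R⊆R′ r ∷ related-⊆ R⊆R′ rs

  related-flip : {x y : Tuple M Γ} → Related R x y → Related (R ∘ swap) y x
  related-flip []       = []
  related-flip (r ∷ rs) = r ∷ related-flip rs

  related-++ : {x y : Tuple M Γ} {x′ y′ : Tuple M Δ} → Related R x y → Related R x′ y′ →
               Related R (x ++ᵗ x′) (y ++ᵗ y′)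
  related-++ []       rs′ = rs′
  related-++ (r ∷ rs) rs′ = r ∷ related-++ rs rs′

  related-lookup : ∀ {s} {x y : Tuple M Γ} → Related R x y → (i : s ∋ Γ) →
                   R ((s , All.lookup x i) , (s , All.lookup y i))
  related-lookup (r ∷ rs) (here refl) = r
  related-lookup (r ∷ rs) (there i)   = related-lookup rs i

  related-by : {x y : Tuple M Γ} →
               (∀ {s} (i : s ∋ Γ) → R ((s , All.lookup x i) , (s , All.lookup y i))) → Related R x y
  related-by {x = []}    {y = []}    h = []
  related-by {x = d ∷ x} {y = e ∷ y} h = h (here refl) ∷ related-by (h ∘ there)

  Diagonal : Pred (Element M) ℓ → Pairs
  Diagonal A (a , b) = A a × a ≡ b

  related-diagonal : ∀ {A} (x : Tuple M Γ) → Coords M x ⊆ A → Related (Diagonal A) x x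
  related-diagonal x x⊆A = related-by (λ i → x⊆A (i , refl) , refl)

  diagonal-≡ : ∀ {A} {x y : Tuple M Γ} → Related (Diagonal A) x y → Coords M x ⊆ A × x ≡ y
  diagonal-≡ []                = (λ ()) , refl
  diagonal-≡ ((a , refl) ∷ rs) with x⊆A , refl ← diagonal-≡ rs =
    (λ { (here refl , refl) → a ; (there i , e) → x⊆A (i , e) }) , refl

  Elementary : Pairs → Set ℓ
  Elementary R = ∀ {Γ} {x y : Tuple M Γ} → Related R x y → ∀ φ → Sat M φ x → Sat M φ y

  elementary-⊆ : R′ ⊆ R → Elementary R → Elementary R′
  elementary-⊆ R′⊆R el = el ∘ related-⊆ R′⊆R

  elementary-flip : Elementary R → Elementary (R ∘ swap)
  elementary-flip el r φ φx = dne (λ ¬φy → lower (el (related-flip r) (neg L φ) (↑ ∘ ¬φy) φx))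

  data RelatedEnv (R : Pairs) : ∀ {Γs} → Env Γs → Env Γs → Set ℓ where
    []  : RelatedEnv R [] []
    _∷_ : ∀ {Γ Γs} {x y : Tuple M Γ} {e f : Env Γs} →
          Related R x y → RelatedEnv R e f → RelatedEnv R (x ∷ e) (y ∷ f)

  related-cat : {e f : Env Γs} → RelatedEnv R e f → Related R (catᵗ e) (catᵗ f)
  related-cat []       = []
  related-cat (r ∷ rs) = related-++ r (related-cat rs)

  transfer : ∀ {A} {X : Pred (Env Γs) ℓ} → Elementary R → Diagonal A ⊆ R → DefE A Γs X →
             ∀ {e f} → RelatedEnv R e f → X e → X f
  transfer el A⊆R (φ [ a ∣ a⊆A ] , φ⇔X) {e} {f} r Xe =
    Equivalence.to (φ⇔X f)
      (el (related-++ (related-⊆ A⊆R (related-diagonal a a⊆A)) (related-cat r)) φ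
          (Equivalence.from (φ⇔X e) Xe))

  -- Related tuples x , y are obtained by one substitution of variables from
  -- an R-related and an R′-related pair.
  record Split (R R′ : Pairs) {Γ} (x y : Tuple M Γ) : Set ℓ where
    constructor split
    field
      {Γ₁ Γ₂}  : Context L
      {x₁ y₁}  : Tuple M Γ₁
      {x₂ y₂}  : Tuple M Γ₂
      related₁ : Related R x₁ y₁
      related₂ : Related R′ x₂ y₂
      ρ        : Ren Γ (Γ₁ ++ Γ₂)
      x≡       : pull ρ (x₁ ++ᵗ x₂) ≡ x
      y≡       : pull ρ (y₁ ++ᵗ y₂) ≡ y

  related-split : {x y : Tuple M Γ} → Related (R ∪ R′) x y → Split R R′ x y
  related-split []              = split [] [] [] refl refl
  related-split (inj₁ r ∷ rs) with split r₁ r₂ ρ x≡ y≡ ← related-split rs =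
    split (r ∷ r₁) r₂ (here refl ∷ wk ρ)
      (cong (_ ∷_) (trans (pull-wk ρ _) x≡)) (cong (_ ∷_) (trans (pull-wk ρ _) y≡))
  related-split {R = R} {R′ = R′} (_∷_ {s = s} {d} {e} (inj₂ r) rs)
    with split {Γ₁} {Γ₂} {x₁} {y₁} {x₂} {y₂} r₁ r₂ ρ x≡ y≡ ← related-split {R = R} {R′ = R′} rs =
    split {Γ₂ = s ∷ Γ₂} r₁ (r ∷ r₂) (All.lookup new (here refl) ∷ (ρ ⨾ old))
      (cong₂ _∷_ (new≡ x₁ x₂ d) (trans (pull-⨾ ρ old (x₁ ++ᵗ d ∷ x₂)) (trans (cong (pull ρ) (old≡ x₁ x₂ d)) x≡)))
      (cong₂ _∷_ (new≡ y₁ y₂ e) (trans (pull-⨾ ρ old (y₁ ++ᵗ e ∷ y₂)) (trans (cong (pull ρ) (old≡ y₁ y₂ e)) y≡)))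
    where
    new : Ren (s ∷ Γ₂) (Γ₁ ++ s ∷ Γ₂)
    new = inrʳ {Γ = Γ₁}

    new≡ : ∀ (u : Tuple M Γ₁) (v : Tuple M Γ₂) d →
           All.lookup (u ++ᵗ d ∷ v) (All.lookup new (here refl)) ≡ d
    new≡ u v d = trans (sym (lookup-pull new (u ++ᵗ d ∷ v) (here refl)))
                       (cong (λ z → All.lookup z (here refl)) (pull-inr u (d ∷ v)))

    old : Ren (Γ₁ ++ Γ₂) (Γ₁ ++ s ∷ Γ₂)
    old = inlʳ ++ᵗ (wk {s = s} idʳ ⨾ inrʳ {Γ = Γ₁})

    old≡ : ∀ (u : Tuple M Γ₁) (v : Tuple M Γ₂) d → pull old (u ++ᵗ d ∷ v) ≡ u ++ᵗ v
    old≡ u v d = pull-⊕ inlʳ (wk {s = s} idʳ ⨾ inrʳ {Γ = Γ₁}) (u ++ᵗ d ∷ v) (pull-inl u (d ∷ v))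
                   (trans (pull-⨾inr (wk {s = s} idʳ) u (d ∷ v))
                   (trans (pull-wk idʳ v) (pull-id v)))

  related-const : ∀ {s d e} {x y : Tuple M Γ} → Related (((s , d) , (s , e)) ≡_) x y →
                  Σ[ ρ ∈ Ren Γ (s ∷ []) ] pull ρ (d ∷ []) ≡ x × pull ρ (e ∷ []) ≡ y
  related-const []          = [] , refl , refl
  related-const (refl ∷ rs) =
    let ρ , x≡ , y≡ = related-const rs in here refl ∷ ρ , cong (_ ∷_) x≡ , cong (_ ∷_) y≡

  module _ (el : Elementary R)
    (total : ∀ {s} (d : Dom s) → ∃[ e ] R ((s , d) , (s , e)))
    (onto  : ∀ {s} (e : Dom s) → ∃[ d ] R ((s , d) , (s , e)))
    where

    private
      functional : ∀ {s} {d e e′ : Dom s} → R ((s , d) , (s , e)) → R ((s , d) , (s , e′)) → e ≡ e′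
      functional r r′ = el (r ∷ r′ ∷ []) (var v₀ ≐ var v₁) refl

      injective : ∀ {s} {d d′ e : Dom s} → R ((s , d) , (s , e)) → R ((s , d′) , (s , e)) → d ≡ d′
      injective r r′ = elementary-flip el (r ∷ r′ ∷ []) (var v₀ ≐ var v₁) refl

      related-map : (x : Tuple M Γ) → Related R x (All.map (λ d → proj₁ (total d)) x)
      related-map []      = []
      related-map (d ∷ x) = proj₂ (total d) ∷ related-map x

      evals-vars : ∀ {Γ Δ} (ρ : Ren Γ Δ) (x : Tuple M Δ) → evals M x (All.map var ρ) ≡ pull ρ x
      evals-vars []      x = refl
      evals-vars (i ∷ ρ) x = cong (_ ∷_) (evals-vars ρ x)

    -- Preserving the formula x = y in both directions makes the relation a bijection on each sort.
    -- Preserving the formulas y = f(x) and the atomic relations makes this bijection an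
    -- automorphism.
    elementary⇒automorphism :
      Σ[ σ ∈ Automorphism M ] ∀ {s d e} → R ((s , d) , (s , e)) → Automorphism.to σ d ≡ e
    elementary⇒automorphism = record
      { bijection     = λ s → mk↔ₛ′ (λ d → proj₁ (total d)) (λ e → proj₁ (onto e))
          (λ e → functional (proj₂ (total _)) (proj₂ (onto e)))
          (λ d → injective (proj₂ (onto _)) (proj₂ (total d)))
      ; preserves-fun = λ {Δ} {s} f xs →
          trans (el (proj₂ (total (fun f xs)) ∷ related-map xs)
                   (var v₀ ≐ app f (All.map var (wk idʳ)))
                   (cong (fun f) (sym (vars≡ xs _))))
                (cong (fun f) (vars≡ _ _))
      ; preserves-rel = λ Q xs → mk⇔
          (λ q → subst (relation Q) (vars≡′ _)
                   (el (related-map xs) (rel Q (All.map var idʳ)) (subst (relation Q) (sym (vars≡′ xs)) q)))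
          (λ q → subst (relation Q) (vars≡′ _)
                   (elementary-flip el (related-flip (related-map xs)) (rel Q (All.map var idʳ))
                     (subst (relation Q) (sym (vars≡′ _)) q)))
      } , λ r → functional (proj₂ (total _)) r
      where
      vars≡′ : ∀ {Δ} (xs : Tuple M Δ) → evals M xs (All.map var idʳ) ≡ xs
      vars≡′ xs = trans (evals-vars idʳ xs) (pull-id xs)

      vars≡ : ∀ {Δ s} (xs : Tuple M Δ) (d : Dom s) → evals M (d ∷ xs) (All.map var (wk idʳ)) ≡ xs
      vars≡ xs d = trans (evals-vars (wk idʳ) (d ∷ xs)) (trans (pull-wk idʳ xs) (pull-id xs))

-- Finite tuples over small sets, and powers of 𝒞.

module SmallTuples (em : ∀ {a} → ExcludedMiddle a) {ℓ} {L : Language ℓ} (M : Structure L)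
  (κ : Cardinal ℓ) (saturatedIn : SaturatedIn M κ) where
  open SaturatedIn saturatedIn
  open Cardinal κ using (Carrier)
  open WellOrder em (Cardinal.isStrictTotalOrder κ) (Cardinal.wellFounded κ) using (Infinite)
  open Smallness em κ

  private
    tower : ℕ → Formula L []
    tower zero    = ⊥̇
    tower (suc n) = ⊥̇ ⇒ tower n

    tower-injective : ∀ i j → tower i ≡ tower j → i ≡ j
    tower-injective zero    zero    _  = refl
    tower-injective (suc i) (suc j) eq = cong suc (tower-injective i j (⇒-injective eq))
      where
      ⇒-injective : ∀ {φ ψ : Formula L []} → (⊥̇ ⇒ φ) ≡ (⊥̇ ⇒ ψ) → φ ≡ ψ
      ⇒-injective refl = refl

  -- The formulas ⊥, ⊥ ⇒ ⊥, ⊥ ⇒ (⊥ ⇒ ⊥), ... are pairwise distinct, so a segment of κ that receives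
  -- all formulas is infinite.
  ω : ∃ Infinite
  ω = let k , f , f< , f-inj = language<κ
      in k , (λ n → f ([] , tower n)) , (λ _ → f< _) ,
         λ i j eq → tower-injective i j (Σ-injective (f-inj _ _ eq))
    where
    Σ-injective : ∀ {φ ψ : Formula L []} → _≡_ {A = Σ (Context L) (Formula L)} ([] , φ) ([] , ψ) → φ ≡ ψ
    Σ-injective refl = refl

  elements : ∀ {Γ} → Tuple M Γ → List (Element M)
  elements []      = []
  elements (d ∷ x) = (_ , d) ∷ elements x

  elements-injective : ∀ {Γ Δ} (x : Tuple M Γ) (y : Tuple M Δ) → elements x ≡ elements y →
                       _≡_ {A = Σ (Context L) (Tuple M)} (Γ , x) (Δ , y)
  elements-injective []      []      _  = refl
  elements-injective (d ∷ x) (e ∷ y) eq with refl , eq′ ← ∷-injective eq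
    with refl ← elements-injective x y eq′ = refl

  elements⊆ : ∀ {A : Pred (Element M) ℓ} {Γ} (x : Tuple M Γ) → Coords M x ⊆ A → All A (elements x)
  elements⊆ []      _   = []
  elements⊆ (d ∷ x) x⊆A = x⊆A (here refl , refl) ∷ elements⊆ x (λ (i , e) → x⊆A (there i , e))

  nth-elements : ∀ {Γ} (x : Tuple M Γ) {a} → Coords M x a → ∃[ n ] nth (elements x) n a
  nth-elements (d ∷ x) (here refl , refl) = 0 , refl
  nth-elements (d ∷ x) (there i , e)      = let n , h = nth-elements x (i , e) in suc n , h

  small-tuples : {A : Pred (Element M) ℓ} → SmallerThan κ A →
                 SmallerThan κ {A = Σ (Context L) (Tuple M)} (λ (_ , x) → Coords M x ⊆ A)
  small-tuples sA =
    small-injection ω (λ (_ , x) → elements x) (λ {(_ , x)} → elements⊆ x)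
      (λ {(_ , x)} {(_ , y)} _ _ → elements-injective x y) (small-List ω sA)

  small-coords : {I : Set ℓ} {X : Pred I ℓ} {Γ : I → Context L} (t : ∀ i → Tuple M (Γ i)) →
                 SmallerThan κ X → SmallerThan κ (λ a → ∃[ i ] X i × Coords M (t i) a)
  small-coords t sX =
    small-⊆ ω (λ (i , Xi , c) → i , Xi , nth-elements (t i) c)
      (small-⋃ ω (λ i n a → nth (elements (t i)) n a) (λ h h′ → just-injective (trans (sym h) h′)) sX)

  small-Coords : ∀ {Γ} (x : Tuple M Γ) → SmallerThan κ (Coords M x)
  small-Coords x =
    small-⊆ ω (λ c → _ , refl , c) (small-coords (λ _ → x) (small-singleton ω {A = Lift ℓ ℕ} (↑ 0)))

  ℵ₀-saturated : ℵ₀-Saturated M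
  ℵ₀-saturated a = saturated (Coords M a) (small-Coords a)

module Powers {ℓ} {L : Language ℓ} {M : Structure L} (em : ∀ {a} → ExcludedMiddle a)
  {B : Pred (Element M) ℓ} {Θ : Context L} {𝒞 : Pred (Tuple M Θ) ℓ} (𝒞-def : Definable M B 𝒞) where
  open Definability em M

  pow : ℕ → Context L
  pow zero    = []
  pow (suc n) = Θ ++ pow n

  𝒞^ : ∀ n → Pred (Tuple M (pow n)) ℓ
  𝒞^ zero    _ = ⊤
  𝒞^ (suc n) w = 𝒞 (pull inlʳ w) × 𝒞^ n (pull (inrʳ {Γ = Θ}) w)

  𝒞^-def : ∀ n → Definable M B (𝒞^ n)
  𝒞^-def zero    = toDefinable (⊤ᴰ (λ _ → _))
  𝒞^-def (suc n) = toDefinable (fromDefinable-pull 𝒞-def inlʳ v₀ ×ᴰ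
                                fromDefinable-pull (𝒞^-def n) (inrʳ {Γ = Θ}) v₀)

  𝒞^-++ : ∀ n {x w} → 𝒞 x → 𝒞^ n w → 𝒞^ (suc n) (x ++ᵗ w)
  𝒞^-++ n {x} {w} 𝒞x 𝒞w =
    subst 𝒞 (sym (pull-inl x w)) 𝒞x , subst (𝒞^ n) (sym (pull-inr x w)) 𝒞w

  ++-split : ∀ Γ {Δ} (w : Tuple M (Γ ++ Δ)) →
             Σ[ x ∈ Tuple M Γ ] Σ[ y ∈ Tuple M Δ ] w ≡ x ++ᵗ y
  ++-split []      w       = [] , w , refl
  ++-split (s ∷ Γ) (d ∷ w) = let x , y , eq = ++-split Γ w in d ∷ x , y , cong (d ∷_) eq

  𝒞^⊆ : ∀ n c → 𝒞^ n c → Coords M c ⊆ CoordsOf M 𝒞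
  𝒞^⊆ zero    []  _ ()
  𝒞^⊆ (suc n) w (𝒞x , 𝒞y) with x , y , refl ← ++-split Θ w =
    Coords-++ x y (λ c → x , subst 𝒞 (pull-inl x y) 𝒞x , c)
                  (𝒞^⊆ n y (subst (𝒞^ n) (pull-inr x y) 𝒞y))

  -- A parameter from 𝒞 is a single coordinate of a member of 𝒞. Completing each one to a whole
  -- member turns a finite tuple of such parameters into a projection of a point of the definable
  -- set `𝒞^ n`, over which formulas can quantify.
  from-𝒞^ : ∀ {Γ} (x : Tuple M Γ) → Coords M x ⊆ CoordsOf M 𝒞 →
            ∃[ n ] ∃[ c ] 𝒞^ n c × Σ[ ρ ∈ Ren Γ (pow n) ] pull ρ c ≡ x
  from-𝒞^ []      _ = 0 , [] , _ , [] , refl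
  from-𝒞^ (d ∷ x) x⊆
    with n , c , 𝒞c , ρ , eq ← from-𝒞^ x (λ (i , e) → x⊆ (there i , e))
       | y , 𝒞y , i , eq′ ← x⊆ (here refl , refl)
    = suc n , y ++ᵗ c , 𝒞^-++ n 𝒞y 𝒞c ,
      All.lookup inlʳ i ∷ (ρ ⨾ inrʳ {Γ = Θ}) ,
      cong₂ _∷_
        (trans (sym (lookup-pull inlʳ (y ++ᵗ c) i))
        (trans (cong (λ z → All.lookup z i) (pull-inl y c)) eq′))
        (trans (pull-⨾inr ρ y c) eq)

-- One step of the back-and-forth over D.

module Extension (em : ∀ {a} → ExcludedMiddle a) {ℓ} {L : Language ℓ} (M : Structure L)
  (κ : Cardinal ℓ) (saturatedIn : SaturatedIn M κ)
  (ranked : ∀ {Γ} (φ : LFormula M (λ _ → ⊤) Γ) → Σ[ α ∈ Ordinal ℓ ] ¬ MorleyRank≥ M α φ)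
  {B : Pred (Element M) ℓ} (B-small : SmallerThan κ B)
  {Θ : Context L} {𝒞 : Pred (Tuple M Θ) ℓ} (𝒞-def : Definable M B 𝒞) where
  open Definability em M
  open SaturatedIn saturatedIn
  open Structure M
  open Smallness em κ
  open SmallTuples em M κ saturatedIn
  open Stable em M ranked ℵ₀-saturated
  open Elementarity em M
  open Powers em 𝒞-def

  D : Pred (Element M) ℓ
  D = B ∪ CoordsOf M 𝒞

  coordsˡ : ∀ {A : Pred (Element M) ℓ} {R : Pairs} → (∀ {a b} → R (a , b) → A a) →
            ∀ {Γ} {x y : Tuple M Γ} → Related R x y → Coords M x ⊆ A
  coordsˡ R⇒A r (i , refl) = R⇒A (related-lookup r i)

  coordsʳ : ∀ {A : Pred (Element M) ℓ} {R : Pairs} → (∀ {a b} → R (a , b) → A b) →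
            ∀ {Γ} {x y : Tuple M Γ} → Related R x y → Coords M y ⊆ A
  coordsʳ R⇒A r (i , refl) = R⇒A (related-lookup r i)

  refineʳ : ∀ {Γ Δ Ω : Context L} → Ren Δ Ω → Ren (Γ ++ Δ) (Γ ++ Ω)
  refineʳ {Γ} ρ = inlʳ {Γ = Γ} ++ᵗ (ρ ⨾ inrʳ {Γ = Γ})

  pull-refineʳ : ∀ {Γ Δ Ω Ξ : Context L} (ρ : Ren Ξ (Γ ++ Δ)) (ρ′ : Ren Δ Ω)
                 (x : Tuple M Γ) (y : Tuple M Ω) →
                 pull (ρ ⨾ refineʳ ρ′) (x ++ᵗ y) ≡ pull ρ (x ++ᵗ pull ρ′ y)
  pull-refineʳ {Γ} ρ ρ′ x y =
    trans (pull-⨾ ρ (refineʳ ρ′) (x ++ᵗ y))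
          (cong (pull ρ) (pull-⊕ (inlʳ {Γ = Γ}) (ρ′ ⨾ inrʳ {Γ = Γ}) (x ++ᵗ y)
                           (pull-inl x y) (pull-⨾inr ρ′ x y)))

  Left Right : Pairs → Pred (Element M) ℓ
  Left  S a = ∃[ b ] S (a , b)
  Right S b = ∃[ a ] S (a , b)

  module _ {S : Pairs} (S-left : SmallerThan κ (Left S)) (S-right : SmallerThan κ (Right S))
    (el : Elementary (Diagonal D ∪ S)) {s} (d : Dom s) where
    private
      Λ : Pred (Element M) ℓ
      Λ = (Left S ∪ B) ∪ ((s , d) ≡_)

      Λ-small : SmallerThan κ Λ
      Λ-small = small-∪ ω (small-∪ ω S-left B-small) (small-singleton ω (s , d))

      Index : Set ℓ
      Index = Σ[ Ω ∈ Context L ] Tuple M Ω × Σ[ n ∈ ℕ ] Formula L (Ω ++ pow n)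

      index-small : SmallerThan κ {A = Index} (λ (_ , x , _) → Coords M x ⊆ Λ)
      index-small =
        small-injection ω flat (λ x⊆Λ → x⊆Λ , _ , _) (λ {i} {j} _ _ → flat-injective i j)
          (small-× ω (small-tuples Λ-small) (small-× ω language<κ (small-ℕ ω)))
        where
        flat : Index → Σ (Context L) (Tuple M) × Σ (Context L) (Formula L) × Lift ℓ ℕ
        flat (Ω , x , n , φ) = (Ω , x) , (Ω ++ pow n , φ) , ↑ n

        flat-injective : ∀ i j → flat i ≡ flat j → i ≡ j
        flat-injective (Ω , x , n , φ) (Ω′ , x′ , n′ , φ′) eq
          with refl ← cong proj₁ eq
          with refl ← cong (lower ∘ proj₂ ∘ proj₂) eq
          with refl ← cong (proj₁ ∘ proj₂) eq = refl

      opaque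
        trace : ∀ ((Ω , x , n , φ) : Index) →
                Σ[ θ ∈ LFormula M D (pow n) ] (∀ c → 𝒞^ n c → Satᴸ M θ c ⇔ Sat M φ (x ++ᵗ c))
        trace (Ω , x , n , φ) = stablyEmbedded (𝒞^-def n) φ inj₁ (λ c 𝒞c → inj₂ ∘ 𝒞^⊆ n c 𝒞c) x

      base : ∀ i → Tuple M (LFormula.Params (proj₁ (trace i)))
      base i = LFormula.params (proj₁ (trace i))

      -- The parameters of all traces on powers of 𝒞 of formulas over Λ, the domain together with B
      -- and d. A map that fixes them and is elementary on Λ preserves the statement that θ defines
      -- the trace of φ, and so is elementary over all of 𝒞.
      C₀ : Pred (Element M) ℓ
      C₀ a = ∃[ i ] (Coords M (proj₁ (proj₂ i)) ⊆ Λ) × Coords M (base i) a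

      C₀-small : SmallerThan κ C₀
      C₀-small = small-coords base index-small

      C₀⊆D : C₀ ⊆ D
      C₀⊆D (i , _ , c) = LFormula.params⊆A (proj₁ (trace i)) c

      W₀ : Pairs
      W₀ = S ∪ Diagonal (B ∪ C₀)

      W₀-elementary : Elementary W₀
      W₀-elementary = elementary-⊆
        [ inj₂ , (λ { (inj₁ b , eq) → inj₁ (inj₁ b , eq) ; (inj₂ c , eq) → inj₁ (C₀⊆D c , eq) }) ] el

      A′ : Pred (Element M) ℓ
      A′ = Right S ∪ (B ∪ C₀)

      A′-small : SmallerThan κ A′
      A′-small = small-∪ ω S-right (small-∪ ω B-small C₀-small)

      W₀-right : ∀ {Γ} {x y : Tuple M Γ} → Related W₀ x y → Coords M y ⊆ A′
      W₀-right = coordsʳ λ { (inj₁ r) → inj₁ (_ , r) ; (inj₂ (b , refl)) → inj₂ b }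

      -- The image under W₀ of the type of d.
      q : Pred (LFormula M A′ (s ∷ [])) ℓ
      q (φ [ y ∣ _ ]) = ∃[ x ] Related W₀ x y × Sat M φ (x ++ᵗ d ∷ [])

      -- Finitely many members of `q` carry different parameter tuples. They are joined into one
      -- B-definable condition Q on v and an environment, so that the single statement that such a v
      -- exists can be transferred along `W₀`.
      record Conjunction (φs : List (LFormula M A′ (s ∷ []))) : Set (Level.suc ℓ) where
        field
          {Γs}    : List (Context L)
          {e f}   : Env Γs
          related : RelatedEnv W₀ e f
          Q       : Pred (Env ((s ∷ []) ∷ Γs)) ℓ
          Q-def   : DefE B _ Q
          Q-d     : Q ((d ∷ []) ∷ e)
          Q⇒φs    : ∀ v → Q (v ∷ f) → All (λ φ → Satᴸ M φ v) φs

      conjunction : ∀ φs → All q φs → Conjunction φs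
      conjunction []                []                     = record
        { related = [] ; Q = λ _ → ⊤ ; Q-def = ⊤ᴰ (λ _ → _) ; Q-d = _ ; Q⇒φs = λ _ _ → [] }
      conjunction ((φ [ y ∣ _ ]) ∷ φs) ((x , r , φx) ∷ qs) = record
        { related = r ∷ ih.related
        ; Q       = λ e → Sat M φ (All.lookup e v₁ ++ᵗ All.lookup e v₀) ×
                          ih.Q (All.head e ∷ All.tail (All.tail e))
        ; Q-def   = fromDefinable-++ (Sat-def φ) v₁ v₀ ×ᴰ weakenᴰ ih.Q-def
        ; Q-d     = φx , ih.Q-d
        ; Q⇒φs    = λ v (φv , Qv) → φv ∷ ih.Q⇒φs v Qv
        }
        where module ih = Conjunction (conjunction φs qs)

      q-satisfiable : FinitelySatisfiable M q
      q-satisfiable φs qs =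
        let v , Qv = transfer W₀-elementary (λ (b , eq) → inj₂ (inj₁ b , eq))
                       (∃ᴰ (s ∷ []) Q-def) related (d ∷ [] , Q-d)
        in v , Q⇒φs v Qv
        where open Conjunction (conjunction φs qs)

      W : Dom s → Pairs
      W e = W₀ ∪ (((s , d) , (s , e)) ≡_)

      module _ {e : Dom s} (e⊨q : ∀ {φ} → q φ → Satᴸ M φ (e ∷ [])) where

        W-elementary : Elementary (W e)
        W-elementary r φ φx
          with split {x₁ = x₁} {y₁} r₁ r₂ ρ refl refl ← related-split r
          with ρ₂ , refl , refl ← related-const r₂
          = Equivalence.to (Sat-rename M (ρ ⨾ refineʳ ρ₂) φ (y₁ ++ᵗ e ∷ []) (pull-refineʳ ρ ρ₂ y₁ (e ∷ [])))
              (e⊨q {rename (ρ ⨾ refineʳ ρ₂) φ [ y₁ ∣ W₀-right r₁ ]}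
                (x₁ , r₁ , Equivalence.from
                  (Sat-rename M (ρ ⨾ refineʳ ρ₂) φ (x₁ ++ᵗ d ∷ []) (pull-refineʳ ρ ρ₂ x₁ (d ∷ []))) φx))

        -- `W e` without the pairs on C₀. The left side must stay inside Λ, because only formulas
        -- over Λ have the parameters of their traces in C₀.
        W′ : Pairs
        W′ = (S ∪ Diagonal B) ∪ (((s , d) , (s , e)) ≡_)

        W′-left : ∀ {Γ} {x y : Tuple M Γ} → Related W′ x y → Coords M x ⊆ Λ
        W′-left = coordsˡ λ { (inj₁ (inj₁ r))        → inj₁ (inj₁ (_ , r))
                            ; (inj₁ (inj₂ (b , _)))  → inj₁ (inj₂ b)
                            ; (inj₂ refl)            → inj₂ refl }

        W′⊆W : W′ ⊆ W e
        W′⊆W (inj₁ (inj₁ r))        = inj₁ (inj₁ r)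
        W′⊆W (inj₁ (inj₂ (b , eq))) = inj₁ (inj₂ (inj₁ b , eq))
        W′⊆W (inj₂ eq)              = inj₂ eq

        sort : (Diagonal D ∪ S) ∪ (((s , d) , (s , e)) ≡_) ⊆ W′ ∪ Diagonal (CoordsOf M 𝒞)
        sort (inj₁ (inj₁ (inj₁ b , eq))) = inj₁ (inj₁ (inj₂ (b , eq)))
        sort (inj₁ (inj₁ (inj₂ c , eq))) = inj₂ (c , eq)
        sort (inj₁ (inj₂ r))             = inj₁ (inj₁ (inj₁ r))
        sort (inj₂ eq)                   = inj₁ (inj₂ eq)

        -- The trace of φ on 𝒞^ n is definable over C₀, which W e fixes.
        W′-𝒞 : ∀ {Γ n c} {x y : Tuple M Γ} → Related W′ x y → 𝒞^ n c →
               (φ : Formula L (Γ ++ pow n)) → Sat M φ (x ++ᵗ c) → Sat M φ (y ++ᵗ c)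
        W′-𝒞 {Γ} {n} {c} {x} {y} r 𝒞c φ φx =
          transfer W-elementary (λ (b , eq) → inj₁ (inj₂ (inj₁ b , eq))) implication
            (related-⊆ W′⊆W r ∷
             related-⊆ (λ (b , eq) → inj₁ (inj₂ (inj₂ b , eq)))
               (related-diagonal (base i) (λ b → i , W′-left r , b)) ∷ [])
            (λ c 𝒞c → Equivalence.to (proj₂ (trace i) c 𝒞c))
            c 𝒞c (Equivalence.from (proj₂ (trace i) c 𝒞c) φx)
          where
          i : Index
          i = Γ , x , n , φ

          θ : Formula L (LFormula.Params (proj₁ (trace i)) ++ pow n)
          θ = LFormula.body (proj₁ (trace i))

          implication : DefE B (Γ ∷ LFormula.Params (proj₁ (trace i)) ∷ [])
            (λ e → ∀ c → 𝒞^ n c → Sat M θ (All.lookup e v₁ ++ᵗ c) → Sat M φ (All.lookup e v₀ ++ᵗ c))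
          implication = ∀ᴰ (pow n)
            (fromDefinable (𝒞^-def n) v₀ ⇒ᴰ
             fromDefinable-++ (Sat-def θ) v₂ v₀ ⇒ᴰ
             fromDefinable-++ (Sat-def φ) v₁ v₀)

        -- A finite related tuple is sorted into a `W′`-part and coordinates from 𝒞. The latter are
        -- completed to a point of `𝒞^ n`, and then `W′-𝒞` applies.
        extended : Elementary ((Diagonal D ∪ S) ∪ (((s , d) , (s , e)) ≡_))
        extended r φ φx
          with split {x₁ = x₁} {y₁} {x₂} r₁ r₂ ρ refl refl ← related-split {R = W′} (related-⊆ sort r)
          with c⊆ , refl ← diagonal-≡ r₂
          with n , c , 𝒞c , ρ₂ , refl ← from-𝒞^ x₂ c⊆
          = Equivalence.to (Sat-rename M (ρ ⨾ refineʳ ρ₂) φ (y₁ ++ᵗ c) (pull-refineʳ ρ ρ₂ y₁ c))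
              (W′-𝒞 r₁ 𝒞c (rename (ρ ⨾ refineʳ ρ₂) φ)
                (Equivalence.from
                  (Sat-rename M (ρ ⨾ refineʳ ρ₂) φ (x₁ ++ᵗ c) (pull-refineʳ ρ ρ₂ x₁ c)) φx))

    forth : ∃[ e ] Elementary ((Diagonal D ∪ S) ∪ (((s , d) , (s , e)) ≡_))
    forth = from-realisation (saturated A′ A′-small q q-satisfiable)
      where
      from-realisation : ∃ (Realisations M q) →
        ∃[ e ] Elementary ((Diagonal D ∪ S) ∪ (((s , d) , (s , e)) ≡_))
      from-realisation ((e ∷ []) , e⊨q) = e , extended (λ {φ} → e⊨q {φ})

-- The back-and-forth of length κ: equal types over D are conjugate.

module Homogeneity (em : ∀ {a} → ExcludedMiddle a) {ℓ} {L : Language ℓ} (M : Structure L)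
  (κ : Cardinal ℓ) (saturatedIn : SaturatedIn M κ)
  (ranked : ∀ {Γ} (φ : LFormula M (λ _ → ⊤) Γ) → Σ[ α ∈ Ordinal ℓ ] ¬ MorleyRank≥ M α φ)
  {B : Pred (Element M) ℓ} (B-small : SmallerThan κ B)
  {Θ : Context L} {𝒞 : Pred (Tuple M Θ) ℓ} (𝒞-def : Definable M B 𝒞) where
  open Definability em M
  open SaturatedIn saturatedIn
  open Structure M
  open Cardinal κ using (Carrier; _<_; wellFounded)
  open WellOrder em (Cardinal.isStrictTotalOrder κ) wellFounded
  open Smallness em κ
  open SmallTuples em M κ saturatedIn
  open Elementarity em M
  open Extension em M κ saturatedIn ranked B-small 𝒞-def

  private
    infix 4 _↦_
    _↦_ : Element M → Element M → Pairs
    a ↦ b = (a , b) ≡_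

    ElementaryOverD : Pairs → Set ℓ
    ElementaryOverD S = Elementary (Diagonal D ∪ S)

    elD-⊆ : ∀ {S S′} → S′ ⊆ S → ElementaryOverD S → ElementaryOverD S′
    elD-⊆ S′⊆S = elementary-⊆ [ inj₁ , inj₂ ∘ S′⊆S ]

    SmallSides : Pairs → Set ℓ
    SmallSides S = SmallerThan κ (Left S) × SmallerThan κ (Right S)

    smallSides-∪ : ∀ {S S′} → SmallSides S → SmallSides S′ → SmallSides (S ∪ S′)
    smallSides-∪ (l , r) (l′ , r′) =
      small-⊆ ω (λ { (b , inj₁ s) → inj₁ (b , s) ; (b , inj₂ s) → inj₂ (b , s) }) (small-∪ ω l l′) ,
      small-⊆ ω (λ { (b , inj₁ s) → inj₁ (b , s) ; (b , inj₂ s) → inj₂ (b , s) }) (small-∪ ω r r′)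

    smallSides-↦ : ∀ a b → SmallSides (a ↦ b)
    smallSides-↦ a b =
      small-⊆ ω (λ (_ , eq) → cong proj₁ eq) (small-singleton ω a) ,
      small-⊆ ω (λ (_ , eq) → cong proj₂ eq) (small-singleton ω b)

    extend : ∀ {S} → SmallSides S → ElementaryOverD S → ∀ {s} (d : Dom s) →
             ∃[ e ] ElementaryOverD (S ∪ ((s , d) ↦ (s , e)))
    extend (l , r) el d =
      let e , el′ = forth l r el d
      in e , elementary-⊆ [ inj₁ ∘ inj₁ , [ inj₁ ∘ inj₂ , inj₂ ] ] el′

    -- The forth step for the inverse relation, since the diagonal on D is its own inverse.
    extend⁻¹ : ∀ {S} → SmallSides S → ElementaryOverD S → ∀ {s} (e : Dom s) →
               ∃[ d ] ElementaryOverD (S ∪ ((s , d) ↦ (s , e)))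
    extend⁻¹ {S} (l , r) el e =
      let d , el′ = extend {S ∘ swap} (r , l)
                      (elementary-⊆ [ (λ (b , eq) → inj₁ (subst D eq b , sym eq)) , inj₂ ]
                                    (elementary-flip el)) e
      in d , elementary-⊆ [ (λ (b , eq) → inj₁ (subst D eq b , sym eq)) ,
                            [ inj₂ ∘ inj₁ , (λ eq → inj₂ (inj₂ (cong swap eq))) ] ]
                          (elementary-flip el′)

    enc : Element M → Carrier
    enc = Injection.to size≤κ

    Coded : Pred (Element M) ℓ → Pred Carrier ℓ
    Coded Q k = ∃[ x ] enc x ≡ k × Q x

    -- A choice that depends only on the extension of Q, as needed to unfold
    -- the recursion below.
    opaque
      choose : Element M → Pred (Element M) ℓ → Element M
      choose x₀ Q with em {P = ∃ (Coded Q)}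
      ... | yes ∃k = proj₁ (proj₁ (proj₂ (least ∃k)))
      ... | no _   = x₀

      choose-sat : ∀ x₀ (Q : Pred (Element M) ℓ) {x} → Q x → Q (choose x₀ Q)
      choose-sat x₀ Q {x} Qx with em {P = ∃ (Coded Q)}
      ... | yes ∃k  = proj₂ (proj₂ (proj₁ (proj₂ (least ∃k))))
      ... | no none = ⊥-elim (none (enc x , x , refl , Qx))

      choose-cong : ∀ x₀ (Q Q′ : Pred (Element M) ℓ) → Q ⊆ Q′ → Q′ ⊆ Q → choose x₀ Q ≡ choose x₀ Q′
      choose-cong x₀ Q Q′ Q⊆ ⊆Q with em {P = ∃ (Coded Q)} | em {P = ∃ (Coded Q′)}
      ... | yes ∃k | yes ∃k′ =
        let k  , (x  , enc≡k  , _) , _ = least ∃k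
            k′ , (x′ , enc≡k′ , _) , _ = least ∃k′
        in Injection.injective size≤κ
             (trans enc≡k
             (trans (least-cong (λ (y , eq , Qy) → y , eq , Q⊆ Qy) (λ (y , eq , Qy) → y , eq , ⊆Q Qy)
                                (proj₂ (least ∃k)) (proj₂ (least ∃k′)))
                    (sym enc≡k′)))
      ... | yes (k , x , eq , Qx) | no none               = ⊥-elim (none (k , x , eq , Q⊆ Qx))
      ... | no none               | yes (k , x , eq , Qx) = ⊥-elim (none (k , x , eq , ⊆Q Qx))
      ... | no _                  | no _                  = refl

    Forward Backward : Pairs → Element M → Pred (Element M) ℓ
    Forward  S x y = proj₁ y ≡ proj₁ x × ElementaryOverD (S ∪ (x ↦ y))
    Backward S x z = proj₁ z ≡ proj₁ x × ElementaryOverD (S ∪ (z ↦ x))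

    image preimage : Pairs → Element M → Element M
    image    S x = choose x (Forward S x)
    -- The preimage is sought over the map that already contains x ↦ `image S x`, so that both pairs
    -- can be added in the same stage.
    preimage S x = choose x (Backward (S ∪ (x ↦ image S x)) x)

    image-cong : ∀ {S S′} x → S ⊆ S′ → S′ ⊆ S → image S x ≡ image S′ x
    image-cong {S} {S′} x S⊆ ⊆S = choose-cong x (Forward S x) (Forward S′ x)
      (λ (eq , el) → eq , elD-⊆ [ inj₁ ∘ ⊆S , inj₂ ] el)
      (λ (eq , el) → eq , elD-⊆ [ inj₁ ∘ S⊆ , inj₂ ] el)

    preimage-cong : ∀ {S S′} x → S ⊆ S′ → S′ ⊆ S → preimage S x ≡ preimage S′ x
    preimage-cong {S} {S′} x S⊆ ⊆S = choose-cong x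
      (Backward (S ∪ (x ↦ image S x)) x) (Backward (S′ ∪ (x ↦ image S′ x)) x)
      (λ (eq , el) → eq , elD-⊆ [ [ inj₁ ∘ inj₁ ∘ ⊆S , inj₁ ∘ inj₂ ∘ trans (cong (x ,_) im≡) ] , inj₂ ] el)
      (λ (eq , el) → eq , elD-⊆ [ [ inj₁ ∘ inj₁ ∘ S⊆ , inj₁ ∘ inj₂ ∘ trans (cong (x ,_) (sym im≡)) ] , inj₂ ] el)
      where
      im≡ : image S x ≡ image S′ x
      im≡ = image-cong x S⊆ ⊆S

    at-sort : ∀ {s} (y : Element M) → proj₁ y ≡ s → Σ[ e ∈ Dom s ] y ≡ (s , e)
    at-sort (_ , e) refl = e , refl

    -- Stage k treats the element coded by k, in both directions. Since `enc` is just an injection,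
    -- a stage whose index codes nothing adds nothing.
    step : Carrier → Pairs → List (Element M × Element M)
    step k S with em {P = ∃[ x ] enc x ≡ k}
    ... | yes (x , _) = (x , image S x) ∷ (preimage S x , x) ∷ []
    ... | no _        = []

    step-cong : ∀ k {S S′} → S ⊆ S′ → S′ ⊆ S → step k S ≡ step k S′
    step-cong k S⊆ ⊆S with em {P = ∃[ x ] enc x ≡ k}
    ... | yes (x , _) = cong₂ (λ y z → (x , y) ∷ (z , x) ∷ [])
                              (image-cong x S⊆ ⊆S) (preimage-cong x S⊆ ⊆S)
    ... | no _        = refl

    module _ {S} (small : SmallSides S) (el : ElementaryOverD S) where

      image-sat : ∀ x → Forward S x (image S x)
      image-sat (s , d) = let e , el′ = extend small el d in choose-sat (s , d) (Forward S (s , d)) {s , e} (refl , el′)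

      preimage-sat : ∀ x → Backward (S ∪ (x ↦ image S x)) x (preimage S x)
      preimage-sat (s , e) =
        let d , el′ = extend⁻¹ (smallSides-∪ small (smallSides-↦ _ _)) (proj₂ (image-sat (s , e))) e
        in choose-sat (s , e) (Backward (S ∪ ((s , e) ↦ image S (s , e))) (s , e)) {s , d} (refl , el′)

      step-elementary : ∀ k → ElementaryOverD (S ∪ (_∈ˡ step k S))
      step-elementary k with em {P = ∃[ x ] enc x ≡ k}
      ... | yes (x , _) = elD-⊆
        [ inj₁ ∘ inj₁ , (λ { (here refl) → inj₁ (inj₂ refl) ; (there (here refl)) → inj₂ refl }) ]
        (proj₂ (preimage-sat x))
      ... | no _ = elD-⊆ [ id , (λ ()) ] el

      step-total : ∀ {s} (d : Dom s) → ∃[ e ] ((s , d) , (s , e)) ∈ˡ step (enc (s , d)) S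
      step-total {s} d with em {P = ∃[ x ] enc x ≡ enc (s , d)}
      ... | no none = ⊥-elim (none (_ , refl))
      ... | yes (x , eq) with refl ← Injection.injective size≤κ eq
        = let e , y≡ = at-sort (image S (s , d)) (proj₁ (image-sat (s , d)))
          in e , here (cong ((s , d) ,_) (sym y≡))

      step-onto : ∀ {s} (e : Dom s) → ∃[ d ] ((s , d) , (s , e)) ∈ˡ step (enc (s , e)) S
      step-onto {s} e with em {P = ∃[ x ] enc x ≡ enc (s , e)}
      ... | no none = ⊥-elim (none (_ , refl))
      ... | yes (x , eq) with refl ← Injection.injective size≤κ eq
        = let d , z≡ = at-sort (preimage S (s , e)) (proj₁ (preimage-sat (s , e)))
          in d , there (here (cong (_, (s , e)) (sym z≡)))

  module _ {Γ : Context L} {a b : Tuple M Γ}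
    (sameType : ∀ (φ : LFormula M D Γ) → Satᴸ M φ a → Satᴸ M φ b) where
    private
      a↦b : Pairs
      a↦b (p , q) = ∃[ s ] Σ[ i ∈ s ∋ Γ ] p ≡ (s , All.lookup a i) × q ≡ (s , All.lookup b i)

      a↦b-small : SmallSides a↦b
      a↦b-small =
        small-⊆ ω (λ { (_ , s , i , refl , _) → i , refl }) (small-Coords a) ,
        small-⊆ ω (λ { (_ , s , i , _ , refl) → i , refl }) (small-Coords b)

      a↦b-related : ∀ {Δ} {x y : Tuple M Δ} → Related a↦b x y →
                    Σ[ ρ ∈ Ren Δ Γ ] pull ρ a ≡ x × pull ρ b ≡ y
      a↦b-related []                            = [] , refl , refl
      a↦b-related ((s , i , refl , refl) ∷ rs) =
        let ρ , x≡ , y≡ = a↦b-related rs in i ∷ ρ , cong (_ ∷_) x≡ , cong (_ ∷_) y≡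

      a↦b-elementary : ElementaryOverD a↦b
      a↦b-elementary r φ φx
        with split {x₁ = x₁} r₁ r₂ ρ refl refl ← related-split r
        with x₁⊆D , refl ← diagonal-≡ r₁
        with ρ₂ , refl , refl ← a↦b-related r₂
        = Equivalence.to (Sat-rename M (ρ ⨾ refineʳ ρ₂) φ (x₁ ++ᵗ b) (pull-refineʳ ρ ρ₂ x₁ b))
            (sameType (rename (ρ ⨾ refineʳ ρ₂) φ [ x₁ ∣ x₁⊆D ])
              (Equivalence.from
                (Sat-rename M (ρ ⨾ refineʳ ρ₂) φ (x₁ ++ᵗ a) (pull-refineʳ ρ ρ₂ x₁ a)) φx))

      Earlier : ∀ k → (∀ {j} → j < k → List (Element M × Element M)) → Pairs
      Earlier k f = a↦b ∪ λ p → ∃[ j ] Σ[ j<k ∈ j < k ] p ∈ˡ f j<k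

      module F = WF.FixPoint wellFounded (λ _ → List (Element M × Element M))
        (λ k f → step k (Earlier k f))
        (λ k eq → step-cong k
          [ inj₁ , (λ (j , j<k , p∈) → inj₂ (j , j<k , subst (_ ∈ˡ_) (eq j<k) p∈)) ]
          [ inj₁ , (λ (j , j<k , p∈) → inj₂ (j , j<k , subst (_ ∈ˡ_) (sym (eq j<k)) p∈)) ])

      stage : Carrier → List (Element M × Element M)
      stage = WF.All.wfRec wellFounded _ (λ _ → List (Element M × Element M))
                (λ k f → step k (Earlier k f))

      Stages : Pred Carrier ℓ → Pairs
      Stages J = a↦b ∪ λ p → ∃[ j ] J j × p ∈ˡ stage j

      stage-unfold : ∀ k → stage k ≡ step k (Stages (_< k))
      stage-unfold k = F.unfold-wfRec

      -- A finite subset of a union of stages lies in a single one.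
      stages-compact : ∀ {J Δ} {x y : Tuple M Δ} → Related (Diagonal D ∪ Stages J) x y →
        Related (Diagonal D ∪ a↦b) x y ⊎
        ∃[ j ] J j × Related (Diagonal D ∪ Stages (_≤ j)) x y
      stages-compact []       = inj₁ []
      stages-compact {J} (r ∷ rs) with early r | stages-compact rs
        where
        early : ∀ {p} → (Diagonal D ∪ Stages J) p →
                (Diagonal D ∪ a↦b) p ⊎ (∃[ j ] J j × p ∈ˡ stage j)
        early (inj₁ r)        = inj₁ (inj₁ r)
        early (inj₂ (inj₁ r)) = inj₁ (inj₂ r)
        early (inj₂ (inj₂ r)) = inj₂ r
      ... | inj₁ r             | inj₁ rs            = inj₁ (r ∷ rs)
      ... | inj₁ r             | inj₂ (j , Jj , rs) = inj₂ (j , Jj , [ inj₁ , inj₂ ∘ inj₁ ] r ∷ rs)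
      ... | inj₂ (i , Ji , p∈) | inj₁ rs            =
        inj₂ (i , Ji , inj₂ (inj₂ (i , ≤-refl , p∈)) ∷ related-⊆ [ inj₁ , inj₂ ∘ inj₁ ] rs)
      ... | inj₂ (i , Ji , p∈) | inj₂ (j , Jj , rs) =
        inj₂ (max i j , max-closed J Ji Jj ,
              inj₂ (inj₂ (i , ≤maxˡ i j , p∈)) ∷
              related-⊆ [ inj₁ , [ inj₂ ∘ inj₁ ,
                (λ (k , k≤j , p∈) → inj₂ (inj₂ (k , ≤-trans k≤j (≤maxʳ i j) , p∈))) ] ] rs)

      stages-elementary : ∀ {J} → (∀ {j} → J j → ElementaryOverD (Stages (_≤ j))) →
                          ElementaryOverD (Stages J)
      stages-elementary IH r with stages-compact r
      ... | inj₁ r            = a↦b-elementary r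
      ... | inj₂ (j , Jj , r) = IH Jj r

      -- Each stage is a finite list and the stages before k are indexed by a proper segment of κ,
      -- so their union is a small family of countable sets. This keeps `forth` applicable at every
      -- stage, limit stages included.
      stages-small : ∀ k → SmallSides (Stages (_< k))
      stages-small k = smallSides-∪ a↦b-small
        ( small-⊆ ω (λ (b , j , j<k , p∈) → let n , h = ∈⇒nth p∈ in j , j<k , n , b , h)
            (small-⋃ ω (λ j n a → ∃[ b ] nth (stage j) n (a , b))
              (λ (_ , h) (_ , h′) → cong proj₁ (just-injective (trans (sym h) h′))) segment)
        , small-⊆ ω (λ (a , j , j<k , p∈) → let n , h = ∈⇒nth p∈ in j , j<k , n , a , h)
            (small-⋃ ω (λ j n b → ∃[ a ] nth (stage j) n (a , b))
              (λ (_ , h) (_ , h′) → cong proj₂ (just-injective (trans (sym h) h′))) segment))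
        where
        segment : SmallerThan κ (_< k)
        segment = k , id , id , λ _ _ → id

      stage-elementary : ∀ k → ElementaryOverD (Stages (_≤ k))
      stage-elementary = WF.All.wfRec wellFounded _ (λ k → ElementaryOverD (Stages (_≤ k))) λ k IH →
        elD-⊆ (λ { (inj₁ r) → inj₁ (inj₁ r) ; (inj₂ (j , j≤k , p∈)) → late k j≤k p∈ })
          (step-elementary (stages-small k) (stages-elementary (λ j<k → IH j<k)) k)
        where
        late : ∀ k {j p} → j ≤ k → p ∈ˡ stage j →
               (Stages (_< k) ∪ (_∈ˡ step k (Stages (_< k)))) p
        late k {j} j≤k p∈ with em {P = j ≡ k}
        ... | yes refl = inj₂ (subst (_ ∈ˡ_) (stage-unfold k) p∈)
        ... | no j≢k   = inj₁ (inj₂ (j , ≤∧≢⇒< j≤k j≢k , p∈))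

      before-elementary : ∀ k → ElementaryOverD (Stages (_< k))
      before-elementary k = stages-elementary (λ {j} _ → stage-elementary j)

      limit : Pairs
      limit = Diagonal D ∪ Stages (λ _ → ⊤)

      in-stage : ∀ k {p} → p ∈ˡ step k (Stages (_< k)) → Stages (λ _ → ⊤) p
      in-stage k {p} p∈ = inj₂ (k , _ , subst (p ∈ˡ_) (sym (stage-unfold k)) p∈)

      -- Every element receives an image and a preimage at the stage indexed by its own code, so the
      -- union of all stages is total and onto. It is elementary because a formula involves only
      -- finitely many pairs.
      automorphism : Σ[ σ ∈ Automorphism M ]
                     ∀ {s d e} → limit ((s , d) , (s , e)) → Automorphism.to σ d ≡ e
      automorphism = elementary⇒automorphism (stages-elementary (λ {j} _ → stage-elementary j))
        (λ {s} d → let k      = enc (s , d)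
                       e , p∈ = step-total (stages-small k) (before-elementary k) d
                   in e , inj₂ (in-stage k p∈))
        (λ {s} e → let k      = enc (s , e)
                       d , p∈ = step-onto (stages-small k) (before-elementary k) e
                   in d , inj₂ (in-stage k p∈))

      map-by : ∀ {Δ} (σ : Automorphism M) (x y : Tuple M Δ) →
               (∀ {s} (i : s ∋ Δ) → Automorphism.to σ (All.lookup x i) ≡ All.lookup y i) →
               _$ᵗ_ M σ x ≡ y
      map-by σ []      []      h = refl
      map-by σ (d ∷ x) (e ∷ y) h = cong₂ _∷_ (h (here refl)) (map-by σ x y (h ∘ there))

    opaque
      homogeneous : Σ[ σ ∈ Automorphism M ] Fixes M D σ × _$ᵗ_ M σ a ≡ b
      homogeneous =
        let σ , σ-limit = automorphism
        in σ , (λ x → σ-limit (inj₁ (x , refl))) ,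
           map-by σ a b (λ i → σ-limit (inj₂ (inj₁ (_ , i , refl , refl))))

-- Internality: partial functions with parameters in 𝒞, and isolation of p.

module Invariance {ℓ} {L : Language ℓ} (M : Structure L) (em : ∀ {a} → ExcludedMiddle a) where
  open Definability em M

  infixr 8 _$ᵉ_
  _$ᵉ_ : ∀ {Γs} → Automorphism M → Env Γs → Env Γs
  σ $ᵉ e = All.map (_$ᵗ_ M σ) e

  $ᵗ-catᵗ : ∀ {Γs} σ (e : Env Γs) → _$ᵗ_ M σ (catᵗ e) ≡ catᵗ (σ $ᵉ e)
  $ᵗ-catᵗ σ []      = refl
  $ᵗ-catᵗ σ (x ∷ e) = trans ($ᵗ-++ᵗ M σ x (catᵗ e)) (cong (_$ᵗ_ M σ x ++ᵗ_) ($ᵗ-catᵗ σ e))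

  invariant : ∀ {A Γs X} → DefE A Γs X → ∀ σ → Fixes M A σ → ∀ e → X e → X (σ $ᵉ e)
  invariant (φ [ a ∣ a⊆A ] , φ⇔X) σ fix e Xe =
    Equivalence.to (φ⇔X (σ $ᵉ e))
      (subst (Sat M φ)
        (trans ($ᵗ-++ᵗ M σ a (catᵗ e))
               (cong₂ _++ᵗ_ (fixes-tuple M σ fix a a⊆A) ($ᵗ-catᵗ σ e)))
        (Equivalence.to (Sat-$ᵗ M σ φ _) (Equivalence.from (φ⇔X e) Xe)))

module Internality (em : ∀ {a} → ExcludedMiddle a) {ℓ} {L : Language ℓ} (M : Structure L)
  (κ : Cardinal ℓ) (saturatedIn : SaturatedIn M κ)
  (ranked : ∀ {Γ} (φ : LFormula M (λ _ → ⊤) Γ) → Σ[ α ∈ Ordinal ℓ ] ¬ MorleyRank≥ M α φ)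
  {B : Pred (Element M) ℓ} (B-small : SmallerThan κ B)
  {Θ : Context L} {𝒞 : Pred (Tuple M Θ) ℓ} (𝒞-def : Definable M B 𝒞)
  {Γ : Context L} (p : CompleteType M B Γ)
  (internal : FundamentalInternal M p 𝒞) (orthogonal : WeaklyOrthogonal M p 𝒞) where
  open Classical em
  open Definability em M
  open Rank em M ranked using (Isolating; isolating-dense; _⟨_⟩)
  open SaturatedIn saturatedIn
  open Elementarity em M
  open Powers em 𝒞-def
  open Extension em M κ saturatedIn ranked B-small 𝒞-def using (D)
  open Homogeneity em M κ saturatedIn ranked B-small 𝒞-def
  open Invariance M em
  open CompleteType p

  P : Pred (Tuple M Γ) ℓ
  P = Realisations M formulas

  -- The type q over D given by weak orthogonality decides φ, and finitely many formulas of p imply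
  -- whatever q contains.
  sameType : ∀ {a b} → P a → P b → ∀ (φ : LFormula M D Γ) → Satᴸ M φ a → Satᴸ M φ b
  sameType {a} {b} a⊨p b⊨p φ φa with CompleteType.complete (proj₁ orthogonal) φ
  ... | inj₁ φ∈q = let φs , φs⊆p , φs⊢φ = proj₂ orthogonal φ∈q
                   in φs⊢φ b (All.map b⊨p φs⊆p)
  ... | inj₂ ¬φ∈q = let φs , φs⊆p , φs⊢¬φ = proj₂ orthogonal ¬φ∈q
                    in ⊥-elim (lower (φs⊢¬φ a (All.map a⊨p φs⊆p) φa))

  opaque
    carry : ∀ {a b} → P a → P b → Σ[ σ ∈ Automorphism M ] Fixes M D σ × _$ᵗ_ M σ a ≡ b
    carry a⊨p b⊨p = homogeneous (sameType a⊨p b⊨p)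

  fixes-B : ∀ {σ} → Fixes M D σ → Fixes M B σ
  fixes-B fix b = fix (inj₁ b)

  $-P : ∀ σ → Fixes M D σ → ∀ {a} → P a → P (_$ᵗ_ M σ a)
  $-P σ fix {a} a⊨p {φ} = $ᵗ-realises M formulas σ (fixes-B {σ} fix) a⊨p {φ}

  fixes-𝒞^ : ∀ σ → Fixes M D σ → ∀ n c → 𝒞^ n c → _$ᵗ_ M σ c ≡ c
  fixes-𝒞^ σ fix n c 𝒞c = fixes-tuple M σ fix c (λ x → inj₂ (𝒞^⊆ n c 𝒞c x))

  -- B-definable partial functions (c , x) ↦ z, c ∈ 𝒞^ n.
  PartialFun : Set ℓ
  PartialFun = Σ[ n ∈ ℕ ] LFormula M B (concat (pow n ∷ Γ ∷ Γ ∷ []))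

  -- Any formula counts as a partial function: it has a value only where it has exactly one
  -- solution.
  record Value (F : PartialFun) (c : Tuple M (pow (proj₁ F))) (x z : Tuple M Γ) : Set ℓ where
    constructor value
    field
      holds  : Satᴸ M (proj₂ F) (catᵗ (c ∷ x ∷ z ∷ []))
      unique : ∀ z′ → Satᴸ M (proj₂ F) (catᵗ (c ∷ x ∷ z′ ∷ [])) → z′ ≡ z

  value-unique : ∀ {F c x z z′} → Value F c x z → Value F c x z′ → z ≡ z′
  value-unique val val′ = Value.unique val′ _ (Value.holds val)

  valueᴰ : ∀ F {Γs} (v : pow (proj₁ F) ∋ Γs) (w u : Γ ∋ Γs) →
           DefE B Γs (λ e → Value F (All.lookup e v) (All.lookup e w) (All.lookup e u))
  valueᴰ (n , F) v w u = respᴰ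
    (λ e → value⇔ (All.lookup e v) (All.lookup e w) (All.lookup e u))
    (at graph (v ∷ w ∷ u ∷ []) ×ᴰ
     ∀ᴰ Γ (at graph (there v ∷ there w ∷ v₀ ∷ []) ⇒ᴰ tuple≡ᴰ v₀ (there u)))
    where
    graph : DefE B (pow n ∷ Γ ∷ Γ ∷ []) (λ e → Satᴸ M F (catᵗ e))
    graph = F , λ _ → mk⇔ id id

    value⇔ : ∀ c x z → (Satᴸ M F (catᵗ (c ∷ x ∷ z ∷ [])) ×
                        (∀ z′ → Satᴸ M F (catᵗ (c ∷ x ∷ z′ ∷ [])) → z′ ≡ z)) ⇔ Value (n , F) c x z
    value⇔ c x z = mk⇔ (λ (s , unique) → value s unique) (λ val → Value.holds val , Value.unique val)

  value-$ : ∀ σ → Fixes M D σ → ∀ F {c x z} → 𝒞^ (proj₁ F) c → Value F c x z →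
            Value F c (_$ᵗ_ M σ x) (_$ᵗ_ M σ z)
  value-$ σ fix F {c} {x} {z} 𝒞c val =
    subst (λ c′ → Value F c′ (_$ᵗ_ M σ x) (_$ᵗ_ M σ z)) (fixes-𝒞^ σ fix (proj₁ F) c 𝒞c)
      (invariant (valueᴰ F {pow (proj₁ F) ∷ Γ ∷ Γ ∷ []} v₀ v₁ v₂) σ (fixes-B {σ} fix)
                 (c ∷ x ∷ z ∷ []) val)

  Links : PartialFun → Tuple M Γ → Tuple M Γ → Set ℓ
  Links F x z = ∃[ c ] 𝒞^ (proj₁ F) c × Value F c x z

  linksᴰ : ∀ F {Γs} (w u : Γ ∋ Γs) →
           DefE B Γs (λ e → Links F (All.lookup e w) (All.lookup e u))
  linksᴰ F w u = ∃ᴰ (pow (proj₁ F)) (fromDefinable (𝒞^-def (proj₁ F)) v₀ ×ᴰ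
                                     valueᴰ F v₀ (there w) (there u))

  module _ (a : Tuple M Γ) where
    private
      A : Pred (Element M) ℓ
      A = B ∪ (Coords M a ∪ CoordsOf M 𝒞)

    singleton-def : ∀ {Δ} (y : Tuple M Δ) → Coords M y ⊆ dcl M A → Definable M A (_≡ y)
    singleton-def []      _     = toDefinable (⊤ᴰ λ { ([] ∷ []) → refl })
    singleton-def (_∷_ {x = s} d y) y⊆dcl =
      let φ , φd , φ-unique = y⊆dcl (here refl , refl)
      in toDefinable (respᴰ
           (λ { ((d′ ∷ y′) ∷ []) → mk⇔
             (λ (φd′ , y′≡) → cong₂ _∷_ (φ-unique d′ φd′) (trans (sym (tail≡ d′ y′)) y′≡))
             (λ { refl → φd , tail≡ d y }) })
           (fromDefinable-pull {X = Satᴸ M φ} (Satᴸ-def φ) (here refl ∷ []) v₀ ×ᴰ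
            fromDefinable-pull (singleton-def y (λ (i , e) → y⊆dcl (there i , e))) (wk idʳ) v₀))
      where
      tail≡ : ∀ {s Δ} (d : Structure.Dom M s) (y : Tuple M Δ) → pull (wk idʳ) (d ∷ y) ≡ y
      tail≡ d y = trans (pull-wk idʳ y) (pull-id y)

    from-coords : ∀ {Δ} (x : Tuple M Δ) → Coords M x ⊆ Coords M a → Σ[ ρ ∈ Ren Δ Γ ] pull ρ a ≡ x
    from-coords []      _   = [] , refl
    from-coords (d ∷ x) x⊆a =
      let ρ , eq  = from-coords x (λ (i , e) → x⊆a (there i , e))
          i , eq′ = x⊆a (here refl , refl)
      in i ∷ ρ , cong₂ _∷_ eq′ eq

    -- The parameters of a formula over B, a and 𝒞 are separated into a tuple β from B, the tuple a
    -- and a point c of a power of 𝒞, so that a and c can be replaced by variables while β stays.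
    record Parameters {Δ} (u : Tuple M Δ) : Set ℓ where
      field
        {Ω} : Context L
        β   : Tuple M Ω
        β⊆B : Coords M β ⊆ B
        n   : ℕ
        c   : Tuple M (pow n)
        c∈  : 𝒞^ n c
        ρ   : Ren Δ (Ω ++ (Γ ++ pow n))
        u≡  : pull ρ (β ++ᵗ (a ++ᵗ c)) ≡ u

    merge : ∀ {Ω n Δ Δ₁ Δ₂ Δ₃} (β : Tuple M Ω) (c : Tuple M (pow n)) (ρ : Ren Δ (Ω ++ Δ₁))
            (ρ′ : Ren Δ₁ (Δ₂ ++ Δ₃)) (ρ₁ : Ren Δ₂ Γ) (ρ₂ : Ren Δ₃ (pow n)) →
            Σ[ ρ″ ∈ Ren Δ (Ω ++ (Γ ++ pow n)) ]
              pull ρ″ (β ++ᵗ (a ++ᵗ c)) ≡ pull ρ (β ++ᵗ pull ρ′ (pull ρ₁ a ++ᵗ pull ρ₂ c))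
    merge {Ω} {n} {Δ₁ = Δ₁} {Δ₂} {Δ₃} β c ρ ρ′ ρ₁ ρ₂ = ρ ⨾ outer ,
      trans (pull-⨾ ρ outer (β ++ᵗ (a ++ᵗ c))) (cong (pull ρ)
        (pull-⊕ (inlʳ {Γ = Ω}) ((ρ′ ⨾ inner) ⨾ inrʳ {Γ = Ω}) (β ++ᵗ (a ++ᵗ c))
          (pull-inl β (a ++ᵗ c))
          (trans (pull-⨾inr (ρ′ ⨾ inner) β (a ++ᵗ c))
          (trans (pull-⨾ ρ′ inner (a ++ᵗ c)) (cong (pull ρ′)
            (pull-⊕ (ρ₁ ⨾ inlʳ) (ρ₂ ⨾ inrʳ {Γ = Γ}) (a ++ᵗ c)
              (pull-⨾inl ρ₁ a c) (pull-⨾inr ρ₂ a c)))))))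
      where
      inner : Ren (Δ₂ ++ Δ₃) (Γ ++ pow n)
      inner = (ρ₁ ⨾ inlʳ) ++ᵗ (ρ₂ ⨾ inrʳ {Γ = Γ})

      outer : Ren (Ω ++ Δ₁) (Ω ++ (Γ ++ pow n))
      outer = inlʳ {Γ = Ω} ++ᵗ ((ρ′ ⨾ inner) ⨾ inrʳ {Γ = Ω})

    parameters : ∀ {Δ} (u : Tuple M Δ) → Coords M u ⊆ A → Parameters u
    parameters u u⊆A
      with split {Γ₁ = Ω} {x₁ = β} {x₂ = x₂} r₁ r₂ ρ refl _ ←
             related-split {R = Diagonal B} {R′ = Diagonal (Coords M a) ∪ Diagonal (CoordsOf M 𝒞)}
               (related-⊆ (λ { (inj₁ b , eq) → inj₁ (b , eq)
                             ; (inj₂ (inj₁ x) , eq) → inj₂ (inj₁ (x , eq))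
                             ; (inj₂ (inj₂ c) , eq) → inj₂ (inj₂ (c , eq)) })
                          (related-diagonal u u⊆A))
      with split {x₁ = x} {x₂ = y} r₃ r₄ ρ′ refl _ ← related-split r₂
      with ρ₁ , refl ← from-coords x (proj₁ (diagonal-≡ r₃))
         | n , c , 𝒞c , ρ₂ , refl ← from-𝒞^ y (proj₁ (diagonal-≡ r₄))
      = record
        { β   = β
        ; β⊆B = proj₁ (diagonal-≡ r₁)
        ; n   = n
        ; c   = c
        ; c∈  = 𝒞c
        ; ρ   = proj₁ (merge {n = n} β c ρ ρ′ ρ₁ ρ₂)
        ; u≡  = proj₂ (merge {n = n} β c ρ ρ′ ρ₁ ρ₂)
        }

    opaque
      -- A formula with parameters β, a, c whose only solution is b becomes, with a and c turned
      -- into variables, a partial function over B taking b as its value at (c , a).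
      dcl⇒links : ∀ {b} → Coords M b ⊆ dcl M A → ∃[ F ] Links F a b
      dcl⇒links {b} b⊆dcl with (φ [ u ∣ u⊆A ]) , φ⇔ ← singleton-def b b⊆dcl =
        (n , proj₁ graph) , c , c∈ ,
        value
          (Equivalence.from (proj₂ graph (c ∷ a ∷ b ∷ []))
            (subst (λ w → Sat M φ (w ++ᵗ b)) (sym u≡) (Equivalence.from (φ⇔ b) refl)))
          (λ z s → Equivalence.to (φ⇔ z)
            (subst (λ w → Sat M φ (w ++ᵗ z)) u≡ (Equivalence.to (proj₂ graph (c ∷ a ∷ z ∷ [])) s)))
        where
        open Parameters (parameters u u⊆A)

        Blocks : List (Context L)
        Blocks = Ω ∷ pow n ∷ Γ ∷ Γ ∷ []

        arguments : Ren (Ω ++ (Γ ++ pow n)) (concat Blocks)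
        arguments = block {Γs = Blocks} v₀ ++ᵗ (block {Γs = Blocks} v₂ ++ᵗ block {Γs = Blocks} v₁)

        arguments≡ : (e : Env Blocks) → pull arguments (catᵗ e) ≡
                     All.lookup e v₀ ++ᵗ (All.lookup e v₂ ++ᵗ All.lookup e v₁)
        arguments≡ e =
          pull-⊕ (block {Γs = Blocks} v₀) (block {Γs = Blocks} v₂ ++ᵗ block {Γs = Blocks} v₁) (catᵗ e)
            (pull-block v₀ e)
            (pull-⊕ (block {Γs = Blocks} v₂) (block {Γs = Blocks} v₁) (catᵗ e)
              (pull-block v₂ e) (pull-block v₁ e))

        graph : DefE B (pow n ∷ Γ ∷ Γ ∷ [])
          (λ e → Sat M φ (pull ρ (β ++ᵗ (All.lookup e v₁ ++ᵗ All.lookup e v₀)) ++ᵗ All.lookup e v₂))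
        graph = fill {X = λ e → Sat M φ (pull ρ (All.lookup e v₀ ++ᵗ (All.lookup e v₂ ++ᵗ All.lookup e v₁))
                                         ++ᵗ All.lookup e v₃)} β β⊆B
          (pullbackᴰ {X = Sat M φ} (Sat-def φ)
            ((ρ ⨾ arguments) ++ᵗ block {Γs = Blocks} v₃)
            (λ e → pull-⊕ (ρ ⨾ arguments) (block {Γs = Blocks} v₃) (catᵗ e)
                     (trans (pull-⨾ ρ arguments (catᵗ e)) (cong (pull ρ) (arguments≡ e)))
                     (pull-block v₃ e)))

  -- Internality speaks of one realisation a. An automorphism over D carries x to a, the image of z
  -- is linked to a there, and the inverse brings the link back while fixing c.
  linked : ∀ {x z} → P x → P z → ∃[ F ] Links F x z
  linked {x} {z} x⊨p z⊨p =
    let a , a⊨p , internal-a = internal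
        σ , fix , σx≡a       = carry x⊨p a⊨p
        F , c , 𝒞c , val     = dcl⇒links a (λ {y} → internal-a (_$ᵗ_ M σ z)
                                 ($-P σ fix z⊨p) {y})
    in F , c , 𝒞c ,
       subst₂ (Value F c)
         (trans (cong (_$ᵗ_ M (_⁻¹ᴬ M σ)) (sym σx≡a)) (⁻¹ᴬ-$ᵗ-$ᵗ M σ x)) (⁻¹ᴬ-$ᵗ-$ᵗ M σ z)
         (value-$ (_⁻¹ᴬ M σ) (Fixes-⁻¹ M {D} σ fix) F 𝒞c val)

  record Cover : Set (Level.suc ℓ) where
    field
      θs    : List (LFormula M B Γ)
      θs⊆p  : All formulas θs
      funs  : List PartialFun
      cover : ∀ x z → All (λ θ → Satᴸ M θ x) θs → All (λ θ → Satᴸ M θ z) θs →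
              Any (λ F → Links F x z) funs

  private
    Pair : Context L
    Pair = concat (Γ ∷ Γ ∷ [])

    -- The partial type of a pair of realisations of p that no partial function links. Membership
    -- means being implied by one of these conditions, which spares fixing particular formulas for
    -- them.
    Unlinked : Pred (LFormula M B Pair) ℓ
    Unlinked φ =
      (∃[ θ ] formulas θ × (∀ (x z : Tuple M Γ) → Satᴸ M θ x → Satᴸ M φ (catᵗ (x ∷ z ∷ [])))) ⊎
      (∃[ θ ] formulas θ × (∀ (x z : Tuple M Γ) → Satᴸ M θ z → Satᴸ M φ (catᵗ (x ∷ z ∷ [])))) ⊎
      (∃[ F ] (∀ (x z : Tuple M Γ) → ¬ Links F x z → Satᴸ M φ (catᵗ (x ∷ z ∷ []))))

    unrealised : ¬ ∃ (Realisations M Unlinked)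
    unrealised (t , t⊨)
      with x , t′ , refl ← ++-split Γ {Γ ++ []} t
      with z , [] , refl ← ++-split Γ {[]} t′
      = let F , link = linked (λ {θ} → x⊨p θ) (λ {θ} → z⊨p θ)
            ψ , ψ⇔   = ¬ᴰ linksᴰ F {Γ ∷ Γ ∷ []} v₀ v₁
        in Equivalence.to (ψ⇔ (x ∷ z ∷ []))
             (t⊨ {ψ} (inj₂ (inj₂ (F , λ x z → Equivalence.from (ψ⇔ (x ∷ z ∷ [])))))) link
      where
      x⊨p : ∀ θ → formulas θ → Satᴸ M θ x
      x⊨p θ θ∈p =
        let ψ , ψ⇔ = fromDefinable {Γs = Γ ∷ Γ ∷ []} {X = Satᴸ M θ} (Satᴸ-def θ) v₀
        in Equivalence.to (ψ⇔ (x ∷ z ∷ []))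
             (t⊨ {ψ} (inj₁ (θ , θ∈p , λ x z → Equivalence.from (ψ⇔ (x ∷ z ∷ [])))))

      z⊨p : ∀ θ → formulas θ → Satᴸ M θ z
      z⊨p θ θ∈p =
        let ψ , ψ⇔ = fromDefinable {Γs = Γ ∷ Γ ∷ []} {X = Satᴸ M θ} (Satᴸ-def θ) v₁
        in Equivalence.to (ψ⇔ (x ∷ z ∷ []))
             (t⊨ {ψ} (inj₂ (inj₁ (θ , θ∈p , λ x z → Equivalence.from (ψ⇔ (x ∷ z ∷ []))))))

    record Support (φs : List (LFormula M B Pair)) : Set (Level.suc ℓ) where
      field
        θs   : List (LFormula M B Γ)
        θs⊆p : All formulas θs
        funs : List PartialFun
        φs-hold : ∀ (x z : Tuple M Γ) → All (λ θ → Satᴸ M θ x) θs → All (λ θ → Satᴸ M θ z) θs →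
                  ¬ Any (λ F → Links F x z) funs → All (λ φ → Satᴸ M φ (catᵗ (x ∷ z ∷ []))) φs

    support : ∀ φs → All Unlinked φs → Support φs
    support []       []       = record { θs = [] ; θs⊆p = [] ; funs = [] ; φs-hold = λ _ _ _ _ _ → [] }
    support (φ ∷ φs) (inj₁ (θ , θ∈p , h) ∷ us) = record
      { θs = θ ∷ ih.θs ; θs⊆p = θ∈p ∷ ih.θs⊆p ; funs = ih.funs
      ; φs-hold = λ { x z (θx ∷ θsx) (_ ∷ θsz) none → h x z θx ∷ ih.φs-hold x z θsx θsz none } }
      where module ih = Support (support φs us)
    support (φ ∷ φs) (inj₂ (inj₁ (θ , θ∈p , h)) ∷ us) = record
      { θs = θ ∷ ih.θs ; θs⊆p = θ∈p ∷ ih.θs⊆p ; funs = ih.funs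
      ; φs-hold = λ { x z (_ ∷ θsx) (θz ∷ θsz) none → h x z θz ∷ ih.φs-hold x z θsx θsz none } }
      where module ih = Support (support φs us)
    support (φ ∷ φs) (inj₂ (inj₂ (F , h)) ∷ us) = record
      { θs = ih.θs ; θs⊆p = ih.θs⊆p ; funs = F ∷ ih.funs
      ; φs-hold = λ x z θsx θsz none →
          h x z (λ link → none (here link)) ∷ ih.φs-hold x z θsx θsz (none ∘ there) }
      where module ih = Support (support φs us)

  opaque
    -- Compactness: if `Unlinked` were finitely satisfiable, saturation would realise it, against
    -- `linked`. The finitely many inconsistent formulas use only finitely many θ from p and
    -- finitely many partial functions. The resulting cover holds for all x, z satisfying the θ, as
    -- required later for a point not yet known to realise p.
    finite-cover : Cover
    finite-cover = dne λ none →
      unrealised (saturated B B-small Unlinked λ φs us → dne λ inconsistent →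
        let open Support (support φs us)
        in none record
             { θs = θs ; θs⊆p = θs⊆p ; funs = funs
             ; cover = λ x z θsx θsz → dne λ unlinked →
                 inconsistent (catᵗ (x ∷ z ∷ []) , φs-hold x z θsx θsz unlinked) })

  open Cover finite-cover public using (funs)

  linked-by-funs : ∀ {x z} → P x → P z → Any (λ F → Links F x z) funs
  linked-by-funs {x} {z} x⊨p z⊨p =
    Cover.cover finite-cover x z (All.map x⊨p (Cover.θs⊆p finite-cover))
                                 (All.map z⊨p (Cover.θs⊆p finite-cover))

  overD : LFormula M B Γ → LFormula M D Γ
  overD φ = φ ⟨ inj₁ ⟩

  all-definable : ∀ {A} (φs : List (LFormula M A Γ)) → Definable M A (λ x → All (λ φ → Satᴸ M φ x) φs)
  all-definable []       = toDefinable (⊤ᴰ (λ _ → []))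
  all-definable (φ ∷ φs) = toDefinable
    (respᴰ (λ e → mk⇔ (λ (s , ss) → s ∷ ss) (λ { (s ∷ ss) → s , ss }))
           (fromDefinable {X = Satᴸ M φ} (Satᴸ-def φ) v₀ ×ᴰ
            fromDefinable (all-definable φs) v₀))

  -- An element e of a formula isolating a type over D is linked to every
  -- realisation a of p, so that tp(a/D) is isolated too, and by weak
  -- orthogonality p isolates it.
  private
    module _ {a : Tuple M Γ} (a⊨p : P a) {χ : LFormula M D Γ} (χ-isolating : Isolating χ)
             {e : Tuple M Γ} (χe : Satᴸ M χ e) (F : PartialFun) (link : Links F e a) where
      private
        c = proj₁ link

        imageᴰ : ∀ {Y : Pred (Tuple M Γ) ℓ} → Definable M D Y →
                 DefE D (Γ ∷ []) (λ e → ∃[ z ] Value F c (All.lookup e v₀) z × Y z)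
        imageᴰ Y-def = fill c (inj₂ ∘ 𝒞^⊆ (proj₁ F) c (proj₁ (proj₂ link)))
          (∃ᴰ Γ (monoᴰ inj₁ (valueᴰ F v₁ v₂ v₀) ×ᴰ fromDefinable Y-def v₀))

        χ′ : Σ[ χ′ ∈ LFormula M D Γ ] ∀ z → Satᴸ M χ′ z ⇔ (∃[ x ] Satᴸ M χ x × Value F c x z)
        χ′ = toDefinable (fill c (inj₂ ∘ 𝒞^⊆ (proj₁ F) c (proj₁ (proj₂ link)))
               (∃ᴰ Γ (fromDefinable {X = Satᴸ M χ} (Satᴸ-def χ) v₀ ×ᴰ
                      monoᴰ inj₁ (valueᴰ F v₁ v₀ v₂))))

        -- For θ in p, having a value under F c that satisfies θ is a D-formula in x. It holds at e,
        -- whose value is a, hence at every x of χ, since χ is isolating.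
        χ′⊢p : ∀ z → Satᴸ M (proj₁ χ′) z → P z
        χ′⊢p z χ′z {θ} θ∈p =
          let x , χx , val = Equivalence.to (proj₂ χ′ z) χ′z
              ψ , ψ⇔ = toDefinable {X = λ x → ∃[ z ] Value F c x z × Satᴸ M θ z}
                         (imageᴰ {Satᴸ M θ} (Satᴸ-def (overD θ)))
              z′ , val′ , θz′ = Equivalence.to (ψ⇔ x) (χ-isolating ψ e x χe χx
                (Equivalence.from (ψ⇔ e) (a , proj₂ (proj₂ link) , a⊨p {θ} θ∈p)))
          in subst (Satᴸ M θ) (value-unique val′ val) θz′

        χ′a : Satᴸ M (proj₁ χ′) a
        χ′a = Equivalence.from (proj₂ χ′ a) (e , χe , proj₂ (proj₂ link))

        -- Weak orthogonality makes p imply `χ′` or its negation, and the realisation a of p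
        -- satisfies `χ′`.
        p⊢χ′ : Entails M formulas (proj₁ χ′)
        p⊢χ′ with CompleteType.complete (proj₁ orthogonal) (proj₁ χ′)
        ... | inj₁ χ′∈q  = proj₂ orthogonal χ′∈q
        ... | inj₂ ¬χ′∈q =
          let φs , φs⊆p , φs⊢ = proj₂ orthogonal ¬χ′∈q
          in ⊥-elim (lower (φs⊢ a (All.map a⊨p φs⊆p) χ′a))

      isolated : Definable M B P
      isolated =
        let φs , φs⊆p , φs⊢χ′ = p⊢χ′
            ψ , ψ⇔            = all-definable φs
        in ψ , λ x → mk⇔ (λ ψx {θ} → χ′⊢p x (φs⊢χ′ x (Equivalence.to (ψ⇔ x) ψx)) {θ})
                         (λ x⊨p → Equivalence.from (ψ⇔ x) (All.map x⊨p φs⊆p))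

  opaque
    P-def : Definable M B P
    P-def = from-isolating (isolating-dense (overD (proj₁ ψ)) (a , Equivalence.from (proj₂ ψ a) θsa))
      where
      open Cover finite-cover hiding (funs)

      a : Tuple M Γ
      a = proj₁ internal

      a⊨p : P a
      a⊨p {θ} = proj₁ (proj₂ internal) {θ}

      θsa : All (λ θ → Satᴸ M θ a) θs
      θsa = All.map a⊨p θs⊆p

      ψ : Definable M B (λ x → All (λ θ → Satᴸ M θ x) θs)
      ψ = all-definable θs

      from-isolating : Σ[ χ ∈ LFormula M D Γ ]
        Isolating χ × ∃ (Satᴸ M χ) × Satᴸ M χ ⊆ Satᴸ M (overD (proj₁ ψ)) → Definable M B P
      from-isolating (χ , iso , (e , χe) , χ⊆ψ) =
        let F , link = find-link (cover e a (Equivalence.to (proj₂ ψ e) (χ⊆ψ χe)) θsa)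
        in isolated a⊨p {χ} iso {e} χe F link
        where
        find-link : ∀ {Fs} → Any (λ F → Links F e a) Fs → ∃[ F ] Links F e a
        find-link (here link) = _ , link
        find-link (there any) = find-link any

-- Canonical parameters from elimination of imaginaries.

module Codes (em : ∀ {a} → ExcludedMiddle a) {ℓ} {L : Language ℓ} {T : Pred (Sentence L) ℓ}
  (ei : EliminationOfImaginaries T) (M : Structure L) (M⊨T : M ⊨ᵀ T) where
  open Classical em
  open Definability em M

  module _ (W V : Context L) (φ : Formula L (W ++ V)) where
    private
      left right : Ren (W ++ V) (V ++ (W ++ W))
      left  = (inlʳ {Γ = W} ⨾ inrʳ {Γ = V}) ++ᵗ inlʳ
      right = (inrʳ {Γ = W} ⨾ inrʳ {Γ = V}) ++ᵗ inlʳ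

    -- Two indices are equivalent when they define the same set in the variables V. This is an
    -- equivalence in every structure, so elimination of imaginaries applies; the nested negations
    -- spell out a conjunction.
    sameFibre : Formula L (W ++ W)
    sameFibre = ∀̇* V (neg L ((rename left φ ⇒ rename right φ) ⇒ neg L (rename right φ ⇒ rename left φ)))

    module _ (N : Structure L) where
      SameFibre : Tuple N W → Tuple N W → Set ℓ
      SameFibre x y = ∀ v → Sat N φ (x ++ᵗ v) ⇔ Sat N φ (y ++ᵗ v)

      Sat-sameFibre : ∀ x y → Sat N sameFibre (x ++ᵗ y) ⇔ SameFibre x y
      Sat-sameFibre x y = mk⇔
        (λ s v → let h = Equivalence.to (q v) (Equivalence.to all s v) in mk⇔ (proj₁ h) (proj₂ h))
        (λ h → Equivalence.from all (λ v →
          Equivalence.from (q v) (Equivalence.to (h v) , Equivalence.from (h v))))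
        where
        all = Sat-∀* N V (neg L ((rename left φ ⇒ rename right φ) ⇒ neg L (rename right φ ⇒ rename left φ)))
                     (x ++ᵗ y)

        q : ∀ v → Sat N (neg L ((rename left φ ⇒ rename right φ) ⇒ neg L (rename right φ ⇒ rename left φ)))
                        (v ++ᵗ (x ++ᵗ y)) ⇔
                  ((Sat N φ (x ++ᵗ v) → Sat N φ (y ++ᵗ v)) × (Sat N φ (y ++ᵗ v) → Sat N φ (x ++ᵗ v)))
        q v = mk⇔
          (λ s → dne (λ none → lower (s (λ f → λ g → ↑ (none
            ((r.to ∘ f ∘ l.from) , (l.to ∘ g ∘ r.from)))))))
          (λ (f , g) s → s (r.from ∘ f ∘ l.to) (l.from ∘ g ∘ r.to))
          where
          w = v ++ᵗ (x ++ᵗ y)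
          module l = Equivalence (Sat-rename N left φ w
            (pull-⊕ (inlʳ {Γ = W} ⨾ inrʳ {Γ = V}) inlʳ w
              (trans (pull-⨾inr (inlʳ {Γ = W}) v (x ++ᵗ y)) (pull-inl x y)) (pull-inl v (x ++ᵗ y))))
          module r = Equivalence (Sat-rename N right φ w
            (pull-⊕ (inrʳ {Γ = W} ⨾ inrʳ {Γ = V}) inlʳ w
              (trans (pull-⨾inr (inrʳ {Γ = W}) v (x ++ᵗ y)) (pull-inr x y)) (pull-inl v (x ++ᵗ y))))

      sameFibre-isEquivalence : IsEquivalence (λ x y → Sat N sameFibre (x ++ᵗ y))
      sameFibre-isEquivalence = record
        { refl  = λ {x} → Equivalence.from (Sat-sameFibre x x) (λ v → mk⇔ id id)
        ; sym   = λ {x} {y} s → Equivalence.from (Sat-sameFibre y x) (λ v →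
            let h = Equivalence.to (Sat-sameFibre x y) s v in mk⇔ (Equivalence.from h) (Equivalence.to h))
        ; trans = λ {x} {y} {z} s t → Equivalence.from (Sat-sameFibre x z) (λ v →
            let h = Equivalence.to (Sat-sameFibre x y) s v
                k = Equivalence.to (Sat-sameFibre y z) t v
            in mk⇔ (Equivalence.to k ∘ Equivalence.to h) (Equivalence.from h ∘ Equivalence.from k))
        }

  module Coding {B : Pred (Element M) ℓ} (U V : Context L) (X : Pred (Tuple M (U ++ V)) ℓ)
    (X-def : Definable M B X) where
    private
      open LFormula (proj₁ X-def) renaming (Params to Π; body to φ; params to β; params⊆A to β⊆B)

      assoc : Ren (Π ++ (U ++ V)) ((Π ++ U) ++ V)
      assoc = (inlʳ {Γ = Π} ⨾ inlʳ) ++ᵗ ((inrʳ {Γ = Π} ⨾ inlʳ) ++ᵗ inrʳ {Γ = Π ++ U})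

      -- Elimination of imaginaries concerns parameter-free formulas, so the parameters β of X are
      -- moved among the index variables. The code of u is the value of the resulting function at
      -- `β ++ᵗ u`.
      φ′ : Formula L ((Π ++ U) ++ V)
      φ′ = rename assoc φ

      Sat-φ′ : ∀ u v → Sat M φ′ ((β ++ᵗ u) ++ᵗ v) ⇔ X (u ++ᵗ v)
      Sat-φ′ u v =
        let w = (β ++ᵗ u) ++ᵗ v
            module r = Equivalence (Sat-rename M assoc φ w
              (pull-⊕ (inlʳ {Γ = Π} ⨾ inlʳ) ((inrʳ {Γ = Π} ⨾ inlʳ) ++ᵗ inrʳ {Γ = Π ++ U}) w
                (trans (pull-⨾inl (inlʳ {Γ = Π}) (β ++ᵗ u) v) (pull-inl β u))
                (pull-⊕ (inrʳ {Γ = Π} ⨾ inlʳ) (inrʳ {Γ = Π ++ U}) w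
                  (trans (pull-⨾inl (inrʳ {Γ = Π}) (β ++ᵗ u) v) (pull-inr β u))
                  (pull-inr (β ++ᵗ u) v))))
            module X = Equivalence (proj₂ X-def (u ++ᵗ v))
        in mk⇔ (X.to ∘ r.to) (r.from ∘ X.from)

      imaginary : ∃[ Δ ] Σ[ F ∈ Formula L ((Π ++ U) ++ Δ) ]
        (∀ N → N ⊨ᵀ T →
          (∀ (x : Tuple N (Π ++ U)) → ∃! _≡_ (λ (d : Tuple N Δ) → Sat N F (x ++ᵗ d))) ×
          (∀ (x y : Tuple N (Π ++ U)) → Sat N (sameFibre (Π ++ U) V φ′) (x ++ᵗ y) ⇔
                   (Σ[ d ∈ Tuple N Δ ] Sat N F (x ++ᵗ d) × Sat N F (y ++ᵗ d))))
      imaginary = ei (sameFibre (Π ++ U) V φ′) (λ N _ → sameFibre-isEquivalence (Π ++ U) V φ′ N)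

    opaque
      Code : Context L
      Code = proj₁ imaginary

      graph : Formula L ((Π ++ U) ++ Code)
      graph = proj₁ (proj₂ imaginary)

      functional : ∀ (w : Tuple M (Π ++ U)) → Σ[ d ∈ Tuple M Code ]
                   Sat M graph (w ++ᵗ d) × (∀ {d′} → Sat M graph (w ++ᵗ d′) → d ≡ d′)
      functional = proj₁ (proj₂ (proj₂ imaginary) M M⊨T)

      kernel : ∀ (x y : Tuple M (Π ++ U)) → Sat M (sameFibre (Π ++ U) V φ′) (x ++ᵗ y) ⇔
               (Σ[ d ∈ Tuple M Code ] Sat M graph (x ++ᵗ d) × Sat M graph (y ++ᵗ d))
      kernel = proj₂ (proj₂ (proj₂ imaginary) M M⊨T)

      code : Tuple M U → Tuple M Code
      code u = proj₁ (functional (β ++ᵗ u))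

      code-cong : ∀ u u′ → (∀ v → X (u ++ᵗ v) ⇔ X (u′ ++ᵗ v)) → code u ≡ code u′
      code-cong u u′ h =
        trans (proj₂ (proj₂ (functional (β ++ᵗ u))) (proj₁ (proj₂ shared)))
              (sym (proj₂ (proj₂ (functional (β ++ᵗ u′))) (proj₂ (proj₂ shared))))
        where
        shared : Σ[ d ∈ Tuple M Code ]
                 Sat M graph ((β ++ᵗ u) ++ᵗ d) × Sat M graph ((β ++ᵗ u′) ++ᵗ d)
        shared = Equivalence.to (kernel (β ++ᵗ u) (β ++ᵗ u′))
          (Equivalence.from (Sat-sameFibre (Π ++ U) V φ′ M (β ++ᵗ u) (β ++ᵗ u′)) (λ v →
            mk⇔ (Equivalence.from (Sat-φ′ u′ v) ∘ Equivalence.to (h v) ∘ Equivalence.to (Sat-φ′ u v))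
                (Equivalence.from (Sat-φ′ u v) ∘ Equivalence.from (h v) ∘ Equivalence.to (Sat-φ′ u′ v))))

      code-injective : ∀ u u′ → code u ≡ code u′ → ∀ v → X (u ++ᵗ v) → X (u′ ++ᵗ v)
      code-injective u u′ eq v Xuv =
        Equivalence.to (Sat-φ′ u′ v) (Equivalence.to
          (Equivalence.to (Sat-sameFibre (Π ++ U) V φ′ M (β ++ᵗ u) (β ++ᵗ u′))
            (Equivalence.from (kernel (β ++ᵗ u) (β ++ᵗ u′))
              (code u , proj₁ (proj₂ (functional (β ++ᵗ u))) ,
               subst (λ d → Sat M graph ((β ++ᵗ u′) ++ᵗ d)) (sym eq) (proj₁ (proj₂ (functional (β ++ᵗ u′))))))
            v)
          (Equivalence.from (Sat-φ′ u v) Xuv))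

      code-def : ∀ {Γs} (ρ : Ren U (concat Γs)) {f : Env Γs → Tuple M U} →
                 (∀ e → pull ρ (catᵗ e) ≡ f e) → (v : Code ∋ Γs) →
                 DefE B Γs (λ e → code (f e) ≡ All.lookup e v)
      code-def {Γs} ρ {f} ρ≡f v = respᴰ
        (λ e → let d , s , unique = functional (β ++ᵗ f e)
               in mk⇔ unique (λ eq → subst (λ d → Sat M graph ((β ++ᵗ f e) ++ᵗ d)) eq s))
        (fill {X = λ e → Sat M graph ((All.head e ++ᵗ f (All.tail e)) ++ᵗ All.lookup (All.tail e) v)} β β⊆B
          (pullbackᴰ {X = Sat M graph} (Sat-def graph)
            ((inlʳ {Γ = Π} ++ᵗ (ρ ⨾ inrʳ {Γ = Π})) ++ᵗ (block v ⨾ inrʳ {Γ = Π}))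
            {f = λ e → (All.head e ++ᵗ f (All.tail e)) ++ᵗ All.lookup (All.tail e) v}
            (λ { (b ∷ e) →
              pull-⊕ (inlʳ {Γ = Π} ++ᵗ (ρ ⨾ inrʳ {Γ = Π})) (block v ⨾ inrʳ {Γ = Π}) (b ++ᵗ catᵗ e)
                (pull-⊕ (inlʳ {Γ = Π}) (ρ ⨾ inrʳ {Γ = Π}) (b ++ᵗ catᵗ e)
                  (pull-inl b (catᵗ e)) (trans (pull-⨾inr ρ b (catᵗ e)) (ρ≡f e)))
                (trans (pull-⨾inr (block v) b (catᵗ e)) (pull-block v e)) })))

-- A heap on P, written T x y z for x y⁻¹ z, whose graph is relatively definable.
record DefinableHeap {ℓ} {L : Language ℓ} (em : ∀ {a} → ExcludedMiddle a) (M : Structure L)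
  (B : Pred (Element M) ℓ) {Γ : Context L} (P : Pred (Tuple M Γ) ℓ) : Set (Level.suc ℓ) where
  open Definability em M
  field
    T       : Tuple M Γ → Tuple M Γ → Tuple M Γ → Tuple M Γ
    T-P     : ∀ {x y z} → P x → P y → P z → P (T x y z)
    T-xxy   : ∀ {x y} → P x → P y → T x x y ≡ y
    T-xyy   : ∀ {x y} → P x → P y → T x y y ≡ x
    T-assoc : ∀ {v w x y z} → P v → P w → P x → P y → P z →
              T v w (T x y z) ≡ T (T v w x) y z
    Graph   : Tuple M Γ → Tuple M Γ → Tuple M Γ → Tuple M Γ → Set ℓ
    graphᴰ  : ∀ {Γs} (x y z t : Γ ∋ Γs) →
              DefE B Γs (λ e → Graph (All.lookup e x) (All.lookup e y) (All.lookup e z) (All.lookup e t))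
    graph⇔  : ∀ {x y z t} → P x → P y → P z → P t → Graph x y z t ⇔ T x y z ≡ t

  -- Its left translations x ↦ b a⁻¹ x are the right translations x ↦ x a⁻¹ b of the given heap, so
  -- one construction of a group serves both sides.
  opposite : DefinableHeap em M B P
  opposite = record
    { T       = λ x y z → T z y x
    ; T-P     = λ x y z → T-P z y x
    ; T-xxy   = λ x y → T-xyy y x
    ; T-xyy   = λ x y → T-xxy y x
    ; T-assoc = λ v w x y z → sym (T-assoc z y x w v)
    ; Graph   = λ x y z → Graph z y x
    ; graphᴰ  = λ x y z → graphᴰ z y x
    ; graph⇔  = λ x y z → graph⇔ z y x
    }

-- The definable group of translations of a heap and its regular action.

module HeapGroup (em : ∀ {a} → ExcludedMiddle a) {ℓ} {L : Language ℓ} {Th : Pred (Sentence L) ℓ}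
  (ei : EliminationOfImaginaries Th) (M : Structure L) (M⊨Th : M ⊨ᵀ Th)
  {B : Pred (Element M) ℓ} {Γ : Context L} {P : Pred (Tuple M Γ) ℓ} (P-def : Definable M B P)
  (inhabitant : ∃ P) (heap : DefinableHeap em M B P) where
  open Definability em M
  open Codes em ei M M⊨Th
  open DefinableHeap heap

  private
    e₀ : Tuple M Γ
    e₀ = proj₁ inhabitant

    Pe₀ : P e₀
    Pe₀ = proj₂ inhabitant

    Pᴰ : ∀ {Γs} (v : Γ ∋ Γs) → DefE B Γs (λ e → P (All.lookup e v))
    Pᴰ = fromDefinable P-def

    Γ² : Context L
    Γ² = Γ ++ Γ

    quarters : All (λ Δ → Ren Δ (Γ² ++ Γ²)) (Γ ∷ Γ ∷ Γ ∷ Γ ∷ [])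
    quarters = (inlʳ {Γ = Γ} ⨾ inlʳ {Γ = Γ²}) ∷ (inrʳ {Γ = Γ} ⨾ inlʳ {Γ = Γ²}) ∷
               (inlʳ {Γ = Γ} ⨾ inrʳ {Γ = Γ²}) ∷ (inrʳ {Γ = Γ} ⨾ inrʳ {Γ = Γ²}) ∷ []

    quarter : Tuple M (Γ² ++ Γ²) → Env (Γ ∷ Γ ∷ Γ ∷ Γ ∷ [])
    quarter w = All.map (λ v → pull v w) quarters

    quarter≡ : ∀ a b v → quarter ((a ++ᵗ b) ++ᵗ v) ≡ a ∷ b ∷ pull inlʳ v ∷ pull (inrʳ {Γ = Γ}) v ∷ []
    quarter≡ a b v =
      cong₂ _∷_ (trans (pull-⨾inl (inlʳ {Γ = Γ}) (a ++ᵗ b) v) (pull-inl a b))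
     (cong₂ _∷_ (trans (pull-⨾inl (inrʳ {Γ = Γ}) (a ++ᵗ b) v) (pull-inr a b))
     (cong₂ _∷_ (pull-⨾inr (inlʳ {Γ = Γ}) (a ++ᵗ b) v)
     (cong (_∷ []) (pull-⨾inr (inrʳ {Γ = Γ}) (a ++ᵗ b) v))))

    -- Translates a b x z: the translation b a⁻¹ takes x to z.
    Translates : Env (Γ ∷ Γ ∷ Γ ∷ Γ ∷ []) → Set ℓ
    Translates e = P (All.lookup e v₂) × P (All.lookup e v₃) ×
                   Graph (All.lookup e v₁) (All.lookup e v₀) (All.lookup e v₂) (All.lookup e v₃)

    Translating : Pred (Tuple M (Γ² ++ Γ²)) ℓ
    Translating w = Translates (quarter w)

    translatingᴰ : Definable M B Translating
    translatingᴰ = flatten (Pᴰ v₂ ×ᴰ Pᴰ v₃ ×ᴰ graphᴰ v₁ v₀ v₂ v₃) quarters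

  open Coding Γ² Γ² Translating translatingᴰ public
    renaming (Code to Codes) using (code; code-cong; code-injective; code-def)

  -- The canonical parameter of the translation b a⁻¹.
  translation : Tuple M Γ → Tuple M Γ → Tuple M Codes
  translation a b = code (a ++ᵗ b)

  translationᴰ : ∀ {Γs} (v w : Γ ∋ Γs) (u : Codes ∋ Γs) →
                 DefE B Γs (λ e → translation (All.lookup e v) (All.lookup e w) ≡ All.lookup e u)
  translationᴰ v w u = code-def (block v ++ᵗ block w)
    (λ e → pull-⊕ (block v) (block w) (catᵗ e) (pull-block v e) (pull-block w e)) u

  translation-cong : ∀ {a b a′ b′} → P a → P b → P a′ → P b′ →
                     (∀ x → P x → T b a x ≡ T b′ a′ x) → translation a b ≡ translation a′ b′
  translation-cong {a} {b} {a′} {b′} Pa Pb Pa′ Pb′ h =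
    code-cong (a ++ᵗ b) (a′ ++ᵗ b′) (λ v → mk⇔
      (transport Pa Pb Pa′ Pb′ h v) (transport Pa′ Pb′ Pa Pb (λ x Px → sym (h x Px)) v))
    where
    transport : ∀ {a b a′ b′} → P a → P b → P a′ → P b′ → (∀ x → P x → T b a x ≡ T b′ a′ x) →
                ∀ v → Translates (quarter ((a ++ᵗ b) ++ᵗ v)) → Translates (quarter ((a′ ++ᵗ b′) ++ᵗ v))
    transport {a} {b} {a′} {b′} Pa Pb Pa′ Pb′ h v t =
      let Px , Pz , g = subst Translates (quarter≡ a b v) t
      in subst Translates (sym (quarter≡ a′ b′ v))
           (Px , Pz , Equivalence.from (graph⇔ Pb′ Pa′ Px Pz)
                        (trans (sym (h _ Px)) (Equivalence.to (graph⇔ Pb Pa Px Pz) g)))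

  translation-injective : ∀ {a b a′ b′} → P a → P b → P a′ → P b′ →
                          translation a b ≡ translation a′ b′ → ∀ x → P x → T b a x ≡ T b′ a′ x
  translation-injective {a} {b} {a′} {b′} Pa Pb Pa′ Pb′ eq x Px =
    let Pz          = T-P Pb Pa Px
        v           = x ++ᵗ T b a x
        at-x        = λ a b → trans (quarter≡ a b v)
                        (cong₂ (λ x z → a ∷ b ∷ x ∷ z ∷ []) (pull-inl x _) (pull-inr x _))
        _ , _ , g   = subst Translates (at-x a′ b′)
                        (code-injective (a ++ᵗ b) (a′ ++ᵗ b′) eq v
                          (subst Translates (sym (at-x a b))
                            (Px , Pz , Equivalence.from (graph⇔ Pb Pa Px Pz) refl)))
    in sym (Equivalence.to (graph⇔ Pb′ Pa′ Px Pz) g)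

  -- A member carries a pair a, b that represents it, and `_⊙_` computes with this pair. Equality of
  -- group elements compares only codes, hence the need for `⊙-cong`.
  Translation : Pred (Tuple M Codes) ℓ
  Translation g = ∃[ a ] ∃[ b ] P a × P b × translation a b ≡ g

  infixr 7 _⊙_
  _⊙_ : ∃ Translation → Tuple M Γ → Tuple M Γ
  (_ , a , b , _) ⊙ x = T b a x

  ⊙-P : ∀ g {x} → P x → P (g ⊙ x)
  ⊙-P (_ , a , b , Pa , Pb , _) Px = T-P Pb Pa Px

  ⊙-T : ∀ g {x y z} → P x → P y → P z → g ⊙ T x y z ≡ T (g ⊙ x) y z
  ⊙-T (_ , a , b , Pa , Pb , _) Px Py Pz = T-assoc Pb Pa Px Py Pz

  ⊙-cong : ∀ g h → proj₁ g ≡ proj₁ h → ∀ {x} → P x → g ⊙ x ≡ h ⊙ x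
  ⊙-cong (_ , a , b , Pa , Pb , refl) (_ , a′ , b′ , Pa′ , Pb′ , eq) g≡h Px =
    translation-injective Pa Pb Pa′ Pb′ (trans g≡h (sym eq)) _ Px

  ⊙-via : ∀ g {x y} → P x → P y → g ⊙ y ≡ T (g ⊙ x) x y
  ⊙-via g Px Py = trans (cong (g ⊙_) (sym (T-xxy Px Py))) (⊙-T g Px Px Py)

  -- The value at one point x determines a translation, since g y = (g x) x⁻¹ y by `⊙-via`.
  ⊙-injective : ∀ g h {x} → P x → g ⊙ x ≡ h ⊙ x → proj₁ g ≡ proj₁ h
  ⊙-injective g@(_ , a , b , Pa , Pb , refl) h@(_ , a′ , b′ , Pa′ , Pb′ , refl) {x} Px eq =
    translation-cong Pa Pb Pa′ Pb′ (λ y Py →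
      trans (⊙-via g Px Py) (trans (cong (λ z → T z x y) eq) (sym (⊙-via h Px Py))))

  move : ∀ {a b} → P a → P b → ∃ Translation
  move {a} {b} Pa Pb = translation a b , a , b , Pa , Pb , refl

  move-⊙ : ∀ {a b} (Pa : P a) (Pb : P b) → move Pa Pb ⊙ a ≡ b
  move-⊙ Pa Pb = T-xyy Pb Pa

  private
    infixl 7 _∙_
    -- As a translation is known from its value at one point, the product may be taken to be the one
    -- moving e₀ to g (h e₀). By `∙-⊙` it is the composite on all of P, and the group laws are read
    -- off at a single point.
    _∙_ : ∃ Translation → ∃ Translation → ∃ Translation
    g ∙ h = move Pe₀ (⊙-P g (⊙-P h Pe₀))

    ε : ∃ Translation
    ε = move Pe₀ Pe₀

    infix 8 _⁻¹
    _⁻¹ : ∃ Translation → ∃ Translation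
    g ⁻¹ = move (⊙-P g Pe₀) Pe₀

    ∙-⊙ : ∀ g h {x} → P x → (g ∙ h) ⊙ x ≡ g ⊙ h ⊙ x
    ∙-⊙ g h {x} Px =
      trans (sym (⊙-T g (⊙-P h Pe₀) Pe₀ Px)) (cong (g ⊙_) (sym (⊙-via h Pe₀ Px)))

    ε-⊙ : ∀ {x} → P x → ε ⊙ x ≡ x
    ε-⊙ Px = T-xxy Pe₀ Px

    ⁻¹-⊙ : ∀ g → g ⁻¹ ⊙ g ⊙ e₀ ≡ e₀
    ⁻¹-⊙ g = move-⊙ (⊙-P g Pe₀) Pe₀

    isGroup : IsGroup (λ (g h : ∃ Translation) → proj₁ g ≡ proj₁ h) _∙_ ε _⁻¹
    isGroup = record
      { isMonoid = record
        { isSemigroup = record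
          { isMagma = record
            { isEquivalence = record { refl = refl ; sym = sym ; trans = trans }
            ; ∙-cong = λ {g} {g′} {h} {h′} g≡g′ h≡h′ →
                ⊙-injective (g ∙ h) (g′ ∙ h′) Pe₀
                  (trans (∙-⊙ g h Pe₀)
                  (trans (cong (g ⊙_) (⊙-cong h h′ h≡h′ Pe₀))
                  (trans (⊙-cong g g′ g≡g′ (⊙-P h′ Pe₀)) (sym (∙-⊙ g′ h′ Pe₀)))))
            }
          ; assoc = λ g h k → ⊙-injective ((g ∙ h) ∙ k) (g ∙ (h ∙ k)) Pe₀
              (trans (∙-⊙ (g ∙ h) k Pe₀)
              (trans (∙-⊙ g h (⊙-P k Pe₀))
              (trans (cong (g ⊙_) (sym (∙-⊙ h k Pe₀))) (sym (∙-⊙ g (h ∙ k) Pe₀)))))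
          }
        ; identity =
            (λ g → ⊙-injective (ε ∙ g) g Pe₀ (trans (∙-⊙ ε g Pe₀) (ε-⊙ (⊙-P g Pe₀)))) ,
            (λ g → ⊙-injective (g ∙ ε) g Pe₀ (trans (∙-⊙ g ε Pe₀) (cong (g ⊙_) (ε-⊙ Pe₀))))
        }
      ; inverse =
          (λ g → ⊙-injective (g ⁻¹ ∙ g) ε Pe₀
             (trans (∙-⊙ (g ⁻¹) g Pe₀) (trans (⁻¹-⊙ g) (sym (ε-⊙ Pe₀))))) ,
          (λ g → ⊙-injective (g ∙ g ⁻¹) ε (⊙-P g Pe₀)
             (trans (∙-⊙ g (g ⁻¹) (⊙-P g Pe₀))
             (trans (cong (g ⊙_) (⁻¹-⊙ g)) (sym (ε-⊙ (⊙-P g Pe₀))))))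
      ; ⁻¹-cong = λ {g} {h} g≡h → cong (λ y → translation y e₀) (⊙-cong g h g≡h Pe₀)
      }

  Acts : Tuple M Codes → Tuple M Γ → Tuple M Γ → Set ℓ
  Acts g x z = ∃[ b ] ∃[ a ] (P a × P b × translation a b ≡ g) × Graph b a x z

  actsᴰ : ∀ {Γs} (g : Codes ∋ Γs) (x z : Γ ∋ Γs) →
          DefE B Γs (λ e → Acts (All.lookup e g) (All.lookup e x) (All.lookup e z))
  actsᴰ g x z = ∃ᴰ Γ (∃ᴰ Γ
    ((Pᴰ v₀ ×ᴰ Pᴰ v₁ ×ᴰ translationᴰ v₀ v₁ (there (there g))) ×ᴰ
     graphᴰ v₁ v₀ (there (there x)) (there (there z))))

  acts⇔ : ∀ g {x z} → P x → P z → Acts (proj₁ g) x z ⇔ (g ⊙ x ≡ z)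
  acts⇔ g@(_ , a , b , Pa , Pb , eq) Px Pz = mk⇔
    (λ (b′ , a′ , (Pa′ , Pb′ , eq′) , graph) →
      trans (⊙-cong g (_ , a′ , b′ , Pa′ , Pb′ , eq′) refl Px)
            (Equivalence.to (graph⇔ Pb′ Pa′ Px Pz) graph))
    (λ gx≡z → b , a , (Pa , Pb , eq) , Equivalence.from (graph⇔ Pb Pa Px Pz) gx≡z)

  private
    -- The product is described by its effect on every point of P, so that the base point e₀ does
    -- not enter as a parameter.
    Composes : Env (Codes ∷ Codes ∷ Codes ∷ []) → Set ℓ
    Composes e = ∀ x y z → P z → P y → P x → Acts (All.lookup e v₁) z y → Acts (All.lookup e v₀) y x →
                 Acts (All.lookup e v₂) z x

    composesᴰ : DefE B (Codes ∷ Codes ∷ Codes ∷ []) Composes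
    composesᴰ = ∀ᴰ Γ (∀ᴰ Γ (∀ᴰ Γ
      (Pᴰ v₀ ⇒ᴰ Pᴰ v₁ ⇒ᴰ Pᴰ v₂ ⇒ᴰ
       actsᴰ v₄ v₀ v₁ ⇒ᴰ actsᴰ v₃ v₁ v₂ ⇒ᴰ actsᴰ v₅ v₀ v₂)))

    composes⇔ : ∀ g h k → Composes (proj₁ g ∷ proj₁ h ∷ proj₁ k ∷ []) ⇔ (proj₁ (g ∙ h) ≡ proj₁ k)
    composes⇔ g h k = mk⇔
      (λ c → ⊙-injective (g ∙ h) k Pe₀ (trans (∙-⊙ g h Pe₀) (sym
        (Equivalence.to (acts⇔ k Pe₀ (⊙-P g (⊙-P h Pe₀)))
          (c _ _ _ Pe₀ (⊙-P h Pe₀) (⊙-P g (⊙-P h Pe₀))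
             (Equivalence.from (acts⇔ h Pe₀ (⊙-P h Pe₀)) refl)
             (Equivalence.from (acts⇔ g (⊙-P h Pe₀) (⊙-P g (⊙-P h Pe₀))) refl))))))
      (λ gh≡k x y z Pz Py Px hz gy → Equivalence.from (acts⇔ k Pz Px)
        (trans (sym (⊙-cong (g ∙ h) k gh≡k Pz))
        (trans (∙-⊙ g h Pz)
        (trans (cong (g ⊙_) (Equivalence.to (acts⇔ h Pz Py) hz))
               (Equivalence.to (acts⇔ g Py Px) gy)))))

  relativelyDefinable : ∀ {Γ₁ Γ₂ Γ₃} {X : Pred (Tuple M Γ₁) ℓ} {Y : Pred (Tuple M Γ₂) ℓ}
    {Z : Pred (Tuple M Γ₃) ℓ} {f : ∃ X → ∃ Y → ∃ Z}
    {R : Tuple M Γ₁ → Tuple M Γ₂ → Tuple M Γ₃ → Set ℓ} →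
    DefE B (Γ₁ ∷ Γ₂ ∷ Γ₃ ∷ []) (λ e → R (All.lookup e v₀) (All.lookup e v₁) (All.lookup e v₂)) →
    (∀ x y z → R (proj₁ x) (proj₁ y) (proj₁ z) ⇔ (proj₁ (f x y) ≡ proj₁ z)) →
    RelativelyDefinable M B {X = X} {Y = Y} {Z = Z} f
  relativelyDefinable {Γ₁} {Γ₂} {Γ₃} {f = f} {R} Rᴰ R⇔ =
    proj₁ θ , λ x y z →
      let module θ = Equivalence (proj₂ θ (proj₁ x ++ᵗ proj₁ y ++ᵗ proj₁ z))
          module r = Equivalence (R⇔ x y z)
          eq = thirds≡ (proj₁ x) (proj₁ y) (proj₁ z)
      in mk⇔ (λ s → r.to (subst R′ eq (θ.to s))) (λ e → θ.from (subst R′ (sym eq) (r.from e)))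
    where
    R′ : Env (Γ₁ ∷ Γ₂ ∷ Γ₃ ∷ []) → Set ℓ
    R′ e = R (All.lookup e v₀) (All.lookup e v₁) (All.lookup e v₂)

    thirds : All (λ Δ → Ren Δ (Γ₁ ++ (Γ₂ ++ Γ₃))) (Γ₁ ∷ Γ₂ ∷ Γ₃ ∷ [])
    thirds = inlʳ ∷ (inlʳ {Γ = Γ₂} ⨾ inrʳ {Γ = Γ₁}) ∷ (inrʳ {Γ = Γ₂} ⨾ inrʳ {Γ = Γ₁}) ∷ []

    thirds≡ : ∀ x y z → All.map (λ v → pull v (x ++ᵗ y ++ᵗ z)) thirds ≡ x ∷ y ∷ z ∷ []
    thirds≡ x y z =
      cong₂ _∷_ (pull-inl x (y ++ᵗ z))
     (cong₂ _∷_ (trans (pull-⨾inr (inlʳ {Γ = Γ₂}) x (y ++ᵗ z)) (pull-inl y z))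
     (cong (_∷ []) (trans (pull-⨾inr (inrʳ {Γ = Γ₂}) x (y ++ᵗ z)) (pull-inr y z))))

    θ : Definable M B (λ w → R′ (All.map (λ v → pull v w) thirds))
    θ = flatten Rᴰ thirds

  translationGroup : DefinableGroup M B
  translationGroup = record
    { set         = Translation
    ; definable   = toDefinable (∃ᴰ Γ (∃ᴰ Γ (Pᴰ v₁ ×ᴰ Pᴰ v₀ ×ᴰ translationᴰ v₁ v₀ v₂)))
    ; _∙_         = _∙_
    ; ε           = ε
    ; _⁻¹         = _⁻¹
    ; isGroup     = isGroup
    ; ∙-definable = relativelyDefinable {X = Translation} {Translation} {Translation} {_∙_}
        {R = λ g h k → Composes (g ∷ h ∷ k ∷ [])} composesᴰ composes⇔
    }

  action : LeftAction (DefinableGroup.group translationGroup) (setoidOf M P)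
  action = record
    { _·_      = λ g (x , Px) → g ⊙ x , ⊙-P g Px
    ; ·-cong   = λ { {g} {h} {a , Pa} g≡h refl → ⊙-cong g h g≡h Pa }
    ; identity = λ (_ , Px) → ε-⊙ Px
    ; assoc    = λ g h (_ , Px) → ∙-⊙ g h Px
    }

  action-uniquelyTransitive : LeftAction.UniquelyTransitive action
  action-uniquelyTransitive (_ , Pa) (_ , Pb) =
    move Pa Pb , move-⊙ Pa Pb ,
    λ {g} ga≡b → ⊙-injective (move Pa Pb) g Pa (trans (move-⊙ Pa Pb) (sym ga≡b))

  action-definable : RelativelyDefinable M B {X = Translation} {Y = P} {Z = P} (LeftAction._·_ action)
  action-definable = relativelyDefinable {X = Translation} {P} {P} {LeftAction._·_ action} {Acts}
    (actsᴰ v₀ v₁ v₂)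
    (λ g (_ , Px) (_ , Pz) → acts⇔ g Px Pz)

-- The heap on P, the bitorsor, and the binding group.

module BindingGroup (em : ∀ {a} → ExcludedMiddle a) {ℓ} {L : Language ℓ} {Th : Pred (Sentence L) ℓ}
  (ei : EliminationOfImaginaries Th) (M : Structure L) (M⊨Th : M ⊨ᵀ Th)
  (κ : Cardinal ℓ) (saturatedIn : SaturatedIn M κ)
  (ranked : ∀ {Γ} (φ : LFormula M (λ _ → ⊤) Γ) → Σ[ α ∈ Ordinal ℓ ] ¬ MorleyRank≥ M α φ)
  {B : Pred (Element M) ℓ} (B-small : SmallerThan κ B)
  {Θ : Context L} {𝒞 : Pred (Tuple M Θ) ℓ} (𝒞-def : Definable M B 𝒞)
  {Γ : Context L} (p : CompleteType M B Γ)
  (internal : FundamentalInternal M p 𝒞) (orthogonal : WeaklyOrthogonal M p 𝒞) where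
  open Definability em M
  open Powers em 𝒞-def
  open Extension em M κ saturatedIn ranked B-small 𝒞-def using (D)
  open Internality em M κ saturatedIn ranked B-small 𝒞-def p internal orthogonal

  agree : ∀ {a b} → P a → P b → ∀ σ τ → Fixes M D σ → Fixes M D τ →
          _$ᵗ_ M σ a ≡ _$ᵗ_ M τ a → _$ᵗ_ M σ b ≡ _$ᵗ_ M τ b
  agree {a} {b} Pa Pb σ τ σ-fix τ-fix eq =
    let F , c , 𝒞c , val = linked Pa Pb
    in value-unique (subst (λ x → Value F c x _) eq (value-$ σ σ-fix F 𝒞c val)) (value-$ τ τ-fix F 𝒞c val)

  -- x a⁻¹ b is the image of b under the automorphism over B ∪ 𝒞 taking a to x.
  torsor : Tuple M Γ → Tuple M Γ → Tuple M Γ → Tuple M Γ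
  torsor x a b with em {P = P a × P x}
  ... | yes (Pa , Px) = _$ᵗ_ M (proj₁ (carry Pa Px)) b
  -- An arbitrary value outside P; all heap laws are stated on P.
  ... | no _          = x

  -- By `agree`, the automorphism chosen by `carry` may be replaced by any other over D with the
  -- same effect on a. The heap laws follow by choosing convenient ones, such as the identity or a
  -- composite.
  torsor-$ : ∀ {x a b} → P x → P a → P b → ∀ τ → Fixes M D τ → _$ᵗ_ M τ a ≡ x →
             torsor x a b ≡ _$ᵗ_ M τ b
  torsor-$ {x} {a} {b} Px Pa Pb τ τ-fix τa≡x with em {P = P a × P x}
  ... | no none = ⊥-elim (none (Pa , Px))
  ... | yes (Pa′ , Px′) =
    let σ , σ-fix , σa≡x = carry Pa′ Px′
    in agree Pa Pb σ τ σ-fix τ-fix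
             (trans σa≡x (sym τa≡x))

  module _ {x a b : Tuple M Γ} (Px : P x) (Pa : P a) (Pb : P b) where
    torsor-by : Σ[ τ ∈ Automorphism M ] Fixes M D τ × _$ᵗ_ M τ a ≡ x × torsor x a b ≡ _$ᵗ_ M τ b
    torsor-by =
      let τ , τ-fix , τa≡x = carry Pa Px
      in τ , τ-fix , τa≡x ,
         torsor-$ Px Pa Pb τ τ-fix τa≡x

    torsor-P : P (torsor x a b)
    torsor-P = let τ , τ-fix , _ , eq = torsor-by
               in subst P (sym eq) ($-P τ τ-fix Pb)

    torsor-value : ∀ {F c} → 𝒞^ (proj₁ F) c → Value F c a b → Value F c x (torsor x a b)
    torsor-value {F} {c} 𝒞c val =
      let τ , τ-fix , τa≡x , eq = torsor-by
      in subst₂ (Value F c) τa≡x (sym eq) (value-$ τ τ-fix F 𝒞c val)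

  -- The same F and c serve both values. The finite list `funs` turns the choice of F into a
  -- first-order disjunction, and it suffices because it links any two points of P.
  TorsorGraph : Tuple M Γ → Tuple M Γ → Tuple M Γ → Tuple M Γ → Set ℓ
  TorsorGraph x a b z = Any (λ F → ∃[ c ] 𝒞^ (proj₁ F) c × Value F c a b × Value F c x z) funs

  torsorGraphᴰ : ∀ {Γs} (x a b z : Γ ∋ Γs) →
    DefE B Γs (λ e → TorsorGraph (All.lookup e x) (All.lookup e a) (All.lookup e b) (All.lookup e z))
  torsorGraphᴰ {Γs} x a b z = go funs
    where
    go : ∀ Fs → DefE B Γs (λ e → Any (λ F → ∃[ c ] 𝒞^ (proj₁ F) c ×
           Value F c (All.lookup e a) (All.lookup e b) × Value F c (All.lookup e x) (All.lookup e z)) Fs)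
    go []       = respᴰ (λ e → mk⇔ (λ ¬⊤ → ⊥-elim (¬⊤ _)) (λ ())) (¬ᴰ ⊤ᴰ {X = λ _ → ⊤} (λ _ → _))
    go (F ∷ Fs) = respᴰ (λ e → mk⇔ [ here , there ] (λ { (here h) → inj₁ h ; (there h) → inj₂ h }))
      (∃ᴰ (pow (proj₁ F)) (fromDefinable (𝒞^-def (proj₁ F)) v₀ ×ᴰ
         valueᴰ F v₀ (there a) (there b) ×ᴰ valueᴰ F v₀ (there x) (there z)) ⊎ᴰ go Fs)

  torsorGraph⇔ : ∀ {x a b z} → P x → P a → P b → P z → TorsorGraph x a b z ⇔ (torsor x a b ≡ z)
  torsorGraph⇔ {x} {a} {b} {z} Px Pa Pb Pz = mk⇔ to
    (λ eq → from eq (linked-by-funs Pa Pb))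
    where
    value-at-x : ∀ {F c} → 𝒞^ (proj₁ F) c → Value F c a b → Value F c x (torsor x a b)
    value-at-x = torsor-value Px Pa Pb

    to : ∀ {Fs} → Any (λ F → ∃[ c ] 𝒞^ (proj₁ F) c × Value F c a b × Value F c x z) Fs → torsor x a b ≡ z
    to (here (c , 𝒞c , val , val′)) = value-unique (value-at-x 𝒞c val) val′
    to (there any)                  = to any

    from : torsor x a b ≡ z → ∀ {Fs} → Any (λ F → Links F a b) Fs →
           Any (λ F → ∃[ c ] 𝒞^ (proj₁ F) c × Value F c a b × Value F c x z) Fs
    from refl (here (c , 𝒞c , val)) = here (c , 𝒞c , val , value-at-x 𝒞c val)
    from eq   (there any)           = there (from eq any)

  heap : DefinableHeap em M B P
  heap = record
    { T       = torsor
    ; T-P     = λ Px Pa Pb → torsor-P Px Pa Pb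
    ; T-xxy   = λ {x} {y} Px Py →
        trans (torsor-$ Px Px Py (idᴬ M) (λ _ → refl) (idᴬ-$ᵗ M x))
              (idᴬ-$ᵗ M y)
    ; T-xyy   = λ Px Py →
        let τ , _ , τy≡x , eq = torsor-by Px Py Py
        in trans eq τy≡x
    ; T-assoc = λ {v} {w} {x} {y} {z} Pv Pw Px Py Pz → assoc
        Pv Pw Px Py Pz
    ; Graph   = TorsorGraph
    ; graphᴰ  = torsorGraphᴰ
    ; graph⇔  = λ Px Pa Pb Pz →
        torsorGraph⇔ Px Pa Pb Pz
    }
    where
    -- If σ takes y to x and τ takes w to v, then τ ∘ σ takes y to τ x = v w⁻¹ x. Both sides are
    -- therefore the image of z under τ ∘ σ.
    assoc : ∀ {v w x y z} → P v → P w → P x → P y → P z →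
            torsor v w (torsor x y z) ≡ torsor (torsor v w x) y z
    assoc {v} {w} {x} {y} {z} Pv Pw Px Py Pz =
      let σ , σ-fix , σy≡x , eq = torsor-by Px Py Pz
          τ , τ-fix , τw≡v , eq′ = torsor-by Pv Pw Px
          τ$ : ∀ {u} → P u → torsor v w u ≡ _$ᵗ_ M τ u
          τ$ = λ {u} Pu → torsor-$ Pv Pw Pu τ τ-fix τw≡v
      in trans (τ$ (torsor-P Px Py Pz))
        (trans (cong (_$ᵗ_ M τ) eq)
        (trans (sym (∘ᴬ-$ᵗ M τ σ z))
        (sym (torsor-$ (torsor-P Pv Pw Px)
               Py Pz (_∘ᴬ_ M τ σ)
               (λ c → trans (cong (Automorphism.to τ) (σ-fix c)) (τ-fix c))
               (trans (∘ᴬ-$ᵗ M τ σ y) (trans (cong (_$ᵗ_ M τ) σy≡x) (sym eq′)))))))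

  inhabitant : ∃ P
  inhabitant = proj₁ internal , proj₁ (proj₂ internal)

  module G = HeapGroup em ei M M⊨Th P-def inhabitant heap
  module H = HeapGroup em ei M M⊨Th P-def inhabitant (DefinableHeap.opposite heap)

  private
    module HG = Group (DefinableGroup.group H.translationGroup)

  -- The translations of the opposite heap form a group acting on the left; acting through inverses
  -- turns this into a right action of the same group.
  rightAction : RightAction (setoidOf M P) (DefinableGroup.group H.translationGroup)
  rightAction = record
    { _·_      = λ a h → (h HG.⁻¹) ·ᴴ a
    ; ·-cong   = λ {a} {b} {g} {h} a≡b g≡h →
        ·-cong {g HG.⁻¹} {h HG.⁻¹} {a} {b} (HG.⁻¹-cong {g} {h} g≡h) a≡b
    ; identity = λ a → trans (·-cong {HG.ε HG.⁻¹} {HG.ε} {a} {a} ε⁻¹≈ε refl) (identity a)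
    ; assoc    = λ a g h →
        trans (·-cong {(g HG.∙ h) HG.⁻¹} {(h HG.⁻¹) HG.∙ (g HG.⁻¹)} {a} {a} (⁻¹-anti-homo-∙ g h) refl)
              (assoc (h HG.⁻¹) (g HG.⁻¹) a)
    }
    where
    open LeftAction H.action renaming (_·_ to _·ᴴ_)
    open GroupProperties (DefinableGroup.group H.translationGroup)

  -- This removes the inverse from the right action: its graph is the graph of the left action with
  -- source and target exchanged, hence definable.
  ⁻¹-⊙⇔ : ∀ (h : HG.Carrier) {x y} → P x → P y → ((h HG.⁻¹) H.⊙ x ≡ y) ⇔ (h H.⊙ y ≡ x)
  ⁻¹-⊙⇔ h {x} {y} Px Py = mk⇔
    (λ eq → trans (cong (h H.⊙_) (sym eq))
           (trans (sym (assoc h (h HG.⁻¹) (x , Px)))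
           (trans (·-cong {h HG.∙ (h HG.⁻¹)} {HG.ε} {x , Px} {x , Px}
                     (HG.inverseʳ h) refl)
                  (identity (x , Px)))))
    (λ eq → trans (cong ((h HG.⁻¹) H.⊙_) (sym eq))
           (trans (sym (assoc (h HG.⁻¹) h (y , Py)))
           (trans (·-cong {(h HG.⁻¹) HG.∙ h} {HG.ε} {y , Py} {y , Py}
                     (HG.inverseˡ h) refl)
                  (identity (y , Py)))))
    where open LeftAction H.action

  rightAction-uniquelyTransitive : RightAction.UniquelyTransitive rightAction
  rightAction-uniquelyTransitive (a , Pa) (b , Pb) =
    h , Equivalence.from (⁻¹-⊙⇔ h Pa Pb) hb≡a ,
    λ {k} ak≡b → H.⊙-injective h k Pb
      (trans hb≡a (sym (Equivalence.to (⁻¹-⊙⇔ k Pa Pb) ak≡b)))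
    where
    h : HG.Carrier
    -- It takes b to a and not a to b, because the right action applies the inverse.
    h = H.move Pb Pa

    hb≡a : h H.⊙ b ≡ a
    hb≡a = H.move-⊙ Pb Pa

  -- The translations x ↦ b a⁻¹ x and x ↦ x c⁻¹ d commute.
  isBitorsor : IsBitorsor G.action rightAction
  isBitorsor = record
    { left-uniquelyTransitive  = G.action-uniquelyTransitive
    ; right-uniquelyTransitive = rightAction-uniquelyTransitive
    ; compatible = λ (_ , a , b , Pa , Pb , _) (x , Px) h →
        sym (commute Pa Pb Px (h HG.⁻¹))
    }
    where
    commute : ∀ {a b x} → P a → P b → P x → ∀ k → torsor b a (k H.⊙ x) ≡ k H.⊙ torsor b a x
    commute Pa Pb Px (_ , c , d , Pc , Pd , _) =
      DefinableHeap.T-assoc heap Pb Pa Px Pc Pd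

  bitorsor : DefinableBitorsor M B P
  bitorsor = record
    { G               = G.translationGroup
    ; H               = H.translationGroup
    ; S-definable     = P-def
    ; left            = G.action
    ; right           = rightAction
    ; isBitorsor      = isBitorsor
    ; left-definable  = G.action-definable
    ; right-definable = H.relativelyDefinable {X = P} {H.Translation} {P} {RightAction._·_ rightAction}
        {λ a h b → H.Acts h b a} (H.actsᴰ v₁ v₂ v₀)
        (λ (a , Pa) h (b , Pb) →
          let module l = Equivalence (H.acts⇔ h {b} {a} Pb Pa)
              module r = Equivalence (⁻¹-⊙⇔ h {a} {b} Pa Pb)
          in mk⇔ (r.from ∘ l.to) (l.from ∘ r.to))
    }

  private
    module AG = Group (AutGroup M p 𝒞)

    induced : ∃ G.Translation → AG.Carrier
    induced (_ , a , b , Pa , Pb , _) =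
      let σ , fix , _ = carry Pa Pb in σ , fix

    induced-⊙ : ∀ g {x} → P x → g G.⊙ x ≡ _$ᵗ_ M (proj₁ (induced g)) x
    induced-⊙ (_ , a , b , Pa , Pb , _) Px =
      let σ , fix , σa≡b = carry Pa Pb
      in torsor-$ Pb Pa Px σ fix σa≡b

    module GG = Group (DefinableGroup.group G.translationGroup)

    induced-cong : ∀ g h → proj₁ g ≡ proj₁ h → induced g AG.≈ induced h
    induced-cong g h g≡h Px =
      trans (sym (induced-⊙ g Px))
     (trans (G.⊙-cong g h g≡h Px) (induced-⊙ h Px))

    induced-≈ : ∀ g τ → (∀ {x} → P x → g G.⊙ x ≡ _$ᵗ_ M (proj₁ τ) x) → induced g AG.≈ τ
    induced-≈ g τ h Px = trans (sym (induced-⊙ g Px)) (h Px)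

  isBindingGroup : IsBindingGroup M p 𝒞 G.translationGroup G.action
  isBindingGroup = record
    { faithful         = λ g h eq → G.⊙-injective g h (proj₂ inhabitant) (eq inhabitant)
    ; action-definable = G.action-definable
    ; ⟦_⟧              = induced
    ; isIsomorphism    = record
      { isGroupMonomorphism = record
        { isGroupHomomorphism = record
          { isMonoidHomomorphism = record
            { isMagmaHomomorphism = record
              { isRelHomomorphism = record { cong = λ {g} {h} → induced-cong g h }
              ; homo = λ g h → induced-≈ (g GG.∙ h) (induced g AG.∙ induced h) (λ {x} Px →
                  trans (LeftAction.assoc G.action g h (x , Px))
                 (trans (induced-⊙ g (G.⊙-P h Px))
                 (trans (cong (_$ᵗ_ M (proj₁ (induced g))) (induced-⊙ h Px))
                        (sym (∘ᴬ-$ᵗ M (proj₁ (induced g)) (proj₁ (induced h)) x)))))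
              }
            ; ε-homo = induced-≈ GG.ε AG.ε (λ {x} Px →
                trans (LeftAction.identity G.action (x , Px)) (sym (idᴬ-$ᵗ M x)))
            }
          ; ⁻¹-homo = λ g → induced-≈ (g GG.⁻¹) (induced g AG.⁻¹) (λ {x} Px →
              let y = (g GG.⁻¹) G.⊙ x
                  Py : P y
                  Py = G.⊙-P (g GG.⁻¹) Px
              in trans (sym (⁻¹ᴬ-$ᵗ-$ᵗ M (proj₁ (induced g)) y))
                   (cong (_$ᵗ_ M (_⁻¹ᴬ M (proj₁ (induced g))))
                     (trans (sym (induced-⊙ g Py))
                     (trans (sym (LeftAction.assoc G.action g (g GG.⁻¹) (x , Px)))
                     (trans (G.⊙-cong (g GG.∙ (g GG.⁻¹)) GG.ε (GG.inverseʳ g) Px)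
                            (LeftAction.identity G.action (x , Px)))))))
          }
        ; injective = λ {g} {h} eq → G.⊙-injective g h (proj₂ inhabitant)
            (trans (induced-⊙ g (proj₂ inhabitant))
            (trans (eq (proj₂ inhabitant)) (sym (induced-⊙ h (proj₂ inhabitant)))))
        }
      ; surjective = λ (σ , fix) → from-automorphism σ fix ,
          λ {g} g≈ Px → trans (induced-cong g (from-automorphism σ fix) g≈ Px)
            (trans (sym (induced-⊙ (from-automorphism σ fix) Px))
                   (torsor-$ ($-P σ fix (proj₂ inhabitant)) (proj₂ inhabitant)
                             Px σ fix refl))
      }
    ; respects-action  = λ g (_ , Px) → induced-⊙ g Px
    }
    where
    -- The translation taking the base point to its image under σ. The automorphism it induces
    -- agrees with σ at that point, and so on all of P.
    from-automorphism : ∀ σ → Fixes M D σ → ∃ G.Translation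
    from-automorphism σ fix = G.move (proj₂ inhabitant)
      ($-P σ fix (proj₂ inhabitant))

  -- The translation x ↦ x a⁻¹ b is determined by c ∈ 𝒞^ n whenever b is the
  -- value at a of a partial function with parameter c.
  H⊆dcl : ∀ h → H.Translation h → Coords M h ⊆ dcl M (B ∪ CoordsOf M 𝒞)
  H⊆dcl h (a , b , Pa , Pb , eq) {s , d} (i , refl) =
    let F , c , 𝒞c , val = linked Pa Pb
        φ , φ⇔ = defining F c 𝒞c
    in φ ,
       Equivalence.from (φ⇔ (All.lookup h i ∷ []))
         (h , (b , a , Pa , Pb , val , eq) , refl) ,
       λ d′ φd′ →
         let h′ , (b′ , a′ , Pa′ , Pb′ , val′ , eq′) , h′≡d′ = Equivalence.to (φ⇔ (d′ ∷ [])) φd′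
         in trans (sym h′≡d′) (cong (λ w → All.lookup w i)
              (trans (sym eq′) (trans (same F c 𝒞c Pa′ Pb′ Pa Pb val′ val) eq)))
    where
    Sends : ∀ F → Tuple M (pow (proj₁ F)) → Tuple M H.Codes → Set ℓ
    Sends F c w = ∃[ b ] ∃[ a ] P a × P b × Value F c a b × H.translation a b ≡ w

    opaque
      defining : ∀ F c → 𝒞^ (proj₁ F) c →
                 Definable M D (λ (x : Tuple M (s ∷ [])) → ∃[ w ] Sends F c w × All.lookup w i ≡ All.lookup x v₀)
      defining F c 𝒞c = toDefinable (fill c (inj₂ ∘ 𝒞^⊆ (proj₁ F) c 𝒞c)
        (∃ᴰ H.Codes (monoᴰ inj₁ (∃ᴰ Γ (∃ᴰ Γ
           (fromDefinable P-def v₀ ×ᴰ fromDefinable P-def v₁ ×ᴰ valueᴰ F v₃ v₀ v₁ ×ᴰ H.translationᴰ v₀ v₁ v₂)))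
         ×ᴰ coord≡ᴰ v₀ i v₂ v₀)))

    -- For any a, b with b = F(c , a) the point x a⁻¹ b is the value of F at (c , x), an expression
    -- in which a and b no longer occur.
    same : ∀ F c → 𝒞^ (proj₁ F) c → ∀ {a b a′ b′} → P a → P b → P a′ → P b′ →
           Value F c a b → Value F c a′ b′ → H.translation a b ≡ H.translation a′ b′
    same F c 𝒞c Pa Pb Pa′ Pb′ val val′ =
      H.translation-cong Pa Pb Pa′ Pb′ (λ x Px →
        value-unique (torsor-value Px Pa Pb 𝒞c val)
                     (torsor-value Px Pa′ Pb′ 𝒞c val′))

theorem2p12 : (∀ {a} → ExcludedMiddle a) →
    ∀ {ℓ : Level} {L : Language ℓ} (T : Pred (Sentence L) ℓ) →
    Complete T → TotallyTranscendental T → QuantifierElimination T → EliminationOfImaginaries T →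
    (M : Structure L) → M ⊨ᵀ T →
    (κ : Cardinal ℓ) → SaturatedIn M κ →
    (B : Pred (Element M) ℓ) → SmallerThan κ B →
    {Θ : Context L} (𝒞 : Pred (Tuple M Θ) ℓ) → Definable M B 𝒞 →
    {Γ : Context L} (p : CompleteType M B Γ) →
    FundamentalInternal M p 𝒞 → WeaklyOrthogonal M p 𝒞 →
    Σ[ 𝓑 ∈ DefinableBitorsor M B (Realisations M (CompleteType.formulas p)) ]
    IsBindingGroup M p 𝒞 (DefinableBitorsor.G 𝓑) (DefinableBitorsor.left 𝓑) ×
    (∀ h → h ∈ DefinableGroup.set (DefinableBitorsor.H 𝓑) →
    Coords M h ⊆ dcl M (B ∪ CoordsOf M 𝒞))
theorem2p12 em T _ tt _ ei M M⊨T κ saturatedIn B B-small 𝒞 𝒞-def p internal orthogonal =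
  bitorsor , isBindingGroup , H⊆dcl
  where
  -- Total transcendence bounds Morley rank in ℵ₀-saturated models; M is one, since the coordinates
  -- of a finite tuple form a small set.
  open BindingGroup em ei M M⊨T κ saturatedIn
    (tt M M⊨T (SmallTuples.ℵ₀-saturated em M κ saturatedIn)) B-small 𝒞-def p internal orthogonal
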